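{- (i) There is an absolute constant $C>0$ such that the following holds. Let $p$ be a prime, $R\subseteq \mathbb{F}_p^*$ a multiplicative subgroup and $l\ge 4$ an integer. If $|R| \ge C \min\{ p^{\frac{2l+2}{5l-3}}, p^{\frac{l+5}{3l+3}} \}$, then $\mathbb{F}^*_p \subseteq lR$. (ii) Let $p$ be a prime, $R\subseteq \mathbb{F}_p^*$ a multiplicative subgroup and $l\ge 2$ an integer. If $|R|>p^{\frac{l+1}{2l}}$, then $\mathbb{F}^*_p \subseteq lR$.
   Context: $lR=\{r_1+\dots+r_l : r_i\in R\}$ denotes the $l$-fold sumset of $R$. -}

module Defs where

open import Data.Nat as ℕ using (ℕ; NonZero)
open import Data.Nat.DivMod using (_mod_)
open import Data.Integer using (+_)
open import Data.Rational as ℚ using (ℚ)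
open import Data.Fin using (Fin; toℕ)
open import Data.Fin.Subset using (Subset; _∈_; _∉_)
open import Data.Vec.Functional using (Vector; foldr)
open import Data.Sum using (_⊎_)
open import Data.Product using (_×_; ∃-syntax)
open import Relation.Binary.PropositionalEquality using (_≡_; _≢_)
open import Algebra.Definitions.RawSemiring ℚ.+-*-rawSemiring using () renaming (_^_ to _^ℚ_)

-- The field 𝔽ₚ is Fin p with arithmetic modulo p.
module _ {p : ℕ} .{{_ : NonZero p}} where

  infixl 6 _⊕_
  infixl 7 _⊗_

  _⊕_ _⊗_ : Fin p → Fin p → Fin p
  x ⊕ y = (toℕ x ℕ.+ toℕ y) mod p
  x ⊗ y = (toℕ x ℕ.* toℕ y) mod p

  𝟘 𝟙 : Fin p
  𝟘 = 0 mod p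
  𝟙 = 1 mod p

  𝔽* : Fin p → Set
  𝔽* x = x ≢ 𝟘

  record IsMultiplicativeSubgroup (R : Subset p) : Set where
    field
      R⊆𝔽*      : ∀ {x} → x ∈ R → 𝔽* x
      𝟙∈R       : 𝟙 ∈ R
      ⊗-closed  : ∀ {x y} → x ∈ R → y ∈ R → x ⊗ y ∈ R
      ⁻¹-closed : ∀ {x} → x ∈ R → ∃[ y ] (y ∈ R × x ⊗ y ≡ 𝟙)

  Σ𝔽 : ∀ {l} → Vector (Fin p) l → Fin p
  Σ𝔽 = foldr _⊕_ 𝟘

  infix 8 _-fold-sumset_

  _-fold-sumset_ : ℕ → Subset p → Fin p → Set
  (l -fold-sumset R) x = ∃[ r ] ((∀ (i : Fin l) → r i ∈ R) × Σ𝔽 r ≡ x)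

fromℕ : ℕ → ℚ
fromℕ n = + n ℚ./ 1

-- C · n ^[ a / b ]≤ m and n ^[ a / b ]< m say C · n^(a/b) ≤ m and n^(a/b) < m
-- for the real power n^(a/b). Both sides being nonnegative, they are compared
-- through their b-th powers. Meaningful only for C ≥ 0 and b > 0.
infix 4 _·_^[_/_]≤_ _^[_/_]<_

_·_^[_/_]≤_ : ℚ → ℕ → ℕ → ℕ → ℕ → Set
C · n ^[ a / b ]≤ m = (C ^ℚ b) ℚ.* fromℕ (n ℕ.^ a) ℚ.≤ fromℕ (m ℕ.^ b)

_^[_/_]<_ : ℕ → ℕ → ℕ → ℕ → Set
n ^[ a / b ]< m = n ℕ.^ a ℕ.< m ℕ.^ b

-- C · min { n^(a/b) , k^(c/d) } ≤ m: for C ≥ 0, the minimum of two reals is at most a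
-- bound exactly when one of them is.
infix 4 _·min[_^_/_,_^_/_]≤_

_·min[_^_/_,_^_/_]≤_ : ℚ → ℕ → ℕ → ℕ → ℕ → ℕ → ℕ → ℕ → Set
C ·min[ n ^ a / b , k ^ c / d ]≤ m = C · n ^[ a / b ]≤ m ⊎ C · k ^[ c / d ]≤ m

{-# OPTIONS --safe #-}

-- Write t = |R|, let T be convolution with the indicator of R, N(a) = #{(x, y) ∈ R² : y − x = a} and
-- E = Σ N(a)². Instead of exponential sums, T is bounded on functions g of mean zero through the
-- identity Σ_m Σ_c (Σ_y w(y) g(c − m y))² = p ‖w‖² ‖g‖². Restricting m to R, which acts trivially when
-- w is R-invariant, gives ‖T g‖² ≤ p ‖g‖² (w the indicator of R) and t ‖T g‖⁴ ≤ p E ‖g‖⁴ (w = N);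
-- weighting m by N gives ‖T g‖⁸ ≤ p E² ‖g‖⁸. If x ≠ 0 is not a sum of l elements of R, neither is any
-- element of xR, and pairing the balanced l-fold convolution of R with the indicator of xR bounds t^{l+1}
-- from above; the three estimates give the three exponents of the theorem.
--
-- The energy satisfies E² ≪ t⁵ for t ≪ p^{2/3} (Heath-Brown and Konyagin): scaling by a turns N(a) into
-- the number M(κ) of u with uᵗ = (u − 1)ᵗ = κ = a^{−t}, and Stepanov's method bounds the number of κ with
-- M(κ) ≥ τ. A nonzero Ψ = Σ P_{b,c} X^{tb} (X − 1)^{tc} with deg P_{b,c} < D is made to vanish to order D
-- at all these u by solving a homogeneous linear system with more unknowns than equations, and
-- Ψ ≠ 0 because a polynomial with k monomials has no zero of order k except at 0.

module Submission where

open import Defs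
open import Algebra.Bundles using (CommutativeRing; AbelianGroup)
open import Algebra.Structures using (IsCommutativeRing)
open import Data.Bool using (Bool; true; false)
open import Data.Fin as Fin using (Fin; zero; suc; toℕ; fromℕ<; combine; remQuot; funToFin; finToFun)
open import Data.Fin.Permutation using (permutation)
open import Data.Fin.Properties as Fin using (_≟_; suc-injective; toℕ-fromℕ<; toℕ-injective; toℕ<n; pigeonhole; finToFun-funToFin; funToFin-finToFin; remQuot-combine; any?)
open import Data.Fin.Subset using (Subset; _∈_; ∣_∣)
open import Data.Fin.Subset.Properties using (x∈p⇒∣p-x∣<∣p∣)
open import Data.Integer as ℤ using (ℤ; +_; 0ℤ; 1ℤ)
import Data.Integer.Properties as ℤ
open import Data.List as List using (List; []; _∷_; length; tabulate; upTo; _++_; allFin; filter)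
open import Data.List.Membership.Propositional using () renaming (_∈_ to _∈ˡ_; _∉_ to _∉ˡ_)
open import Data.List.Membership.Propositional.Properties using (∈-++⁺ˡ; ∈-++⁺ʳ; ∈-map⁺; ∈-upTo⁺; ∈-filter⁺; ∈-allFin)
import Data.List.Membership.DecPropositional as DecMembership
open import Data.List.Properties using (length-++; length-map; length-upTo; tabulate-cong)
open import Data.List.Relation.Unary.All as All using (All; []; _∷_)
import Data.List.Relation.Unary.All.Properties as All
open import Data.List.Relation.Unary.AllPairs using (AllPairs; []; _∷_)
open import Data.List.Relation.Unary.Any as Any using (here; there)
open import Data.List.Relation.Unary.Any.Properties using (lookup-index)
import Data.List.Relation.Unary.Unique.Propositional.Properties as Unique
open import Data.Nat as ℕ using (ℕ; zero; suc; NonZero; z≤n; s≤s)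
import Data.Nat.Properties as ℕ
open import Data.Nat.Coprimality using (prime⇒coprime; coprime-Bézout)
open import Data.Nat.DivMod using (_%_; _mod_; m<n⇒m%n≡m; %-distribˡ-+; %-distribˡ-*; m*n%n≡0)
open import Data.Nat.GCD using (module Bézout)
open import Data.Nat.Primality using (Prime; prime⇒nonTrivial)
open import Data.Product using (_,_; _×_; ∃-syntax; ∃₂; proj₁; proj₂; uncurry)
open import Data.Rational as ℚ using (ℚ; Positive)
import Data.Rational.Properties as ℚ
open import Data.Rational.Unnormalised as ℚᵘ using (mkℚᵘ; *≡*)
import Data.Rational.Unnormalised.Properties as ℚᵘ
open import Data.Sum using (_⊎_; inj₁; inj₂)
open import Data.Vec using (lookup; []; _∷_)
open import Data.Vec.Properties using ([]=⇒lookup; lookup⇒[]=)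
open import Function using (_∘_; id)
open import Level using (0ℓ; _⊔_)
open import Relation.Binary using (tri<; tri≈; tri>)
open import Relation.Binary.PropositionalEquality as ≡
open import Relation.Nullary using (yes; no; contradiction; ¬_; Dec; ¬?; _×-dec_; does)
open import Relation.Nullary.Decidable using (dec-true; dec-false; decidable-stable)
open import Relation.Unary using (Decidable; _⊆_)
open import Algebra.Definitions.RawSemiring ℚ.+-*-rawSemiring using () renaming (_^_ to _^ℚ_)


-- Averaging over dilates instead of characters keeps every quantity an integer: norms occur only
-- squared, means are cleared by a factor q, and each bound is proved in a power high enough to
-- avoid roots, so real exponents become comparisons of powers of natural numbers. For sums of l
-- terms, the operator bounds are spent on l - 3 applications of T. The two ends are cheaper: the
-- two-fold representation function and the adjoint of T applied to the indicator of xR both have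
-- squared norm at most E. With E² ≤ A t⁵ this gives t^(5l-3) ≤ A^(l+1) p^(2l+2) and t^(3l+3) ≤
-- A^(l+1) p^(l+5). Hence C = A suffices for the first part: C enters the hypothesis with exponent
-- 5l - 3 or 3l + 3, larger than l + 1. The obstacle is that Stepanov's method needs its monomials
-- to have degrees below p, which costs the condition 21 t³ ≤ p². For larger t the second part takes
-- over; there t ≥ 21⁵ absorbs the constant, and this follows from t ≥ C.

ind : Bool → ℕ
ind true  = 1
ind false = 0

-- Sums of integers and the Cauchy–Schwarz inequality

module Sumsℤ where

  open import Data.Integer public using (_+_; _*_; _-_; _≤_; -_; +≤+)
  open import Data.Integer.Tactic.RingSolver public using (solve-∀)
  open import Algebra.Properties.Semiring.Sum ℤ.+-*-semiring public using (*-distribˡ-sum; *-distribʳ-sum; ∑-distrib-+; ∑-comm; sum-permute; sum-cong-≗; sum-replicate-zero) renaming (sum to ∑)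
  open import Algebra.Properties.CommutativeSemigroup ℤ.*-commutativeSemigroup public using (interchange) renaming (x∙yz≈y∙xz to swap)

  ∑-mono-≤ : ∀ {n} {f g : Fin n → ℤ} → (∀ i → f i ≤ g i) → ∑ f ≤ ∑ g
  ∑-mono-≤ {zero}  f≤g = ℤ.≤-refl
  ∑-mono-≤ {suc n} f≤g = ℤ.+-mono-≤ (f≤g zero) (∑-mono-≤ (f≤g ∘ suc))

  ∑-nonneg : ∀ {n} {f : Fin n → ℤ} → (∀ i → 0ℤ ≤ f i) → 0ℤ ≤ ∑ f
  ∑-nonneg {n} {f} 0≤f = subst (_≤ ∑ f) (sum-replicate-zero n) (∑-mono-≤ 0≤f)

  ∑-zero : ∀ {n} {f : Fin n → ℤ} → (∀ i → f i ≡ 0ℤ) → ∑ f ≡ 0ℤ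
  ∑-zero {n} f≡0 = trans (sum-cong-≗ f≡0) (sum-replicate-zero n)

  ∑-const : ∀ {n} a → ∑ {n} (λ _ → a) ≡ + n * a
  ∑-const {zero}  a = sym (ℤ.*-zeroˡ a)
  ∑-const {suc n} a = trans (cong (_+_ a) (∑-const {n} a)) (sym (ℤ.suc-* (+ n) a))

  ∑-single : ∀ {n} {f : Fin n → ℤ} i → (∀ j → j ≢ i → f j ≡ 0ℤ) → ∑ f ≡ f i
  ∑-single {suc n} {f} zero    f≡0 = trans (cong (_+_ (f zero)) (∑-zero (λ j → f≡0 (suc j) λ ()))) (ℤ.+-identityʳ _)
  ∑-single {suc n} {f} (suc i) f≡0 = trans (cong₂ _+_ (f≡0 zero λ ())
    (∑-single i (λ j j≢i → f≡0 (suc j) (j≢i ∘ suc-injective)))) (ℤ.+-identityˡ _)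

  ∑∑-* : ∀ {m n} (f : Fin m → ℤ) (g : Fin n → ℤ) → ∑ (λ i → ∑ (λ j → f i * g j)) ≡ ∑ f * ∑ g
  ∑∑-* f g = trans (sum-cong-≗ (λ i → sym (*-distribˡ-sum (f i) g))) (sym (*-distribʳ-sum (∑ g) f))

  0≤sq : ∀ i → 0ℤ ≤ i * i
  0≤sq (+ n)      = subst (0ℤ ≤_) (ℤ.pos-* n n) (+≤+ z≤n)
  0≤sq (ℤ.-[1+ n ]) = +≤+ z≤n

  0≤* : ∀ {i j} → 0ℤ ≤ i → 0ℤ ≤ j → 0ℤ ≤ i * j
  0≤* {+ m} {+ n} _ _ = subst (0ℤ ≤_) (ℤ.pos-* m n) (+≤+ z≤n)

  *-mono : ∀ {a b c d} → 0ℤ ≤ a → 0ℤ ≤ d → a ≤ b → c ≤ d → a * c ≤ b * d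
  *-mono {a} {b} {c} {d} 0≤a 0≤d a≤b c≤d = ℤ.≤-trans
    (ℤ.*-monoˡ-≤-nonNeg a {{ℤ.nonNegative 0≤a}} c≤d) (ℤ.*-monoʳ-≤-nonNeg d {{ℤ.nonNegative 0≤d}} a≤b)

  -- Lagrange's identity: twice the difference of the two sides is the double sum of w i w j (f i g
  -- j - f j g i)², whose terms are nonnegative. Doubling avoids restricting the sum to i < j.
  weighted-cauchy-schwarz : ∀ {n} (w f g : Fin n → ℤ) → (∀ i → 0ℤ ≤ w i) →
    ∑ (λ i → w i * (f i * g i)) * ∑ (λ i → w i * (f i * g i)) ≤
    ∑ (λ i → w i * (f i * f i)) * ∑ (λ i → w i * (g i * g i))
  weighted-cauchy-schwarz w f g 0≤w = ℤ.*-cancelˡ-≤-pos _ _ (+ 2) (ℤ.0≤i-j⇒j≤i (subst (0ℤ ≤_) expand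
      (∑-nonneg λ i → ∑-nonneg λ j → 0≤* (0≤* (0≤w i) (0≤w j)) (0≤sq (f i * g j - f j * g i)))))
    where
    A B C : _ → ℤ
    A i = w i * (f i * f i)
    B i = w i * (g i * g i)
    C i = w i * (f i * g i)
    pointwise : ∀ w w' f g f' g' → (w * w') * ((f * g' - f' * g) * (f * g' - f' * g)) ≡
      (w * (f * f)) * (w' * (g' * g')) + ((w * (g * g)) * (w' * (f' * f')) + - + 2 * (w * (f * g)) * (w' * (f' * g')))
    pointwise = solve-∀
    collect : ∀ a b c → a * b + (b * a + - + 2 * c * c) ≡ + 2 * (a * b) - + 2 * (c * c)
    collect = solve-∀
    open ≡-Reasoning
    expand : ∑ (λ i → ∑ (λ j → (w i * w j) * ((f i * g j - f j * g i) * (f i * g j - f j * g i))))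
           ≡ + 2 * (∑ A * ∑ B) - + 2 * (∑ C * ∑ C)
    expand = begin
      _ ≡⟨ sum-cong-≗ (λ i → sum-cong-≗ (λ j → pointwise (w i) (w j) (f i) (g i) (f j) (g j))) ⟩
      ∑ (λ i → ∑ (λ j → A i * B j + (B i * A j + - + 2 * C i * C j)))
        ≡⟨ sum-cong-≗ (λ i → trans (∑-distrib-+ (λ j → A i * B j) (λ j → B i * A j + - + 2 * C i * C j))
             (cong (_+_ (∑ (λ j → A i * B j))) (∑-distrib-+ (λ j → B i * A j) (λ j → - + 2 * C i * C j)))) ⟩
      ∑ (λ i → ∑ (λ j → A i * B j) + (∑ (λ j → B i * A j) + ∑ (λ j → - + 2 * C i * C j)))
        ≡⟨ trans (∑-distrib-+ (λ i → ∑ (λ j → A i * B j)) _) (cong (_+_ (∑ (λ i → ∑ (λ j → A i * B j))))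
             (∑-distrib-+ (λ i → ∑ (λ j → B i * A j)) (λ i → ∑ (λ j → - + 2 * C i * C j)))) ⟩
      ∑ (λ i → ∑ (λ j → A i * B j)) + (∑ (λ i → ∑ (λ j → B i * A j)) + ∑ (λ i → ∑ (λ j → - + 2 * C i * C j)))
        ≡⟨ cong₂ _+_ (∑∑-* A B) (cong₂ _+_ (∑∑-* B A) (trans (∑∑-* (λ i → - + 2 * C i) C)
             (cong (_* ∑ C) (sym (*-distribˡ-sum (- + 2) C))))) ⟩
      ∑ A * ∑ B + (∑ B * ∑ A + - + 2 * ∑ C * ∑ C) ≡⟨ collect (∑ A) (∑ B) (∑ C) ⟩
      + 2 * (∑ A * ∑ B) - + 2 * (∑ C * ∑ C) ∎

  ‖_‖² : ∀ {n} → (Fin n → ℤ) → ℤ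
  ‖ f ‖² = ∑ (λ i → f i * f i)

  cauchy-schwarz : ∀ {n} (f g : Fin n → ℤ) → ∑ (λ i → f i * g i) * ∑ (λ i → f i * g i) ≤ ‖ f ‖² * ‖ g ‖²
  cauchy-schwarz f g = subst₂ _≤_ (cong₂ _*_ (drop f g) (drop f g)) (cong₂ _*_ (drop f f) (drop g g))
    (weighted-cauchy-schwarz (λ _ → 1ℤ) f g (λ _ → +≤+ z≤n))
    where
    drop : ∀ f g → ∑ (λ i → 1ℤ * (f i * g i)) ≡ ∑ (λ i → f i * g i)
    drop f g = sum-cong-≗ (λ i → ℤ.*-identityˡ (f i * g i))

  0≤‖‖² : ∀ {n} (f : Fin n → ℤ) → 0ℤ ≤ ‖ f ‖²
  0≤‖‖² f = ∑-nonneg λ i → 0≤sq (f i)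

  ∑-ind : ∀ {n} (R : Subset n) → ∑ (λ x → + ind (lookup R x)) ≡ + ∣ R ∣
  ∑-ind []          = refl
  ∑-ind (true ∷ R)  = cong (_+_ 1ℤ) (∑-ind R)
  ∑-ind (false ∷ R) = trans (ℤ.+-identityˡ _) (∑-ind R)

-- Finite fields

-- The operations are abstract while the carrier stays `Fin q`: sums, permutations and the
-- pigeonhole principle apply to it directly, and the later arguments never unfold arithmetic modulo
-- p.
record FiniteField (q : ℕ) : Set where
  infixl 6 _⊞_
  infixl 7 _⊡_
  infix  8 ⊟_
  field
    _⊞_ _⊡_           : Fin q → Fin q → Fin q
    ⊟_                : Fin q → Fin q
    0F 1F             : Fin q
    isCommutativeRing : IsCommutativeRing _≡_ _⊞_ _⊡_ ⊟_ 0F 1F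
    inverse           : ∀ x → x ≢ 0F → ∃[ y ] x ⊡ y ≡ 1F
    1F≢0F             : 1F ≢ 0F

  commutativeRing : CommutativeRing 0ℓ 0ℓ
  commutativeRing = record { isCommutativeRing = isCommutativeRing }

module PrimeField (p : ℕ) .{{_ : NonZero p}} (p-prime : Prime p) where

  toℕ-mod : ∀ a → toℕ (a mod p) ≡ a % p
  toℕ-mod a = toℕ-fromℕ< _

  mod-cong : ∀ {a b} → a % p ≡ b % p → a mod p ≡ b mod p
  mod-cong {a} {b} eq = toℕ-injective (trans (toℕ-mod a) (trans eq (sym (toℕ-mod b))))

  mod-toℕ : ∀ (x : Fin p) → toℕ x mod p ≡ x
  mod-toℕ x = toℕ-injective (trans (toℕ-mod (toℕ x)) (m<n⇒m%n≡m (toℕ<n x)))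

  mod-⊕ : ∀ a b → (a mod p) ⊕ (b mod p) ≡ (a ℕ.+ b) mod p
  mod-⊕ a b = mod-cong (begin
    (toℕ (a mod p) ℕ.+ toℕ (b mod p)) % p ≡⟨ cong₂ (λ m n → (m ℕ.+ n) % p) (toℕ-mod a) (toℕ-mod b) ⟩
    (a % p ℕ.+ b % p) % p ≡⟨ %-distribˡ-+ a b p ⟨
    (a ℕ.+ b) % p ∎)
    where open ≡-Reasoning

  mod-⊗ : ∀ a b → (a mod p) ⊗ (b mod p) ≡ (a ℕ.* b) mod p
  mod-⊗ a b = mod-cong (begin
    (toℕ (a mod p) ℕ.* toℕ (b mod p)) % p ≡⟨ cong₂ (λ m n → (m ℕ.* n) % p) (toℕ-mod a) (toℕ-mod b) ⟩
    (a % p ℕ.* (b % p)) % p ≡⟨ %-distribˡ-* a b p ⟨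
    (a ℕ.* b) % p ∎)
    where open ≡-Reasoning

  ⊕-modˡ : ∀ a (x : Fin p) → (a mod p) ⊕ x ≡ (a ℕ.+ toℕ x) mod p
  ⊕-modˡ a x = trans (cong ((a mod p) ⊕_) (sym (mod-toℕ x))) (mod-⊕ a (toℕ x))

  ⊕-modʳ : ∀ (x : Fin p) b → x ⊕ (b mod p) ≡ (toℕ x ℕ.+ b) mod p
  ⊕-modʳ x b = trans (cong (_⊕ (b mod p)) (sym (mod-toℕ x))) (mod-⊕ (toℕ x) b)

  ⊗-modˡ : ∀ a (x : Fin p) → (a mod p) ⊗ x ≡ (a ℕ.* toℕ x) mod p
  ⊗-modˡ a x = trans (cong ((a mod p) ⊗_) (sym (mod-toℕ x))) (mod-⊗ a (toℕ x))

  ⊗-modʳ : ∀ (x : Fin p) b → x ⊗ (b mod p) ≡ (toℕ x ℕ.* b) mod p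
  ⊗-modʳ x b = trans (cong (_⊗ (b mod p)) (sym (mod-toℕ x))) (mod-⊗ (toℕ x) b)

  ⊕-comm : ∀ (x y : Fin p) → x ⊕ y ≡ y ⊕ x
  ⊕-comm x y = cong (_mod p) (ℕ.+-comm (toℕ x) (toℕ y))

  ⊗-comm : ∀ (x y : Fin p) → x ⊗ y ≡ y ⊗ x
  ⊗-comm x y = cong (_mod p) (ℕ.*-comm (toℕ x) (toℕ y))

  ⊕-assoc : ∀ (x y z : Fin p) → (x ⊕ y) ⊕ z ≡ x ⊕ (y ⊕ z)
  ⊕-assoc x y z = trans (⊕-modˡ _ z)
    (trans (cong (_mod p) (ℕ.+-assoc (toℕ x) (toℕ y) (toℕ z))) (sym (⊕-modʳ x _)))

  ⊗-assoc : ∀ (x y z : Fin p) → (x ⊗ y) ⊗ z ≡ x ⊗ (y ⊗ z)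
  ⊗-assoc x y z = trans (⊗-modˡ _ z)
    (trans (cong (_mod p) (ℕ.*-assoc (toℕ x) (toℕ y) (toℕ z))) (sym (⊗-modʳ x _)))

  ⊕-identityˡ : ∀ (x : Fin p) → 𝟘 ⊕ x ≡ x
  ⊕-identityˡ x = trans (⊕-modˡ 0 x) (mod-toℕ x)

  ⊗-identityˡ : ∀ (x : Fin p) → 𝟙 ⊗ x ≡ x
  ⊗-identityˡ x = trans (⊗-modˡ 1 x) (trans (cong (_mod p) (ℕ.*-identityˡ (toℕ x))) (mod-toℕ x))

  ⊗-distribˡ-⊕ : ∀ (x y z : Fin p) → x ⊗ (y ⊕ z) ≡ x ⊗ y ⊕ x ⊗ z
  ⊗-distribˡ-⊕ x y z = trans (⊗-modʳ x _)
    (trans (cong (_mod p) (ℕ.*-distribˡ-+ (toℕ x) (toℕ y) (toℕ z))) (sym (mod-⊕ _ _)))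

  ⊖_ : Fin p → Fin p
  ⊖ x = (p ℕ.∸ toℕ x) mod p

  multiple≡𝟘 : ∀ k → (k ℕ.* p) mod p ≡ 𝟘
  multiple≡𝟘 k = mod-cong (trans (m*n%n≡0 k p) (sym (m*n%n≡0 0 p)))

  ⊖-inverseˡ : ∀ (x : Fin p) → (⊖ x) ⊕ x ≡ 𝟘
  ⊖-inverseˡ x = trans (⊕-modˡ _ x)
    (trans (cong (_mod p) (trans (ℕ.m∸n+n≡m (ℕ.<⇒≤ (toℕ<n x))) (sym (ℕ.*-identityˡ p)))) (multiple≡𝟘 1))

  ⊕-⊗-isCommutativeRing : IsCommutativeRing _≡_ _⊕_ _⊗_ ⊖_ 𝟘 𝟙
  ⊕-⊗-isCommutativeRing = record
    { isRing = record
      { +-isAbelianGroup = record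
        { isGroup = record
          { isMonoid = record
            { isSemigroup = record
              { isMagma = record { isEquivalence = isEquivalence ; ∙-cong = cong₂ _⊕_ }
              ; assoc   = ⊕-assoc }
            ; identity = ⊕-identityˡ , λ x → trans (⊕-comm x 𝟘) (⊕-identityˡ x) }
          ; inverse = ⊖-inverseˡ , λ x → trans (⊕-comm x (⊖ x)) (⊖-inverseˡ x)
          ; ⁻¹-cong = cong ⊖_ }
        ; comm = ⊕-comm }
      ; *-cong     = cong₂ _⊗_
      ; *-assoc    = ⊗-assoc
      ; *-identity = ⊗-identityˡ , λ x → trans (⊗-comm x 𝟙) (⊗-identityˡ x)
      ; distrib    = ⊗-distribˡ-⊕ , λ x y z → trans (⊗-comm (y ⊕ z) x)
                       (trans (⊗-distribˡ-⊕ x y z) (cong₂ _⊕_ (⊗-comm x y) (⊗-comm x z))) }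
    ; *-comm = ⊗-comm }

  𝔽ₚ : CommutativeRing 0ℓ 0ℓ
  𝔽ₚ = record { isCommutativeRing = ⊕-⊗-isCommutativeRing }

  open import Algebra.Properties.Ring (CommutativeRing.ring 𝔽ₚ) using (-‿distribʳ-*; +-inverseˡ-unique)
  open import Algebra.Properties.Monoid.Mult (CommutativeRing.+-monoid 𝔽ₚ) using () renaming (_×_ to _·_)

  mod≢𝟘 : ∀ n → .{{NonZero n}} → n ℕ.< p → n mod p ≢ 𝟘
  mod≢𝟘 n n<p eq = ℕ.≢-nonZero⁻¹ n (begin
    n ≡⟨ m<n⇒m%n≡m n<p ⟨
    n % p ≡⟨ toℕ-mod n ⟨
    toℕ (n mod p) ≡⟨ cong toℕ eq ⟩
    toℕ (0 mod p) ≡⟨ toℕ-mod 0 ⟩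
    0 % p ≡⟨ m*n%n≡0 0 p ⟩
    0 ∎)
    where open ≡-Reasoning

  ·𝟙≡mod : ∀ n → n · 𝟙 ≡ n mod p
  ·𝟙≡mod zero    = refl
  ·𝟙≡mod (suc n) = trans (cong (𝟙 ⊕_) (·𝟙≡mod n)) (mod-⊕ 1 n)

  ·𝟙≢𝟘 : ∀ n → 0 ℕ.< n → n ℕ.< p → n · 𝟙 ≢ 𝟘
  ·𝟙≢𝟘 (suc n) _ n<p eq = mod≢𝟘 (suc n) n<p (trans (sym (·𝟙≡mod (suc n))) eq)

  ⊗-inverse : ∀ (x : Fin p) → x ≢ 𝟘 → ∃[ y ] x ⊗ y ≡ 𝟙
  ⊗-inverse x x≢𝟘 = go (toℕ x) refl
    where
    open ≡-Reasoning
    go : ∀ n → toℕ x ≡ n → ∃[ y ] x ⊗ y ≡ 𝟙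
    go zero    eq = contradiction (trans (sym (mod-toℕ x)) (cong (_mod p) eq)) x≢𝟘
    go (suc n) eq with coprime-Bézout (prime⇒coprime p-prime (subst (ℕ._< p) eq (toℕ<n x)))
    ... | Bézout.-+ a b id = b mod p , (begin
      x ⊗ (b mod p) ≡⟨ ⊗-modʳ x b ⟩
      (toℕ x ℕ.* b) mod p ≡⟨ cong (_mod p) (trans (cong (ℕ._* b) eq) (trans (ℕ.*-comm (suc n) b) (sym id))) ⟩
      (1 ℕ.+ a ℕ.* p) mod p ≡⟨ mod-⊕ 1 (a ℕ.* p) ⟨
      𝟙 ⊕ ((a ℕ.* p) mod p) ≡⟨ cong (𝟙 ⊕_) (multiple≡𝟘 a) ⟩
      𝟙 ⊕ 𝟘 ≡⟨ CommutativeRing.+-identityʳ 𝔽ₚ 𝟙 ⟩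
      𝟙 ∎)
    -- In this case Bézout's identity reads 1 + b x = a p, so b is the inverse of -x and its sign
    -- has to be changed.
    ... | Bézout.+- a b id = (⊖ (b mod p)) , (begin
      x ⊗ (⊖ (b mod p)) ≡⟨ -‿distribʳ-* x (b mod p) ⟨
      ⊖ (x ⊗ (b mod p)) ≡⟨ +-inverseˡ-unique 𝟙 (x ⊗ (b mod p)) (begin
        𝟙 ⊕ x ⊗ (b mod p) ≡⟨ cong (𝟙 ⊕_) (⊗-modʳ x b) ⟩
        𝟙 ⊕ ((toℕ x ℕ.* b) mod p) ≡⟨ mod-⊕ 1 _ ⟩
        (1 ℕ.+ toℕ x ℕ.* b) mod p ≡⟨ cong (λ m → (1 ℕ.+ m) mod p) (trans (cong (ℕ._* b) eq) (ℕ.*-comm (suc n) b)) ⟩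
        (1 ℕ.+ b ℕ.* suc n) mod p ≡⟨ cong (_mod p) id ⟩
        (a ℕ.* p) mod p ≡⟨ multiple≡𝟘 a ⟩
        𝟘 ∎) ⟨
      𝟙 ∎)

  𝟙≢𝟘 : 𝟙 ≢ 𝟘
  𝟙≢𝟘 = mod≢𝟘 1 (ℕ.nonTrivial⇒n>1 p {{prime⇒nonTrivial p-prime}})

-- Convolution estimates

module Convolution {q : ℕ} (𝔽 : FiniteField q) where

  open Sumsℤ
  open FiniteField 𝔽
  private module F = CommutativeRing commutativeRing

  cancelʳ : ∀ x a → x ⊞ a ⊞ ⊟ a ≡ x
  cancelʳ x a = trans (F.+-assoc x a _) (trans (cong (x ⊞_) (F.-‿inverseʳ a)) (F.+-identityʳ x))

  cancelʳ′ : ∀ x a → x ⊞ ⊟ a ⊞ a ≡ x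
  cancelʳ′ x a = trans (F.+-assoc x _ a) (trans (cong (x ⊞_) (F.-‿inverseˡ a)) (F.+-identityʳ x))

  ∑-shift : ∀ a (f : Fin q → ℤ) → ∑ f ≡ ∑ (λ x → f (x ⊞ a))
  ∑-shift a f = sum-permute f (permutation (_⊞ a) (_⊞ ⊟ a) (λ x → cancelʳ′ x a) (λ x → cancelʳ x a))

  ∑-dilate : ∀ m → m ≢ 0F → (f : Fin q → ℤ) → ∑ f ≡ ∑ (λ x → f (m ⊡ x))
  ∑-dilate m m≢0 f with inverse m m≢0
  ... | m⁻¹ , mm⁻¹≡1 = sum-permute f (permutation (m ⊡_) (m⁻¹ ⊡_)
        (cancel mm⁻¹≡1) (cancel (trans (F.*-comm m⁻¹ m) mm⁻¹≡1)))
    where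
    cancel : ∀ {a b} → a ⊡ b ≡ 1F → ∀ x → a ⊡ (b ⊡ x) ≡ x
    cancel {a} {b} ab≡1 x = trans (sym (F.*-assoc a b x)) (trans (cong (_⊡ x) ab≡1) (F.*-identityˡ x))

  correlation : (Fin q → ℤ) → Fin q → ℤ
  correlation g z = ∑ (λ c → g c * g (c ⊞ z))

  -- Convolution of g with the image of w under dilation by m. The parameter m stands in for a
  -- frequency: summing over all m plays the role of Plancherel's formula.
  conv : (Fin q → ℤ) → (Fin q → ℤ) → Fin q → Fin q → ℤ
  conv w g m c = ∑ (λ y → w y * g (c ⊞ ⊟ (m ⊡ y)))

  correlation-0 : ∀ g → correlation g 0F ≡ ‖ g ‖²
  correlation-0 g = sum-cong-≗ (λ c → cong (λ z → g c * g z) (F.+-identityʳ c))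

  ∑-shiftˡ : ∀ a (f : Fin q → ℤ) → ∑ f ≡ ∑ (λ x → f (a ⊞ x))
  ∑-shiftˡ a f = trans (∑-shift a f) (sum-cong-≗ (λ x → cong f (F.+-comm x a)))

  ∑-correlation : ∀ g → ∑ (correlation g) ≡ ∑ g * ∑ g
  ∑-correlation g = begin
    ∑ (λ z → ∑ (λ c → g c * g (c ⊞ z))) ≡⟨ ∑-comm (λ z c → g c * g (c ⊞ z)) ⟩
    ∑ (λ c → ∑ (λ z → g c * g (c ⊞ z))) ≡⟨ sum-cong-≗ (λ c → ∑-shiftˡ c (λ z → g c * g z)) ⟨
    ∑ (λ c → ∑ (λ z → g c * g z)) ≡⟨ ∑∑-* g g ⟩
    ∑ g * ∑ g ∎
    where open ≡-Reasoning

  ∑-conv : ∀ w g m → ∑ (conv w g m) ≡ ∑ w * ∑ g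
  ∑-conv w g m = begin
    ∑ (λ c → ∑ (λ y → w y * g (c ⊞ ⊟ (m ⊡ y)))) ≡⟨ ∑-comm (λ c y → w y * g (c ⊞ ⊟ (m ⊡ y))) ⟩
    ∑ (λ y → ∑ (λ c → w y * g (c ⊞ ⊟ (m ⊡ y)))) ≡⟨ sum-cong-≗ (λ y → ∑-shift (⊟ (m ⊡ y)) (λ c → w y * g c)) ⟨
    ∑ (λ y → ∑ (λ c → w y * g c)) ≡⟨ ∑∑-* w g ⟩
    ∑ w * ∑ g ∎
    where open ≡-Reasoning

  conv-inner : ∀ w g m → ∑ (λ c → g c * conv w g m c) ≡ ∑ (λ y → w y * correlation g (m ⊡ y))
  conv-inner w g m = begin
    ∑ (λ c → g c * conv w g m c)
      ≡⟨ sum-cong-≗ (λ c → *-distribˡ-sum (g c) (λ y → w y * g (c ⊞ ⊟ (m ⊡ y)))) ⟩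
    ∑ (λ c → ∑ (λ y → g c * (w y * g (c ⊞ ⊟ (m ⊡ y)))))
      ≡⟨ ∑-comm (λ c y → g c * (w y * g (c ⊞ ⊟ (m ⊡ y)))) ⟩
    ∑ (λ y → ∑ (λ c → g c * (w y * g (c ⊞ ⊟ (m ⊡ y)))))
      ≡⟨ sum-cong-≗ (λ y → ∑-shift (m ⊡ y) (λ c → g c * (w y * g (c ⊞ ⊟ (m ⊡ y))))) ⟩
    ∑ (λ y → ∑ (λ c → g (c ⊞ m ⊡ y) * (w y * g (c ⊞ m ⊡ y ⊞ ⊟ (m ⊡ y)))))
      ≡⟨ sum-cong-≗ (λ y → sum-cong-≗ (λ c → trans
           (cong (λ z → g (c ⊞ m ⊡ y) * (w y * g z)) (cancelʳ c (m ⊡ y)))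
           (rotate (g (c ⊞ m ⊡ y)) (w y) (g c)))) ⟩
    ∑ (λ y → ∑ (λ c → w y * (g c * g (c ⊞ m ⊡ y))))
      ≡⟨ sum-cong-≗ (λ y → *-distribˡ-sum (w y) (λ c → g c * g (c ⊞ m ⊡ y))) ⟨
    ∑ (λ y → w y * correlation g (m ⊡ y)) ∎
    where
    open ≡-Reasoning
    rotate : ∀ a b c → a * (b * c) ≡ b * (c * a)
    rotate = solve-∀

  -- Expanding the square and substituting s = r + y separates w from g: after c is shifted by m (r
  -- + y), the values of g depend on r and y only through m y.
  ‖conv‖² : ∀ w g m → ‖ conv w g m ‖² ≡ ∑ (λ y → correlation w y * correlation g (m ⊡ y))
  ‖conv‖² w g m = begin
    ∑ (λ c → conv w g m c * conv w g m c)
      ≡⟨ sum-cong-≗ (λ c → ∑∑-* (λ r → w r * G r c) (λ s → w s * G s c)) ⟨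
    ∑ (λ c → ∑ (λ r → ∑ (λ s → (w r * G r c) * (w s * G s c))))
      ≡⟨ sum-cong-≗ (λ c → sum-cong-≗ (λ r → ∑-shiftˡ r (λ s → (w r * G r c) * (w s * G s c)))) ⟩
    ∑ (λ c → ∑ (λ r → ∑ (λ y → (w r * G r c) * (w (r ⊞ y) * G (r ⊞ y) c))))
      ≡⟨ ∑-comm (λ c r → ∑ (λ y → (w r * G r c) * (w (r ⊞ y) * G (r ⊞ y) c))) ⟩
    ∑ (λ r → ∑ (λ c → ∑ (λ y → (w r * G r c) * (w (r ⊞ y) * G (r ⊞ y) c))))
      ≡⟨ sum-cong-≗ (λ r → ∑-comm (λ c y → (w r * G r c) * (w (r ⊞ y) * G (r ⊞ y) c))) ⟩
    ∑ (λ r → ∑ (λ y → ∑ (λ c → (w r * G r c) * (w (r ⊞ y) * G (r ⊞ y) c))))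
      ≡⟨ sum-cong-≗ (λ r → sum-cong-≗ (λ y → inner r y)) ⟩
    ∑ (λ r → ∑ (λ y → (w r * w (r ⊞ y)) * correlation g (m ⊡ y)))
      ≡⟨ ∑-comm (λ r y → (w r * w (r ⊞ y)) * correlation g (m ⊡ y)) ⟩
    ∑ (λ y → ∑ (λ r → (w r * w (r ⊞ y)) * correlation g (m ⊡ y)))
      ≡⟨ sum-cong-≗ (λ y → *-distribʳ-sum (correlation g (m ⊡ y)) (λ r → w r * w (r ⊞ y))) ⟨
    ∑ (λ y → correlation w y * correlation g (m ⊡ y)) ∎
    where
    open ≡-Reasoning
    G : Fin q → Fin q → ℤ
    G r c = g (c ⊞ ⊟ (m ⊡ r))
    regroup : ∀ a b c d → (a * b) * (c * d) ≡ (a * c) * (d * b)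
    regroup = solve-∀
    index : ∀ c r y → c ⊞ m ⊡ (r ⊞ y) ⊞ ⊟ (m ⊡ r) ≡ c ⊞ m ⊡ y
    index c r y = begin
      c ⊞ m ⊡ (r ⊞ y) ⊞ ⊟ (m ⊡ r) ≡⟨ cong (λ z → c ⊞ z ⊞ ⊟ (m ⊡ r)) (trans (F.distribˡ m r y) (F.+-comm _ _)) ⟩
      c ⊞ (m ⊡ y ⊞ m ⊡ r) ⊞ ⊟ (m ⊡ r) ≡⟨ cong (_⊞ ⊟ (m ⊡ r)) (F.+-assoc c _ _) ⟨
      c ⊞ m ⊡ y ⊞ m ⊡ r ⊞ ⊟ (m ⊡ r) ≡⟨ cancelʳ _ _ ⟩
      c ⊞ m ⊡ y ∎
    inner : ∀ r y → ∑ (λ c → (w r * G r c) * (w (r ⊞ y) * G (r ⊞ y) c)) ≡ (w r * w (r ⊞ y)) * correlation g (m ⊡ y)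
    inner r y = begin
      ∑ (λ c → (w r * G r c) * (w (r ⊞ y) * G (r ⊞ y) c))
        ≡⟨ ∑-shift (m ⊡ (r ⊞ y)) (λ c → (w r * G r c) * (w (r ⊞ y) * G (r ⊞ y) c)) ⟩
      ∑ (λ c → (w r * G r (c ⊞ m ⊡ (r ⊞ y))) * (w (r ⊞ y) * G (r ⊞ y) (c ⊞ m ⊡ (r ⊞ y))))
        ≡⟨ sum-cong-≗ (λ c → trans
             (cong₂ (λ z z′ → (w r * g z) * (w (r ⊞ y) * g z′)) (index c r y) (cancelʳ c _))
             (regroup (w r) (g (c ⊞ m ⊡ y)) (w (r ⊞ y)) (g c))) ⟩
      ∑ (λ c → (w r * w (r ⊞ y)) * (g c * g (c ⊞ m ⊡ y)))
        ≡⟨ *-distribˡ-sum (w r * w (r ⊞ y)) (λ c → g c * g (c ⊞ m ⊡ y)) ⟨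
      (w r * w (r ⊞ y)) * correlation g (m ⊡ y) ∎

  -- For y ≠ y′ the map (m, c) ↦ (c − m y, c − m y′) is a bijection of the plane, so off-diagonal terms
  -- contribute (∑ g)² = 0.
  ∑‖conv‖² : ∀ w g → ∑ g ≡ 0ℤ → ∑ (λ m → ‖ conv w g m ‖²) ≡ + q * (‖ w ‖² * ‖ g ‖²)
  ∑‖conv‖² w g ∑g≡0 = begin
    ∑ (λ m → ‖ conv w g m ‖²)
      ≡⟨ sum-cong-≗ (λ m → ‖conv‖² w g m) ⟩
    ∑ (λ m → ∑ (λ y → correlation w y * correlation g (m ⊡ y)))
      ≡⟨ ∑-comm (λ m y → correlation w y * correlation g (m ⊡ y)) ⟩
    ∑ (λ y → ∑ (λ m → correlation w y * correlation g (m ⊡ y)))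
      ≡⟨ sum-cong-≗ (λ y → *-distribˡ-sum (correlation w y) (λ m → correlation g (m ⊡ y))) ⟨
    ∑ (λ y → correlation w y * ∑ (λ m → correlation g (m ⊡ y)))
      ≡⟨ ∑-single 0F (λ y y≢0 → trans (cong (correlation w y *_) (off y y≢0)) (ℤ.*-zeroʳ (correlation w y))) ⟩
    correlation w 0F * ∑ (λ m → correlation g (m ⊡ 0F))
      ≡⟨ cong₂ _*_ (correlation-0 w) diagonal ⟩
    ‖ w ‖² * (+ q * ‖ g ‖²)
      ≡⟨ swap ‖ w ‖² (+ q) ‖ g ‖² ⟩
    + q * (‖ w ‖² * ‖ g ‖²) ∎
    where
    open ≡-Reasoning
    off : ∀ y → y ≢ 0F → ∑ (λ m → correlation g (m ⊡ y)) ≡ 0ℤ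
    off y y≢0 = begin
      ∑ (λ m → correlation g (m ⊡ y)) ≡⟨ sum-cong-≗ (λ m → cong (correlation g) (F.*-comm m y)) ⟩
      ∑ (λ m → correlation g (y ⊡ m)) ≡⟨ ∑-dilate y y≢0 (correlation g) ⟨
      ∑ (correlation g) ≡⟨ ∑-correlation g ⟩
      ∑ g * ∑ g ≡⟨ cong (λ z → z * ∑ g) ∑g≡0 ⟩
      0ℤ ∎
    diagonal : ∑ (λ m → correlation g (m ⊡ 0F)) ≡ + q * ‖ g ‖²
    diagonal = trans (sum-cong-≗ (λ m → trans (cong (correlation g) (F.zeroʳ m)) (correlation-0 g))) (∑-const {q} ‖ g ‖²)

-- Convolution operators and representation counts of a multiplicative subgroup

record IsSubgroup {q : ℕ} (𝔽 : FiniteField q) (R : Subset q) : Set where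
  open FiniteField 𝔽
  field
    R∌0        : ∀ {x} → x ∈ R → x ≢ 0F
    1∈R        : 1F ∈ R
    ⊡-closed   : ∀ {x y} → x ∈ R → y ∈ R → x ⊡ y ∈ R
    inv-closed : ∀ {x} → x ∈ R → ∃[ y ] (y ∈ R × x ⊡ y ≡ 1F)

module Subgroup {q : ℕ} (𝔽 : FiniteField q) (R : Subset q) (R-subgroup : IsSubgroup 𝔽 R) where

  open Sumsℤ
  open FiniteField 𝔽
  open IsSubgroup R-subgroup
  open Convolution 𝔽
  private module F = CommutativeRing commutativeRing
  open import Algebra.Properties.Ring F.ring using (-‿distribˡ-*; -‿distribʳ-*; -‿involutive)

  χ : Fin q → ℤ
  χ x = + ind (lookup R x)

  t : ℕ
  t = ∣ R ∣

  ∈⇒χ≡1 : ∀ {x} → x ∈ R → χ x ≡ 1ℤ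
  ∈⇒χ≡1 x∈R = cong (+_ ∘ ind) ([]=⇒lookup x∈R)

  χ-cases : ∀ x → x ∈ R ⊎ χ x ≡ 0ℤ
  χ-cases x with lookup R x in eq
  ... | true  = inj₁ (lookup⇒[]= x R eq)
  ... | false = inj₂ refl

  χ-idem : ∀ x → χ x * χ x ≡ χ x
  χ-idem x with lookup R x
  ... | true  = refl
  ... | false = refl

  0≤χ : ∀ x → 0ℤ ≤ χ x
  0≤χ x = +≤+ z≤n

  χ≤1 : ∀ x → χ x ≤ 1ℤ
  χ≤1 x with lookup R x
  ... | true  = ℤ.≤-refl
  ... | false = +≤+ z≤n

  Invariant : (Fin q → ℤ) → Set
  Invariant f = ∀ {m} → m ∈ R → ∀ x → f (m ⊡ x) ≡ f x

  ⊡-cancel : ∀ {a b} → a ⊡ b ≡ 1F → ∀ x → b ⊡ (a ⊡ x) ≡ x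
  ⊡-cancel {a} {b} ab≡1 x = begin
    b ⊡ (a ⊡ x) ≡⟨ F.*-assoc b a x ⟨
    b ⊡ a ⊡ x ≡⟨ cong (_⊡ x) (trans (F.*-comm b a) ab≡1) ⟩
    1F ⊡ x ≡⟨ F.*-identityˡ x ⟩
    x ∎
    where open ≡-Reasoning

  χ-invariant : Invariant χ
  χ-invariant {m} m∈R x with inv-closed m∈R
  ... | m⁻¹ , m⁻¹∈R , mm⁻¹≡1 with χ-cases x | χ-cases (m ⊡ x)
  ... | inj₁ x∈R | _         = trans (∈⇒χ≡1 (⊡-closed m∈R x∈R)) (sym (∈⇒χ≡1 x∈R))
  ... | inj₂ χ≡0 | inj₂ χ≡0′ = trans χ≡0′ (sym χ≡0)
  ... | inj₂ χ≡0 | inj₁ mx∈R = trans (∈⇒χ≡1 mx∈R)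
    (sym (∈⇒χ≡1 (subst (_∈ R) (⊡-cancel mm⁻¹≡1 x) (⊡-closed m⁻¹∈R mx∈R))))

  ∑χ : ∑ χ ≡ + t
  ∑χ = ∑-ind R

  ‖χ‖² : ‖ χ ‖² ≡ + t
  ‖χ‖² = trans (sum-cong-≗ χ-idem) ∑χ

  χ*-≡ : ∀ {a b : ℤ} x → (x ∈ R → a ≡ b) → χ x * a ≡ χ x * b
  χ*-≡ {a} {b} x eq with χ-cases x
  ... | inj₁ x∈R = cong (χ x *_) (eq x∈R)
  ... | inj₂ χ≡0 = trans (cong (_* a) χ≡0) (cong (_* b) (sym χ≡0))

  0<t : 0 ℕ.< t
  0<t = ℕ.≤-<-trans z≤n (x∈p⇒∣p-x∣<∣p∣ 1∈R)

  instance
    t-nonZero : ℕ.NonZero t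
    t-nonZero = ℕ.>-nonZero 0<t
    t-positive : ℤ.Positive (+ t)
    t-positive = ℤ.positive (ℤ.+<+ 0<t)

  N : Fin q → ℤ
  N = correlation χ

  0≤N : ∀ y → 0ℤ ≤ N y
  0≤N y = ∑-nonneg (λ c → 0≤* (0≤χ c) (0≤χ (c ⊞ y)))

  correlation-dilate : ∀ m → m ≢ 0F → ∀ f y → correlation (f ∘ (m ⊡_)) y ≡ correlation f (m ⊡ y)
  correlation-dilate m m≢0 f y = begin
    ∑ (λ c → f (m ⊡ c) * f (m ⊡ (c ⊞ y))) ≡⟨ sum-cong-≗ (λ c → cong (λ z → f (m ⊡ c) * f z) (F.distribˡ m c y)) ⟩
    ∑ (λ c → f (m ⊡ c) * f (m ⊡ c ⊞ m ⊡ y)) ≡⟨ ∑-dilate m m≢0 (λ c → f c * f (c ⊞ m ⊡ y)) ⟨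
    correlation f (m ⊡ y) ∎
    where open ≡-Reasoning

  correlation-cong : ∀ {f g} → (∀ x → f x ≡ g x) → ∀ y → correlation f y ≡ correlation g y
  correlation-cong f≗g y = sum-cong-≗ (λ c → cong₂ _*_ (f≗g c) (f≗g (c ⊞ y)))

  N-invariant : Invariant N
  N-invariant {m} m∈R y = trans (sym (correlation-dilate m (R∌0 m∈R) χ y)) (correlation-cong (χ-invariant m∈R) y)

  E : ℕ
  E = ℤ.∣ ‖ N ‖² ∣

  +E : + E ≡ ‖ N ‖²
  +E = ℤ.0≤i⇒+∣i∣≡i (0≤‖‖² N)

  conv-invariant : ∀ {w} → Invariant w → ∀ g {m} → m ∈ R → ∀ c → conv w g m c ≡ conv w g 1F c
  conv-invariant {w} w-inv g {m} m∈R c = begin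
    ∑ (λ y → w y * g (c ⊞ ⊟ (m ⊡ y)))
      ≡⟨ sum-cong-≗ (λ y → cong₂ (λ a z → a * g (c ⊞ ⊟ z)) (sym (w-inv m∈R y)) (sym (F.*-identityˡ (m ⊡ y)))) ⟩
    ∑ (λ y → w (m ⊡ y) * g (c ⊞ ⊟ (1F ⊡ (m ⊡ y))))
      ≡⟨ ∑-dilate m (R∌0 m∈R) (λ y → w y * g (c ⊞ ⊟ (1F ⊡ y))) ⟨
    conv w g 1F c ∎
    where open ≡-Reasoning

  -- By invariance all m in R give the same convolution, so the sum over all m contains t copies of
  -- the case m = 1; the other terms are nonnegative.
  t‖conv‖²≤ : ∀ {w} → Invariant w → ∀ g → ∑ g ≡ 0ℤ → + t * ‖ conv w g 1F ‖² ≤ + q * (‖ w ‖² * ‖ g ‖²)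
  t‖conv‖²≤ {w} w-inv g ∑g≡0 = begin
    + t * X ≡⟨ cong (_* X) ∑χ ⟨
    ∑ χ * X ≡⟨ *-distribʳ-sum X χ ⟩
    ∑ (λ m → χ m * X) ≡⟨ sum-cong-≗ (λ m → χ*-≡ m (λ m∈R →
              sym (sum-cong-≗ (λ c → cong (λ z → z * z) (conv-invariant w-inv g m∈R c))))) ⟩
    ∑ (λ m → χ m * ‖ conv w g m ‖²) ≤⟨ ∑-mono-≤ (λ m → ℤ.*-monoʳ-≤-nonNeg _ {{ℤ.nonNegative (0≤‖‖² (conv w g m))}} (χ≤1 m)) ⟩
    ∑ (λ m → 1ℤ * ‖ conv w g m ‖²) ≡⟨ sum-cong-≗ (λ m → ℤ.*-identityˡ ‖ conv w g m ‖²) ⟩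
    ∑ (λ m → ‖ conv w g m ‖²) ≡⟨ ∑‖conv‖² w g ∑g≡0 ⟩
    + q * (‖ w ‖² * ‖ g ‖²) ∎
    where
    open ℤ.≤-Reasoning
    X = ‖ conv w g 1F ‖²

  T : (Fin q → ℤ) → Fin q → ℤ
  T g = conv χ g 1F

  ‖T‖²≤q : ∀ g → ∑ g ≡ 0ℤ → ‖ T g ‖² ≤ + q * ‖ g ‖²
  ‖T‖²≤q g ∑g≡0 = ℤ.*-cancelˡ-≤-pos _ _ (+ t) (begin
    + t * ‖ T g ‖² ≤⟨ t‖conv‖²≤ χ-invariant g ∑g≡0 ⟩
    + q * (‖ χ ‖² * ‖ g ‖²) ≡⟨ cong (λ z → + q * (z * ‖ g ‖²)) ‖χ‖² ⟩
    + q * (+ t * ‖ g ‖²) ≡⟨ swap (+ q) (+ t) ‖ g ‖² ⟩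
    + t * (+ q * ‖ g ‖²) ∎)
    where open ℤ.≤-Reasoning

  -- For m = 1 this is ‖Tg‖² = ⟨g, T*T g⟩, with T*T identified as convolution with the
  -- autocorrelation N of R. Cauchy-Schwarz then trades a norm of `conv χ` for a norm of `conv N`.
  ‖convχ‖²-inner : ∀ g m → ‖ conv χ g m ‖² ≡ ∑ (λ c → g c * conv N g m c)
  ‖convχ‖²-inner g m = trans (‖conv‖² χ g m) (sym (conv-inner N g m))

  ‖convχ‖⁴≤ : ∀ g m → ‖ conv χ g m ‖² * ‖ conv χ g m ‖² ≤ ‖ g ‖² * ‖ conv N g m ‖²
  ‖convχ‖⁴≤ g m = subst (λ z → z * z ≤ ‖ g ‖² * ‖ conv N g m ‖²) (sym (‖convχ‖²-inner g m)) (cauchy-schwarz g (conv N g m))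

  t‖T‖⁴≤ : ∀ g → ∑ g ≡ 0ℤ → + t * (‖ T g ‖² * ‖ T g ‖²) ≤ + q * + E * (‖ g ‖² * ‖ g ‖²)
  t‖T‖⁴≤ g ∑g≡0 = begin
    + t * (‖ T g ‖² * ‖ T g ‖²) ≤⟨ ℤ.*-monoˡ-≤-nonNeg (+ t) (‖convχ‖⁴≤ g 1F) ⟩
    + t * (‖ g ‖² * ‖ conv N g 1F ‖²) ≡⟨ swap (+ t) ‖ g ‖² _ ⟩
    ‖ g ‖² * (+ t * ‖ conv N g 1F ‖²) ≤⟨ ℤ.*-monoˡ-≤-nonNeg ‖ g ‖² {{ℤ.nonNegative (0≤‖‖² g)}} (t‖conv‖²≤ N-invariant g ∑g≡0) ⟩
    ‖ g ‖² * (+ q * (‖ N ‖² * ‖ g ‖²)) ≡⟨ cong (λ z → ‖ g ‖² * (+ q * (z * ‖ g ‖²))) (sym +E) ⟩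
    ‖ g ‖² * (+ q * (+ E * ‖ g ‖²)) ≡⟨ regroup ‖ g ‖² (+ q) (+ E) ⟩
    + q * + E * (‖ g ‖² * ‖ g ‖²) ∎
    where
    open ℤ.≤-Reasoning
    regroup : ∀ a b c → a * (b * (c * a)) ≡ b * c * (a * a)
    regroup = solve-∀

  ∑N : ∑ N ≡ + t * + t
  ∑N = trans (∑-correlation χ) (cong₂ _*_ ∑χ ∑χ)

  -- The double sum over x and r involves only the product x r, so weight and dilation can exchange
  -- roles; afterwards each r in R contributes the same value because N is invariant.
  ∑N-conv : ∀ g c → ∑ (λ x → N x * conv χ g x c) ≡ + t * conv N g 1F c
  ∑N-conv g c = begin
    ∑ (λ x → N x * ∑ (λ r → χ r * g (c ⊞ ⊟ (x ⊡ r))))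
      ≡⟨ sum-cong-≗ (λ x → *-distribˡ-sum (N x) (λ r → χ r * g (c ⊞ ⊟ (x ⊡ r)))) ⟩
    ∑ (λ x → ∑ (λ r → N x * (χ r * g (c ⊞ ⊟ (x ⊡ r)))))
      ≡⟨ ∑-comm (λ x r → N x * (χ r * g (c ⊞ ⊟ (x ⊡ r)))) ⟩
    ∑ (λ r → ∑ (λ x → N x * (χ r * g (c ⊞ ⊟ (x ⊡ r)))))
      ≡⟨ sum-cong-≗ (λ r → trans (sum-cong-≗ (λ x → trans (swap (N x) (χ r) _)
           (cong (λ z → χ r * (N x * g (c ⊞ ⊟ z))) (F.*-comm x r))))
           (sym (*-distribˡ-sum (χ r) (λ x → N x * g (c ⊞ ⊟ (r ⊡ x)))))) ⟩
    ∑ (λ r → χ r * conv N g r c)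
      ≡⟨ sum-cong-≗ (λ r → χ*-≡ r (λ r∈R → conv-invariant N-invariant g r∈R c)) ⟩
    ∑ (λ r → χ r * conv N g 1F c)
      ≡⟨ *-distribʳ-sum (conv N g 1F c) χ ⟨
    ∑ χ * conv N g 1F c
      ≡⟨ cong (_* conv N g 1F c) ∑χ ⟩
    + t * conv N g 1F c ∎
    where open ≡-Reasoning

  -- By `∑N-conv`, `conv N g 1F` is t times the mean of `conv χ g x` for the weights N x, whose
  -- total mass is t². Jensen's inequality applies pointwise, and the two factors t² cancel.
  ‖convN‖²≤∑ : ∀ g → ‖ conv N g 1F ‖² ≤ ∑ (λ x → N x * ‖ conv χ g x ‖²)
  ‖convN‖²≤∑ g = ℤ.≤-trans (∑-mono-≤ jensen) (ℤ.≤-reflexive exchange)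
    where
    unit : ∀ a b → a * (b * 1ℤ) ≡ a * b
    unit a b = cong (a *_) (ℤ.*-identityʳ b)
    jensen : ∀ c → conv N g 1F c * conv N g 1F c ≤ ∑ (λ x → N x * (conv χ g x c * conv χ g x c))
    jensen c = ℤ.*-cancelˡ-≤-pos _ _ (+ t * + t)
      {{subst ℤ.Positive (ℤ.pos-* t t) (ℤ.positive (ℤ.+<+ (ℕ.*-mono-< 0<t 0<t)))}} (begin
        (+ t * + t) * (conv N g 1F c * conv N g 1F c)
          ≡⟨ interchange (+ t) (conv N g 1F c) (+ t) (conv N g 1F c) ⟨
        (+ t * conv N g 1F c) * (+ t * conv N g 1F c)
          ≡⟨ cong (λ z → z * z) (trans (sym (∑N-conv g c)) (sum-cong-≗ (λ x → sym (unit (N x) (conv χ g x c))))) ⟩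
        ∑ (λ x → N x * (conv χ g x c * 1ℤ)) * ∑ (λ x → N x * (conv χ g x c * 1ℤ))
          ≤⟨ weighted-cauchy-schwarz N (λ x → conv χ g x c) (λ _ → 1ℤ) 0≤N ⟩
        ∑ (λ x → N x * (conv χ g x c * conv χ g x c)) * ∑ (λ x → N x * (1ℤ * 1ℤ))
          ≡⟨ cong (∑ (λ x → N x * (conv χ g x c * conv χ g x c)) *_)
               (trans (sum-cong-≗ (λ x → ℤ.*-identityʳ (N x))) ∑N) ⟩
        ∑ (λ x → N x * (conv χ g x c * conv χ g x c)) * (+ t * + t)
          ≡⟨ ℤ.*-comm _ (+ t * + t) ⟩
        (+ t * + t) * ∑ (λ x → N x * (conv χ g x c * conv χ g x c)) ∎)
      where open ℤ.≤-Reasoning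
    exchange : ∑ (λ c → ∑ (λ x → N x * (conv χ g x c * conv χ g x c))) ≡ ∑ (λ x → N x * ‖ conv χ g x ‖²)
    exchange = trans (∑-comm (λ c x → N x * (conv χ g x c * conv χ g x c)))
      (sum-cong-≗ (λ x → sym (*-distribˡ-sum (N x) (λ c → conv χ g x c * conv χ g x c))))

  -- Cauchy-Schwarz splits off N, which gives one factor E. The sum of Q² is reduced by `‖convχ‖⁴≤`
  -- to the exact identity for `conv N` over all dilates, which supplies the second E and only one
  -- q.
  ‖convN‖⁴≤ : ∀ g → ∑ g ≡ 0ℤ →
    ‖ conv N g 1F ‖² * ‖ conv N g 1F ‖² ≤ + q * (+ E * + E) * (‖ g ‖² * ‖ g ‖²)
  ‖convN‖⁴≤ g ∑g≡0 = begin
    X * X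
      ≤⟨ *-mono (0≤‖‖² (conv N g 1F)) (∑-nonneg λ x → 0≤* (0≤N x) (0≤‖‖² (conv χ g x))) (‖convN‖²≤∑ g) (‖convN‖²≤∑ g) ⟩
    ∑ (λ x → N x * Q x) * ∑ (λ x → N x * Q x)
      ≤⟨ cauchy-schwarz N Q ⟩
    ‖ N ‖² * ‖ Q ‖²
      ≤⟨ ℤ.*-monoˡ-≤-nonNeg ‖ N ‖² {{ℤ.nonNegative (0≤‖‖² N)}} (∑-mono-≤ (‖convχ‖⁴≤ g)) ⟩
    ‖ N ‖² * ∑ (λ x → ‖ g ‖² * ‖ conv N g x ‖²)
      ≡⟨ cong (‖ N ‖² *_) (trans (sym (*-distribˡ-sum ‖ g ‖² (λ x → ‖ conv N g x ‖²))) (cong (‖ g ‖² *_) (∑‖conv‖² N g ∑g≡0))) ⟩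
    ‖ N ‖² * (‖ g ‖² * (+ q * (‖ N ‖² * ‖ g ‖²)))
      ≡⟨ cong (λ e → e * (‖ g ‖² * (+ q * (e * ‖ g ‖²)))) (sym +E) ⟩
    + E * (‖ g ‖² * (+ q * (+ E * ‖ g ‖²)))
      ≡⟨ regroup (+ E) ‖ g ‖² (+ q) ⟩
    + q * (+ E * + E) * (‖ g ‖² * ‖ g ‖²) ∎
    where
    open ℤ.≤-Reasoning
    X = ‖ conv N g 1F ‖²
    Q : Fin q → ℤ
    Q x = ‖ conv χ g x ‖²
    regroup : ∀ e g q → e * (g * (q * (e * g))) ≡ q * (e * e) * (g * g)
    regroup = solve-∀

  ‖T‖⁸≤ : ∀ g → ∑ g ≡ 0ℤ →
    (‖ T g ‖² * ‖ T g ‖²) * (‖ T g ‖² * ‖ T g ‖²) ≤ + q * (+ E * + E) * ((‖ g ‖² * ‖ g ‖²) * (‖ g ‖² * ‖ g ‖²))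
  ‖T‖⁸≤ g ∑g≡0 = begin
    (Y * Y) * (Y * Y) ≤⟨ *-mono (0≤sq Y) (0≤* (0≤‖‖² g) (0≤‖‖² (conv N g 1F))) (‖convχ‖⁴≤ g 1F) (‖convχ‖⁴≤ g 1F) ⟩
    (G * X) * (G * X) ≡⟨ interchange G X G X ⟩
    (G * G) * (X * X) ≤⟨ ℤ.*-monoˡ-≤-nonNeg (G * G) {{ℤ.nonNegative (0≤sq G)}} (‖convN‖⁴≤ g ∑g≡0) ⟩
    (G * G) * (+ q * (+ E * + E) * (G * G)) ≡⟨ regroup (G * G) (+ q * (+ E * + E)) ⟩
    + q * (+ E * + E) * ((G * G) * (G * G)) ∎
    where
    open ℤ.≤-Reasoning
    X = ‖ conv N g 1F ‖²
    Y = ‖ T g ‖²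
    G = ‖ g ‖²
    regroup : ∀ a b → a * (b * a) ≡ b * (a * a)
    regroup = solve-∀

  Tᵃ : (Fin q → ℤ) → Fin q → ℤ
  Tᵃ g = conv χ g (⊟ 1F)

  ⊟⊟1 : ∀ r → ⊟ (⊟ 1F ⊡ r) ≡ r
  ⊟⊟1 r = trans (cong ⊟_ (trans (sym (-‿distribˡ-* 1F r)) (cong ⊟_ (F.*-identityˡ r)))) (-‿involutive r)

  T-adjoint : ∀ f g → ∑ (λ c → T f c * g c) ≡ ∑ (λ c → f c * Tᵃ g c)
  T-adjoint f g = begin
    ∑ (λ c → T f c * g c)
      ≡⟨ sum-cong-≗ (λ c → *-distribʳ-sum (g c) (λ r → χ r * f (c ⊞ ⊟ (1F ⊡ r)))) ⟩
    ∑ (λ c → ∑ (λ r → χ r * f (c ⊞ ⊟ (1F ⊡ r)) * g c))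
      ≡⟨ ∑-comm (λ c r → χ r * f (c ⊞ ⊟ (1F ⊡ r)) * g c) ⟩
    ∑ (λ r → ∑ (λ c → χ r * f (c ⊞ ⊟ (1F ⊡ r)) * g c))
      ≡⟨ sum-cong-≗ (λ r → ∑-shift (1F ⊡ r) (λ c → χ r * f (c ⊞ ⊟ (1F ⊡ r)) * g c)) ⟩
    ∑ (λ r → ∑ (λ c → χ r * f (c ⊞ 1F ⊡ r ⊞ ⊟ (1F ⊡ r)) * g (c ⊞ 1F ⊡ r)))
      ≡⟨ sum-cong-≗ (λ r → sum-cong-≗ (λ c → trans
           (cong₂ (λ y z → χ r * f y * g z) (cancelʳ c (1F ⊡ r))
             (cong (c ⊞_) (trans (F.*-identityˡ r) (sym (⊟⊟1 r)))))
           (rotate (χ r) (f c) (g (c ⊞ ⊟ (⊟ 1F ⊡ r)))))) ⟩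
    ∑ (λ r → ∑ (λ c → f c * (χ r * g (c ⊞ ⊟ (⊟ 1F ⊡ r)))))
      ≡⟨ ∑-comm (λ r c → f c * (χ r * g (c ⊞ ⊟ (⊟ 1F ⊡ r)))) ⟩
    ∑ (λ c → ∑ (λ r → f c * (χ r * g (c ⊞ ⊟ (⊟ 1F ⊡ r)))))
      ≡⟨ sum-cong-≗ (λ c → *-distribˡ-sum (f c) (λ r → χ r * g (c ⊞ ⊟ (⊟ 1F ⊡ r)))) ⟨
    ∑ (λ c → f c * Tᵃ g c) ∎
    where
    open ≡-Reasoning
    rotate : ∀ a b c → a * b * c ≡ b * (a * c)
    rotate = solve-∀

  -- rep k x counts the representations of x as a sum of k + 1 elements of R.
  rep : ℕ → Fin q → ℤ
  rep zero    = χ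
  rep (suc k) = T (rep k)

  ∑-rep : ∀ k → ∑ (rep k) ≡ + (t ℕ.^ suc k)
  ∑-rep zero    = trans ∑χ (cong +_ (sym (ℕ.*-identityʳ t)))
  ∑-rep (suc k) = trans (∑-conv χ (rep k) 1F) (trans (cong₂ _*_ ∑χ (∑-rep k)) (sym (ℤ.pos-* t _)))

  T-invariant : ∀ {g} → Invariant g → Invariant (T g)
  T-invariant {g} g-inv {m} m∈R x = begin
    ∑ (λ y → χ y * g (m ⊡ x ⊞ ⊟ (1F ⊡ y))) ≡⟨ ∑-dilate m (R∌0 m∈R) (λ y → χ y * g (m ⊡ x ⊞ ⊟ (1F ⊡ y))) ⟩
    ∑ (λ y → χ (m ⊡ y) * g (m ⊡ x ⊞ ⊟ (1F ⊡ (m ⊡ y)))) ≡⟨ sum-cong-≗ (λ y → cong₂ _*_ (χ-invariant m∈R y)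
              (trans (cong g (index y)) (g-inv m∈R (x ⊞ ⊟ (1F ⊡ y))))) ⟩
    ∑ (λ y → χ y * g (x ⊞ ⊟ (1F ⊡ y))) ∎
    where
    open ≡-Reasoning
    index : ∀ y → m ⊡ x ⊞ ⊟ (1F ⊡ (m ⊡ y)) ≡ m ⊡ (x ⊞ ⊟ (1F ⊡ y))
    index y = begin
      m ⊡ x ⊞ ⊟ (1F ⊡ (m ⊡ y)) ≡⟨ cong (λ z → m ⊡ x ⊞ ⊟ z) (trans (F.*-identityˡ _) (cong (m ⊡_) (sym (F.*-identityˡ y)))) ⟩
      m ⊡ x ⊞ ⊟ (m ⊡ (1F ⊡ y)) ≡⟨ cong (m ⊡ x ⊞_) (-‿distribʳ-* m (1F ⊡ y)) ⟩
      m ⊡ x ⊞ m ⊡ ⊟ (1F ⊡ y) ≡⟨ F.distribˡ m x _ ⟨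
      m ⊡ (x ⊞ ⊟ (1F ⊡ y)) ∎

  rep-invariant : ∀ k → Invariant (rep k)
  rep-invariant zero    = χ-invariant
  rep-invariant (suc k) = T-invariant (rep-invariant k)

  -- The representation count minus its mean, scaled by q to stay integral. Sum zero is what the
  -- operator bounds require.
  G : ℕ → Fin q → ℤ
  G k x = + q * rep k x - + (t ℕ.^ suc k)

  ∑-affine : ∀ a b (f g : Fin q → ℤ) → ∑ (λ x → (a * f x - b) * g x) ≡ a * ∑ (λ x → f x * g x) - b * ∑ g
  ∑-affine a b f g = begin
    ∑ (λ x → (a * f x - b) * g x) ≡⟨ sum-cong-≗ (λ x → expand a b (f x) (g x)) ⟩
    ∑ (λ x → a * (f x * g x) + - b * g x) ≡⟨ ∑-distrib-+ (λ x → a * (f x * g x)) (λ x → - b * g x) ⟩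
    ∑ (λ x → a * (f x * g x)) + ∑ (λ x → - b * g x) ≡⟨ cong₂ _+_ (*-distribˡ-sum a (λ x → f x * g x)) (*-distribˡ-sum (- b) g) ⟨
    a * ∑ (λ x → f x * g x) + - b * ∑ g ≡⟨ cong (_+_ (a * ∑ (λ x → f x * g x))) (sym (ℤ.neg-distribˡ-* b (∑ g))) ⟩
    a * ∑ (λ x → f x * g x) - b * ∑ g ∎
    where
    open ≡-Reasoning
    expand : ∀ a b f g → (a * f - b) * g ≡ a * (f * g) + - b * g
    expand = solve-∀

  G-suc : ∀ k x → G (suc k) x ≡ T (G k) x
  G-suc k x = sym (begin
    ∑ (λ y → χ y * G k (x ⊞ ⊟ (1F ⊡ y)))
      ≡⟨ sum-cong-≗ (λ y → ℤ.*-comm (χ y) (G k (x ⊞ ⊟ (1F ⊡ y)))) ⟩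
    ∑ (λ y → G k (x ⊞ ⊟ (1F ⊡ y)) * χ y)
      ≡⟨ ∑-affine (+ q) (+ (t ℕ.^ suc k)) (λ y → rep k (x ⊞ ⊟ (1F ⊡ y))) χ ⟩
    + q * ∑ (λ y → rep k (x ⊞ ⊟ (1F ⊡ y)) * χ y) - + (t ℕ.^ suc k) * ∑ χ
      ≡⟨ cong₂ (λ a b → + q * a - b) (sum-cong-≗ (λ y → ℤ.*-comm (rep k (x ⊞ ⊟ (1F ⊡ y))) (χ y)))
           (trans (cong (+ (t ℕ.^ suc k) *_) ∑χ) (trans (ℤ.*-comm _ (+ t)) (sym (ℤ.pos-* t _)))) ⟩
    G (suc k) x ∎)
    where open ≡-Reasoning

  ∑G : ∀ k → ∑ (G k) ≡ 0ℤ
  ∑G k = begin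
    ∑ (G k) ≡⟨ sum-cong-≗ (λ x → ℤ.*-identityʳ (G k x)) ⟨
    ∑ (λ x → G k x * 1ℤ) ≡⟨ ∑-affine (+ q) (+ (t ℕ.^ suc k)) (rep k) (λ _ → 1ℤ) ⟩
    + q * ∑ (λ x → rep k x * 1ℤ) - + (t ℕ.^ suc k) * ∑ {q} (λ _ → 1ℤ)
      ≡⟨ cong₂ (λ a b → + q * a - + (t ℕ.^ suc k) * b) (trans (sum-cong-≗ (λ x → ℤ.*-identityʳ (rep k x))) (∑-rep k)) (∑-const {q} 1ℤ) ⟩
    + q * + (t ℕ.^ suc k) - + (t ℕ.^ suc k) * (+ q * 1ℤ) ≡⟨ vanish (+ q) (+ (t ℕ.^ suc k)) ⟩
    0ℤ ∎
    where
    open ≡-Reasoning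
    vanish : ∀ a b → a * b - b * (a * 1ℤ) ≡ 0ℤ
    vanish = solve-∀

  -- Removing the mean is an orthogonal projection and cannot increase the norm; q² is the scaling
  -- of `G`.
  ‖G‖²≤ : ∀ k → ‖ G k ‖² ≤ + q * + q * ‖ rep k ‖²
  ‖G‖²≤ k = begin
    ‖ G k ‖² ≡⟨ ∑-affine Q S (rep k) (G k) ⟩
    Q * ∑ (λ x → rep k x * G k x) - S * ∑ (G k) ≡⟨ cong₂ (λ a b → Q * a - S * b) (sum-cong-≗ (λ x → ℤ.*-comm (rep k x) (G k x))) (∑G k) ⟩
    Q * ∑ (λ x → G k x * rep k x) - S * 0ℤ ≡⟨ cong (λ a → Q * a - S * 0ℤ) (∑-affine Q S (rep k) (rep k)) ⟩
    Q * (Q * ‖ rep k ‖² - S * ∑ (rep k)) - S * 0ℤ ≡⟨ cong (λ a → Q * (Q * ‖ rep k ‖² - S * a) - S * 0ℤ) (∑-rep k) ⟩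
    Q * (Q * ‖ rep k ‖² - S * S) - S * 0ℤ ≡⟨ expand Q S ‖ rep k ‖² ⟩
    Q * Q * ‖ rep k ‖² + - (Q * (S * S)) ≤⟨ ℤ.+-monoʳ-≤ (Q * Q * ‖ rep k ‖²) (ℤ.neg-mono-≤ (0≤* {Q} {S * S} (+≤+ z≤n) (0≤sq S))) ⟩
    Q * Q * ‖ rep k ‖² + 0ℤ ≡⟨ ℤ.+-identityʳ _ ⟩
    Q * Q * ‖ rep k ‖² ∎
    where
    open ℤ.≤-Reasoning
    Q = + q
    S = + (t ℕ.^ suc k)
    expand : ∀ q s r → q * (q * r - s * s) - s * 0ℤ ≡ q * q * r + - (q * (s * s))
    expand = solve-∀

  v : ℕ → ℕ
  v k = ℤ.∣ ‖ G k ‖² ∣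

  +v : ∀ k → + v k ≡ ‖ G k ‖²
  +v k = ℤ.0≤i⇒+∣i∣≡i (0≤‖‖² (G k))

  +v-suc : ∀ k → + v (suc k) ≡ ‖ T (G k) ‖²
  +v-suc k = trans (+v (suc k)) (sum-cong-≗ (λ x → cong (λ z → z * z) (G-suc k x)))

  v-suc≤q : ∀ k → v (suc k) ℕ.≤ q ℕ.* v k
  v-suc≤q k = ℤ.drop‿+≤+ (subst₂ _≤_ (sym (+v-suc k)) (trans (cong (+ q *_) (sym (+v k))) (sym (ℤ.pos-* q _)))
    (‖T‖²≤q (G k) (∑G k)))

  pos-sq : ∀ a → + (a ℕ.* a) ≡ + a * + a
  pos-sq a = ℤ.pos-* a a

  v-suc²≤ : ∀ k → t ℕ.* (v (suc k) ℕ.* v (suc k)) ℕ.≤ q ℕ.* E ℕ.* (v k ℕ.* v k)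
  v-suc²≤ k = ℤ.drop‿+≤+ (subst₂ _≤_
    (sym (trans (ℤ.pos-* t _) (cong (+ t *_) (trans (pos-sq (v (suc k))) (cong (λ z → z * z) (+v-suc k))))))
    (sym (trans (ℤ.pos-* (q ℕ.* E) _) (cong₂ _*_ (ℤ.pos-* q E) (trans (pos-sq (v k)) (cong (λ z → z * z) (+v k))))))
    (t‖T‖⁴≤ (G k) (∑G k)))

  v-suc⁴≤ : ∀ k → (v (suc k) ℕ.* v (suc k)) ℕ.* (v (suc k) ℕ.* v (suc k)) ℕ.≤
                  q ℕ.* (E ℕ.* E) ℕ.* ((v k ℕ.* v k) ℕ.* (v k ℕ.* v k))
  v-suc⁴≤ k = ℤ.drop‿+≤+ (subst₂ _≤_
    (sym (fourth (+v-suc k)))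
    (sym (trans (ℤ.pos-* (q ℕ.* (E ℕ.* E)) _) (cong₂ _*_ (trans (ℤ.pos-* q _) (cong (+ q *_) (pos-sq E))) (fourth (+v k)))))
    (‖T‖⁸≤ (G k) (∑G k)))
    where
    fourth : ∀ {a z} → + a ≡ z → + ((a ℕ.* a) ℕ.* (a ℕ.* a)) ≡ (z * z) * (z * z)
    fourth {a} refl = trans (pos-sq (a ℕ.* a)) (cong (λ z → z * z) (pos-sq a))

  v₀≤ : v 0 ℕ.≤ q ℕ.* q ℕ.* t
  v₀≤ = ℤ.drop‿+≤+ (subst₂ _≤_ (sym (+v 0))
    (trans (cong (+ q * + q *_) ‖χ‖²) (sym (trans (ℤ.pos-* (q ℕ.* q) t) (cong (_* + t) (pos-sq q))))) (‖G‖²≤ 0))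

  -- The equation a - b = c - d is the same as a + d = c + b, so the energy is also the second
  -- moment of the number of representations as a sum.
  ‖rep₁‖² : ‖ rep 1 ‖² ≡ + E
  ‖rep₁‖² = trans (‖conv‖² χ χ 1F) (trans (sum-cong-≗ (λ y → cong (λ z → N y * N z) (F.*-identityˡ y))) (sym +E))

  v₁≤ : v 1 ℕ.≤ q ℕ.* q ℕ.* E
  v₁≤ = ℤ.drop‿+≤+ (subst₂ _≤_ (sym (+v 1))
    (trans (cong (+ q * + q *_) ‖rep₁‖²) (sym (trans (ℤ.pos-* (q ℕ.* q) E) (cong (_* + E) (pos-sq q))))) (‖G‖²≤ 1))

  -- Consequences of an element missing from a sumset

  module Missing (x : Fin q) (x≢0 : x ≢ 0F) where

    x⁻¹ : Fin q
    x⁻¹ = proj₁ (inverse x x≢0)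

    xx⁻¹≡1 : x ⊡ x⁻¹ ≡ 1F
    xx⁻¹≡1 = proj₂ (inverse x x≢0)

    unit≢0 : ∀ {a b} → a ⊡ b ≡ 1F → b ≢ 0F
    unit≢0 {a} ab≡1 refl = 1F≢0F (trans (sym ab≡1) (F.zeroʳ a))

    x⁻¹≢0 : x⁻¹ ≢ 0F
    x⁻¹≢0 = unit≢0 xx⁻¹≡1

    ψ : Fin q → ℤ
    ψ z = χ (x⁻¹ ⊡ z)

    ∑ψ : ∑ ψ ≡ + t
    ∑ψ = trans (sym (∑-dilate x⁻¹ x⁻¹≢0 χ)) ∑χ

    ‖ψ‖² : ‖ ψ ‖² ≡ + t
    ‖ψ‖² = trans (sum-cong-≗ (λ z → χ-idem (x⁻¹ ⊡ z))) ∑ψ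

    rep*ψ≡0 : ∀ k → rep k x ≡ 0ℤ → ∀ z → rep k z * ψ z ≡ 0ℤ
    rep*ψ≡0 k rep≡0 z with χ-cases (x⁻¹ ⊡ z)
    ... | inj₂ χ≡0 = trans (cong (rep k z *_) χ≡0) (ℤ.*-zeroʳ (rep k z))
    ... | inj₁ ∈R  = cong (_* ψ z) (trans (cong (rep k) z≡) (trans (rep-invariant k ∈R x) rep≡0))
      where
      z≡ : z ≡ x⁻¹ ⊡ z ⊡ x
      z≡ = sym (trans (F.*-comm (x⁻¹ ⊡ z) x) (⊡-cancel (trans (F.*-comm x⁻¹ x) xx⁻¹≡1) z))

    ∑Gψ : ∀ k → rep k x ≡ 0ℤ → ∑ (λ z → G k z * ψ z) ≡ - + (t ℕ.^ suc (suc k))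
    ∑Gψ k rep≡0 = begin
      ∑ (λ z → G k z * ψ z) ≡⟨ ∑-affine (+ q) (+ (t ℕ.^ suc k)) (rep k) ψ ⟩
      + q * ∑ (λ z → rep k z * ψ z) - + (t ℕ.^ suc k) * ∑ ψ ≡⟨ cong₂ (λ a b → + q * a - + (t ℕ.^ suc k) * b) (∑-zero (rep*ψ≡0 k rep≡0)) ∑ψ ⟩
      + q * 0ℤ - + (t ℕ.^ suc k) * + t ≡⟨ simplify (+ q) (+ (t ℕ.^ suc k)) (+ t) ⟩
      - (+ t * + (t ℕ.^ suc k)) ≡⟨ cong -_ (sym (ℤ.pos-* t _)) ⟩
      - + (t ℕ.^ suc (suc k)) ∎
      where
      open ≡-Reasoning
      simplify : ∀ a b c → a * 0ℤ - b * c ≡ - (c * b)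
      simplify = solve-∀

    neg-square : ∀ n → - + n * - + n ≡ + (n ℕ.* n)
    neg-square n = trans (trans (sym (ℤ.neg-distribˡ-* (+ n) (- + n)))
      (trans (cong -_ (sym (ℤ.neg-distribʳ-* (+ n) (+ n)))) (ℤ.neg-involutive _))) (sym (ℤ.pos-* n n))

    missing≤t : ∀ k → rep k x ≡ 0ℤ → t ℕ.^ suc (suc k) ℕ.* t ℕ.^ suc (suc k) ℕ.≤ v k ℕ.* t
    missing≤t k rep≡0 = ℤ.drop‿+≤+ (subst₂ _≤_
      (trans (cong (λ z → z * z) (∑Gψ k rep≡0)) (neg-square (t ℕ.^ suc (suc k))))
      (trans (cong₂ _*_ (sym (+v k)) ‖ψ‖²) (sym (ℤ.pos-* (v k) t)))
      (cauchy-schwarz (G k) ψ))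

    -- The squared norm pairs N with a dilate of N. Dilation by d is a bijection, so both have
    -- square sum E and the termwise inequality 2 a b ≤ a² + b² suffices.
    ‖Tᵃψ‖²≤E : ‖ Tᵃ ψ ‖² ≤ + E
    ‖Tᵃψ‖²≤E = ℤ.*-cancelˡ-≤-pos _ _ (+ 2) (begin
      + 2 * ‖ Tᵃ ψ ‖² ≡⟨ cong (+ 2 *_) (‖conv‖² χ ψ (⊟ 1F)) ⟩
      + 2 * ∑ (λ y → N y * correlation ψ (⊟ 1F ⊡ y)) ≡⟨ cong (+ 2 *_) (sum-cong-≗ (λ y → cong (N y *_) (shape y))) ⟩
      + 2 * ∑ (λ y → N y * N (d ⊡ y)) ≡⟨ *-distribˡ-sum (+ 2) (λ y → N y * N (d ⊡ y)) ⟩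
      ∑ (λ y → + 2 * (N y * N (d ⊡ y))) ≤⟨ ∑-mono-≤ (λ y → am-gm (N y) (N (d ⊡ y))) ⟩
      ∑ (λ y → N y * N y + N (d ⊡ y) * N (d ⊡ y)) ≡⟨ ∑-distrib-+ (λ y → N y * N y) (λ y → N (d ⊡ y) * N (d ⊡ y)) ⟩
      ‖ N ‖² + ∑ (λ y → N (d ⊡ y) * N (d ⊡ y)) ≡⟨ cong (_+_ ‖ N ‖²) (sym (∑-dilate d d≢0 (λ y → N y * N y))) ⟩
      ‖ N ‖² + ‖ N ‖² ≡⟨ double ‖ N ‖² ⟩
      + 2 * ‖ N ‖² ≡⟨ cong (+ 2 *_) (sym +E) ⟩
      + 2 * + E ∎)
      where
      open ℤ.≤-Reasoning
      d : Fin q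
      d = x⁻¹ ⊡ ⊟ 1F
      d≢0 : d ≢ 0F
      d≢0 = unit≢0 {x ⊡ ⊟ 1F} (trans (rearrange x (⊟ 1F) x⁻¹) (trans (cong₂ _⊡_ xx⁻¹≡1
        (trans (sym (-‿distribˡ-* 1F (⊟ 1F))) (cong ⊟_ (F.*-identityˡ (⊟ 1F))))) (trans (F.*-identityˡ _) (-‿involutive 1F))))
        where
        open import Algebra.Properties.CommutativeSemigroup F.*-commutativeSemigroup using () renaming (interchange to ⊡-interchange)
        rearrange : ∀ a b c → a ⊡ b ⊡ (c ⊡ b) ≡ a ⊡ c ⊡ (b ⊡ b)
        rearrange a b c = ⊡-interchange a b c b
      shape : ∀ y → correlation ψ (⊟ 1F ⊡ y) ≡ N (d ⊡ y)
      shape y = trans (correlation-dilate x⁻¹ x⁻¹≢0 χ (⊟ 1F ⊡ y)) (cong N (sym (F.*-assoc x⁻¹ (⊟ 1F) y)))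
      am-gm : ∀ a b → + 2 * (a * b) ≤ a * a + b * b
      am-gm a b = ℤ.0≤i-j⇒j≤i (subst (0ℤ ≤_) (expand a b) (0≤sq (a - b)))
        where
        expand : ∀ a b → (a - b) * (a - b) ≡ a * a + b * b - + 2 * (a * b)
        expand = solve-∀
      double : ∀ a → a + a ≡ + 2 * a
      double = solve-∀

    -- Moving the last T to the indicator of xR as its adjoint uses up one summand at the price E,
    -- so the index of v is one lower than in `missing≤t`.
    missing≤E : ∀ k → rep (suc k) x ≡ 0ℤ →
      t ℕ.^ suc (suc (suc k)) ℕ.* t ℕ.^ suc (suc (suc k)) ℕ.≤ v k ℕ.* E
    missing≤E k rep≡0 = ℤ.drop‿+≤+ (begin
      + (t ℕ.^ suc (suc (suc k)) ℕ.* t ℕ.^ suc (suc (suc k)))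
        ≡⟨ neg-square (t ℕ.^ suc (suc (suc k))) ⟨
      - + (t ℕ.^ suc (suc (suc k))) * - + (t ℕ.^ suc (suc (suc k)))
        ≡⟨ cong (λ z → z * z) (trans (sym (∑Gψ (suc k) rep≡0))
             (trans (sum-cong-≗ (λ z → cong (_* ψ z) (G-suc k z))) (T-adjoint (G k) ψ))) ⟩
      ∑ (λ c → G k c * Tᵃ ψ c) * ∑ (λ c → G k c * Tᵃ ψ c)
        ≤⟨ cauchy-schwarz (G k) (Tᵃ ψ) ⟩
      ‖ G k ‖² * ‖ Tᵃ ψ ‖²
        ≤⟨ ℤ.*-monoˡ-≤-nonNeg ‖ G k ‖² {{ℤ.nonNegative (0≤‖‖² (G k))}} ‖Tᵃψ‖²≤E ⟩
      ‖ G k ‖² * + E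
        ≡⟨ cong (_* + E) (sym (+v k)) ⟩
      + v k * + E
        ≡⟨ ℤ.pos-* (v k) E ⟨
      + (v k ℕ.* E) ∎)
      where open ℤ.≤-Reasoning

-- Polynomials

module Polynomial {c ℓ} (K : CommutativeRing c ℓ) where

  private module K = CommutativeRing K
  open K using (Carrier; _≈_; 0#; 1#; _+_; _*_; -_)
  open import Algebra.Properties.Ring K.ring using (-0#≈0#)
  open import Algebra.Properties.CommutativeMonoid.Mult K.+-commutativeMonoid using () renaming (_×_ to _·_; ×-distrib-+ to ·-distrib-+; ×-congʳ to ·-congʳ)
  open import Algebra.Properties.Semiring.Mult K.semiring using () renaming (×-comm-* to ·-comm-*)
  open import Algebra.Properties.CommutativeSemigroup K.+-commutativeSemigroup using () renaming (interchange to +-interchange)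

  -- Coefficient lists, constant term first, with trailing zeros allowed. Equality is therefore
  -- equality of all coefficients, and degrees occur only as upper bounds `Deg<`.
  Poly : Set c
  Poly = List Carrier

  coef : Poly → ℕ → Carrier
  coef []      _       = 0#
  coef (a ∷ P) zero    = a
  coef (a ∷ P) (suc i) = coef P i

  infix 4 _≋_
  -- A record rather than a bare function type, so that unification can recover both polynomials
  -- from the type.
  record _≋_ (P Q : Poly) : Set ℓ where
    constructor mk≋
    field coef≈ : ∀ i → coef P i ≈ coef Q i
  open _≋_ public

  infixl 6 _⊹_
  infixl 7 _⊠_

  opaque
    _⊹_ : Poly → Poly → Poly
    []      ⊹ Q       = Q
    (a ∷ P) ⊹ []      = a ∷ P
    (a ∷ P) ⊹ (b ∷ Q) = (a + b) ∷ (P ⊹ Q)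

    scale : Carrier → Poly → Poly
    scale a []      = []
    scale a (b ∷ P) = (a * b) ∷ scale a P

    neg : Poly → Poly
    neg []      = []
    neg (a ∷ P) = (- a) ∷ neg P

    _⊠_ : Poly → Poly → Poly
    []      ⊠ Q = []
    (a ∷ P) ⊠ Q = scale a Q ⊹ (0# ∷ (P ⊠ Q))

    coef-⊹ : ∀ P Q i → coef (P ⊹ Q) i ≈ coef P i + coef Q i
    coef-⊹ []      Q       i       = K.sym (K.+-identityˡ _)
    coef-⊹ (a ∷ P) []      i       = K.sym (K.+-identityʳ _)
    coef-⊹ (a ∷ P) (b ∷ Q) zero    = K.refl
    coef-⊹ (a ∷ P) (b ∷ Q) (suc i) = coef-⊹ P Q i

    coef-scale : ∀ a P i → coef (scale a P) i ≈ a * coef P i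
    coef-scale a []      i       = K.sym (K.zeroʳ a)
    coef-scale a (b ∷ P) zero    = K.refl
    coef-scale a (b ∷ P) (suc i) = coef-scale a P i

    coef-neg : ∀ P i → coef (neg P) i ≈ - coef P i
    coef-neg []      i       = K.sym -0#≈0#
    coef-neg (a ∷ P) zero    = K.refl
    coef-neg (a ∷ P) (suc i) = coef-neg P i

  ⊹-abelianGroup : AbelianGroup c ℓ
  ⊹-abelianGroup = record
    { Carrier = Poly ; _≈_ = _≋_ ; _∙_ = _⊹_ ; ε = [] ; _⁻¹ = neg
    ; isAbelianGroup = record
      { isGroup = record
        { isMonoid = record
          { isSemigroup = record
            { isMagma = record
              { isEquivalence = record
                { refl = mk≋ λ i → K.refl
                ; sym = λ e → mk≋ λ i → K.sym (coef≈ e i)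
                ; trans = λ e f → mk≋ λ i → K.trans (coef≈ e i) (coef≈ f i) }
              ; ∙-cong = λ {P} {P′} {Q} {Q′} e f → mk≋ λ i →
                  K.trans (coef-⊹ P Q i) (K.trans (K.+-cong (coef≈ e i) (coef≈ f i)) (K.sym (coef-⊹ P′ Q′ i))) }
            ; assoc = λ P Q S → mk≋ λ i →
                K.trans (coef-⊹ (P ⊹ Q) S i) (K.trans (K.+-congʳ (coef-⊹ P Q i)) (K.trans (K.+-assoc _ _ _)
                (K.trans (K.+-congˡ (K.sym (coef-⊹ Q S i))) (K.sym (coef-⊹ P (Q ⊹ S) i))))) }
          ; identity = (λ P → mk≋ λ i → K.trans (coef-⊹ [] P i) (K.+-identityˡ _))
                     , (λ P → mk≋ λ i → K.trans (coef-⊹ P [] i) (K.+-identityʳ _)) }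
        ; inverse = (λ P → mk≋ λ i → K.trans (coef-⊹ (neg P) P i) (K.trans (K.+-congʳ (coef-neg P i)) (K.-‿inverseˡ _)))
                  , (λ P → mk≋ λ i → K.trans (coef-⊹ P (neg P) i) (K.trans (K.+-congˡ (coef-neg P i)) (K.-‿inverseʳ _)))
        ; ⁻¹-cong = λ {P} {Q} e → mk≋ λ i → K.trans (coef-neg P i) (K.trans (K.-‿cong (coef≈ e i)) (K.sym (coef-neg Q i))) }
      ; comm = λ P Q → mk≋ λ i → K.trans (coef-⊹ P Q i) (K.trans (K.+-comm _ _) (K.sym (coef-⊹ Q P i))) } }

  private
    module A = AbelianGroup ⊹-abelianGroup
  open import Algebra.Properties.CommutativeSemigroup A.commutativeSemigroup using () renaming (interchange to ⊹-interchange; x∙yz≈y∙xz to ⊹-swap)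

  opaque
    unfolding _⊹_ scale neg _⊠_

    ∷-cong : ∀ {a b P Q} → a ≈ b → P ≋ Q → (a ∷ P) ≋ (b ∷ Q)
    ∷-cong a≈b P≋Q = mk≋ λ { zero → a≈b ; (suc i) → coef≈ P≋Q i }

    0∷[]≋[] : (0# ∷ []) ≋ []
    0∷[]≋[] = mk≋ λ { zero → K.refl ; (suc i) → K.refl }

    0∷-⊹ : ∀ P Q → (0# ∷ (P ⊹ Q)) ≋ (0# ∷ P) ⊹ (0# ∷ Q)
    0∷-⊹ P Q = ∷-cong (K.sym (K.+-identityʳ 0#)) A.refl

    scale-cong : ∀ {a b P Q} → a ≈ b → P ≋ Q → scale a P ≋ scale b Q
    scale-cong {a} {b} {P} {Q} a≈b P≋Q = mk≋ λ i →
      K.trans (coef-scale a P i) (K.trans (K.*-cong a≈b (coef≈ P≋Q i)) (K.sym (coef-scale b Q i)))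

    scale-⊹ : ∀ a P Q → scale a (P ⊹ Q) ≋ scale a P ⊹ scale a Q
    scale-⊹ a P Q = mk≋ λ i → K.trans (coef-scale a (P ⊹ Q) i) (K.trans (K.*-congˡ (coef-⊹ P Q i))
      (K.trans (K.distribˡ a _ _) (K.trans (K.+-cong (K.sym (coef-scale a P i)) (K.sym (coef-scale a Q i)))
      (K.sym (coef-⊹ (scale a P) (scale a Q) i)))))

    scale-scale : ∀ a b P → scale (a * b) P ≋ scale a (scale b P)
    scale-scale a b P = mk≋ λ i → K.trans (coef-scale (a * b) P i) (K.trans (K.*-assoc a b _)
      (K.trans (K.*-congˡ (K.sym (coef-scale b P i))) (K.sym (coef-scale a (scale b P) i))))

    scale-0 : ∀ P → scale 0# P ≋ []
    scale-0 P = mk≋ λ i → K.trans (coef-scale 0# P i) (K.zeroˡ _)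

    scale-1 : ∀ P → scale 1# P ≋ P
    scale-1 P = mk≋ λ i → K.trans (coef-scale 1# P i) (K.*-identityˡ _)

    ⊠-congˡ : ∀ P {Q Q′} → Q ≋ Q′ → P ⊠ Q ≋ P ⊠ Q′
    ⊠-congˡ []      Q≋Q′ = A.refl
    ⊠-congˡ (a ∷ P) Q≋Q′ = A.∙-cong (scale-cong K.refl Q≋Q′) (∷-cong K.refl (⊠-congˡ P Q≋Q′))

    ⊠-zeroʳ : ∀ P → P ⊠ [] ≋ []
    ⊠-zeroʳ []      = A.refl
    ⊠-zeroʳ (a ∷ P) = A.trans (∷-cong K.refl (⊠-zeroʳ P)) 0∷[]≋[]

    -- The mirror image of the defining clause of `_⊠_`, with the recursion on the right factor;
    -- commutativity follows from the pair by induction.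
    ⊠-∷ʳ : ∀ P b Q → P ⊠ (b ∷ Q) ≋ scale b P ⊹ (0# ∷ (P ⊠ Q))
    ⊠-∷ʳ []      b Q = A.sym 0∷[]≋[]
    ⊠-∷ʳ (a ∷ P) b Q = ∷-cong (K.+-congʳ (K.*-comm a b))
      (A.trans (A.∙-congˡ (⊠-∷ʳ P b Q)) (⊹-swap (scale a Q) (scale b P) (0# ∷ (P ⊠ Q))))

    ⊠-comm : ∀ P Q → P ⊠ Q ≋ Q ⊠ P
    ⊠-comm []      Q = A.sym (⊠-zeroʳ Q)
    ⊠-comm (a ∷ P) Q = A.trans (A.∙-congˡ (∷-cong K.refl (⊠-comm P Q))) (A.sym (⊠-∷ʳ Q a P))

    ⊠-distribˡ : ∀ P Q S → P ⊠ (Q ⊹ S) ≋ P ⊠ Q ⊹ P ⊠ S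
    ⊠-distribˡ []      Q S = A.refl
    ⊠-distribˡ (a ∷ P) Q S = A.trans
      (A.∙-cong (scale-⊹ a Q S) (A.trans (∷-cong K.refl (⊠-distribˡ P Q S)) (0∷-⊹ (P ⊠ Q) (P ⊠ S))))
      (⊹-interchange (scale a Q) (scale a S) (0# ∷ (P ⊠ Q)) (0# ∷ (P ⊠ S)))

    ⊠-cong : ∀ {P P′ Q Q′} → P ≋ P′ → Q ≋ Q′ → P ⊠ Q ≋ P′ ⊠ Q′
    ⊠-cong {P} {P′} {Q} {Q′} e f = A.trans (⊠-congˡ P f)
      (A.trans (⊠-comm P Q′) (A.trans (⊠-congˡ Q′ e) (⊠-comm Q′ P′)))

    ⊠-distribʳ : ∀ P Q S → (Q ⊹ S) ⊠ P ≋ Q ⊠ P ⊹ S ⊠ P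
    ⊠-distribʳ P Q S = A.trans (⊠-comm (Q ⊹ S) P)
      (A.trans (⊠-distribˡ P Q S) (A.∙-cong (⊠-comm P Q) (⊠-comm P S)))

    scale-0∷ : ∀ a P → scale a (0# ∷ P) ≋ (0# ∷ scale a P)
    scale-0∷ a P = ∷-cong (K.zeroʳ a) A.refl

    scale-⊠ : ∀ a P Q → scale a P ⊠ Q ≋ scale a (P ⊠ Q)
    scale-⊠ a []      Q = A.refl
    scale-⊠ a (b ∷ P) Q = A.trans
      (A.∙-cong (scale-scale a b Q) (A.trans (∷-cong K.refl (scale-⊠ a P Q)) (A.sym (scale-0∷ a (P ⊠ Q)))))
      (A.sym (scale-⊹ a (scale b Q) (0# ∷ (P ⊠ Q))))

    0∷-⊠ : ∀ P Q → (0# ∷ P) ⊠ Q ≋ (0# ∷ (P ⊠ Q))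
    0∷-⊠ P Q = A.∙-congʳ (scale-0 Q)

    ⊠-assoc : ∀ P Q S → (P ⊠ Q) ⊠ S ≋ P ⊠ (Q ⊠ S)
    ⊠-assoc []      Q S = A.refl
    ⊠-assoc (a ∷ P) Q S = A.trans (⊠-distribʳ S (scale a Q) (0# ∷ (P ⊠ Q)))
      (A.∙-cong (scale-⊠ a Q S) (A.trans (0∷-⊠ (P ⊠ Q) S) (∷-cong K.refl (⊠-assoc P Q S))))

    ⊠-identityˡ : ∀ P → (1# ∷ []) ⊠ P ≋ P
    ⊠-identityˡ P = A.trans (A.∙-cong (scale-1 P) 0∷[]≋[]) (A.identityʳ P)

  K[X] : CommutativeRing c ℓ
  K[X] = record
    { Carrier = Poly ; _≈_ = _≋_ ; _+_ = _⊹_ ; _*_ = _⊠_ ; -_ = neg ; 0# = [] ; 1# = 1# ∷ []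
    ; isCommutativeRing = record
      { isRing = record
        { +-isAbelianGroup = A.isAbelianGroup
        ; *-cong = ⊠-cong
        ; *-assoc = ⊠-assoc
        ; *-identity = ⊠-identityˡ , λ P → A.trans (⊠-comm P _) (⊠-identityˡ P)
        ; distrib = ⊠-distribˡ , ⊠-distribʳ }
      ; *-comm = ⊠-comm } }

  module R = CommutativeRing K[X]
  open import Algebra.Properties.Semiring.Exp R.semiring public using (_^_)
  open import Algebra.Properties.Semiring.Mult R.semiring public using () renaming (_×_ to _•_; ×-assoc-* to •-assoc-*; ×-comm-* to •-comm-*; ×-congʳ to •-congʳ)

  ·-zeroʳ : ∀ n → n · 0# ≈ 0#
  ·-zeroʳ zero    = K.refl
  ·-zeroʳ (suc n) = K.trans (K.+-identityˡ _) (·-zeroʳ n)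

  infix 9 _⟨_⟩
  opaque
    unfolding _⊹_ scale neg _⊠_

    _⟨_⟩ : Poly → Carrier → Carrier
    [] ⟨ u ⟩      = 0#
    (a ∷ P) ⟨ u ⟩ = a + u * P ⟨ u ⟩

    eval-zero : ∀ P u → P ≋ [] → P ⟨ u ⟩ ≈ 0#
    eval-zero []      u e = K.refl
    eval-zero (a ∷ P) u e = K.trans (K.+-cong (coef≈ e 0) (K.trans (K.*-congˡ (eval-zero P u (mk≋ λ i → coef≈ e (suc i)))) (K.zeroʳ u)))
      (K.+-identityʳ 0#)

    eval-cong : ∀ {P Q} u → P ≋ Q → P ⟨ u ⟩ ≈ Q ⟨ u ⟩
    eval-cong {[]}    {Q}     u e = K.sym (eval-zero Q u (A.sym e))
    eval-cong {a ∷ P} {[]}    u e = eval-zero (a ∷ P) u e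
    eval-cong {a ∷ P} {b ∷ Q} u e = K.+-cong (coef≈ e 0) (K.*-congˡ (eval-cong {P} {Q} u (mk≋ λ i → coef≈ e (suc i))))

    eval-⊹ : ∀ P Q u → (P ⊹ Q) ⟨ u ⟩ ≈ P ⟨ u ⟩ + Q ⟨ u ⟩
    eval-⊹ []      Q       u = K.sym (K.+-identityˡ _)
    eval-⊹ (a ∷ P) []      u = K.sym (K.+-identityʳ _)
    eval-⊹ (a ∷ P) (b ∷ Q) u = K.trans (K.+-congˡ (K.trans (K.*-congˡ (eval-⊹ P Q u)) (K.distribˡ u _ _)))
      (+-interchange a b (u * P ⟨ u ⟩) (u * Q ⟨ u ⟩))

    eval-scale : ∀ a P u → scale a P ⟨ u ⟩ ≈ a * P ⟨ u ⟩
    eval-scale a []      u = K.sym (K.zeroʳ a)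
    eval-scale a (b ∷ P) u = K.trans (K.+-congˡ (K.trans (K.*-congˡ (eval-scale a P u)) (x∙yz≈y∙xz u a (P ⟨ u ⟩))))
      (K.sym (K.distribˡ a b _))
      where open import Algebra.Properties.CommutativeSemigroup K.*-commutativeSemigroup using (x∙yz≈y∙xz)

    eval-⊠ : ∀ P Q u → (P ⊠ Q) ⟨ u ⟩ ≈ P ⟨ u ⟩ * Q ⟨ u ⟩
    eval-⊠ []      Q u = K.sym (K.zeroˡ _)
    eval-⊠ (a ∷ P) Q u = K.trans (eval-⊹ (scale a Q) (0# ∷ (P ⊠ Q)) u)
      (K.trans (K.+-cong (eval-scale a Q u) (K.trans (K.+-identityˡ _) (K.trans (K.*-congˡ (eval-⊠ P Q u)) (K.sym (K.*-assoc u _ _)))))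
      (K.sym (K.distribʳ (Q ⟨ u ⟩) a (u * P ⟨ u ⟩))))

    -- The clause for `a ∷ P` is the product rule applied to a + X P.
    ∂ : Poly → Poly
    ∂ []      = []
    ∂ (a ∷ P) = P ⊹ (0# ∷ ∂ P)

    coef-∂ : ∀ P i → coef (∂ P) i ≈ suc i · coef P (suc i)
    coef-∂ []      i       = K.sym (·-zeroʳ (suc i))
    coef-∂ (a ∷ P) zero    = coef-⊹ P (0# ∷ ∂ P) 0
    coef-∂ (a ∷ P) (suc i) = K.trans (coef-⊹ P (0# ∷ ∂ P) (suc i)) (K.+-congˡ (coef-∂ P i))

    ∂-cong : ∀ {P Q} → P ≋ Q → ∂ P ≋ ∂ Q
    ∂-cong {P} {Q} e = mk≋ λ i → K.trans (coef-∂ P i) (K.trans (·-congʳ (suc i) (coef≈ e (suc i))) (K.sym (coef-∂ Q i)))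

    ∂-⊹ : ∀ P Q → ∂ (P ⊹ Q) ≋ ∂ P ⊹ ∂ Q
    ∂-⊹ P Q = mk≋ λ i → K.trans (coef-∂ (P ⊹ Q) i) (K.trans (·-congʳ (suc i) (coef-⊹ P Q (suc i)))
      (K.trans (·-distrib-+ _ _ (suc i)) (K.trans (K.+-cong (K.sym (coef-∂ P i)) (K.sym (coef-∂ Q i)))
      (K.sym (coef-⊹ (∂ P) (∂ Q) i)))))

    ∂-scale : ∀ a P → ∂ (scale a P) ≋ scale a (∂ P)
    ∂-scale a P = mk≋ λ i → K.trans (coef-∂ (scale a P) i) (K.trans (·-congʳ (suc i) (coef-scale a P (suc i)))
      (K.trans (K.sym (·-comm-* (suc i) a _)) (K.trans (K.*-congˡ (K.sym (coef-∂ P i))) (K.sym (coef-scale a (∂ P) i)))))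

    ∂-⊠ : ∀ P Q → ∂ (P ⊠ Q) ≋ ∂ P ⊠ Q ⊹ P ⊠ ∂ Q
    ∂-⊠ []      Q = A.refl
    ∂-⊠ (a ∷ P) Q = begin
      ∂ (scale a Q ⊹ (0# ∷ (P ⊠ Q)))
        ≈⟨ ∂-⊹ (scale a Q) (0# ∷ (P ⊠ Q)) ⟩
      ∂ (scale a Q) ⊹ (P ⊠ Q ⊹ (0# ∷ ∂ (P ⊠ Q)))
        ≈⟨ A.∙-cong (∂-scale a Q) (A.∙-congˡ (A.trans (∷-cong K.refl (∂-⊠ P Q)) (0∷-⊹ (∂ P ⊠ Q) (P ⊠ ∂ Q)))) ⟩
      scale a (∂ Q) ⊹ (P ⊠ Q ⊹ ((0# ∷ (∂ P ⊠ Q)) ⊹ (0# ∷ (P ⊠ ∂ Q))))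
        ≈⟨ A.∙-congˡ {scale a (∂ Q)} (A.assoc (P ⊠ Q) (0# ∷ (∂ P ⊠ Q)) (0# ∷ (P ⊠ ∂ Q))) ⟨
      scale a (∂ Q) ⊹ (P ⊠ Q ⊹ (0# ∷ (∂ P ⊠ Q)) ⊹ (0# ∷ (P ⊠ ∂ Q)))
        ≈⟨ ⊹-swap (scale a (∂ Q)) (P ⊠ Q ⊹ (0# ∷ (∂ P ⊠ Q))) (0# ∷ (P ⊠ ∂ Q)) ⟩
      P ⊠ Q ⊹ (0# ∷ (∂ P ⊠ Q)) ⊹ (scale a (∂ Q) ⊹ (0# ∷ (P ⊠ ∂ Q)))
        ≈⟨ A.∙-congʳ {(a ∷ P) ⊠ ∂ Q} (A.trans (⊠-distribʳ Q P (0# ∷ ∂ P)) (A.∙-congˡ {P ⊠ Q} (0∷-⊠ (∂ P) Q))) ⟨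
      (P ⊹ (0# ∷ ∂ P)) ⊠ Q ⊹ (a ∷ P) ⊠ ∂ Q ∎
      where open import Relation.Binary.Reasoning.Setoid A.setoid

  Deg< : ℕ → Poly → Set ℓ
  Deg< n P = ∀ i → n ℕ.≤ i → coef P i ≈ 0#

  Deg<-cong : ∀ {n P Q} → P ≋ Q → Deg< n P → Deg< n Q
  Deg<-cong e d i n≤i = K.trans (K.sym (coef≈ e i)) (d i n≤i)

  Deg<-mono : ∀ {m n P} → m ℕ.≤ n → Deg< m P → Deg< n P
  Deg<-mono m≤n d i n≤i = d i (ℕ.≤-trans m≤n n≤i)

  Deg<-⊹ : ∀ {n P Q} → Deg< n P → Deg< n Q → Deg< n (P ⊹ Q)
  Deg<-⊹ {n} {P} {Q} d e i n≤i = K.trans (coef-⊹ P Q i) (K.trans (K.+-cong (d i n≤i) (e i n≤i)) (K.+-identityʳ 0#))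

  Deg<-scale : ∀ {n} a P → Deg< n P → Deg< n (scale a P)
  Deg<-scale a P d i n≤i = K.trans (coef-scale a P i) (K.trans (K.*-congˡ (d i n≤i)) (K.zeroʳ a))

  Deg<-∷ : ∀ {n P} a → Deg< n P → Deg< (suc n) (a ∷ P)
  Deg<-∷ a d (suc i) (s≤s n≤i) = d i n≤i

  Deg<0⇒≋[] : ∀ {P} → Deg< 0 P → P ≋ []
  Deg<0⇒≋[] d = mk≋ λ i → d i z≤n

  ≋[]⇒Deg< : ∀ {n P} → P ≋ [] → Deg< n P
  ≋[]⇒Deg< e i _ = coef≈ e i

  opaque
    unfolding _⊹_ scale neg _⊠_

    -- Bounds are strict: degree at most m times degree below n has degree below m + n, hence `suc`
    -- on one side only.
    Deg<-⊠ : ∀ {m n} P Q → Deg< (suc m) P → Deg< n Q → Deg< (m ℕ.+ n) (P ⊠ Q)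
    Deg<-⊠ {m} {n} [] Q d e = ≋[]⇒Deg< {m ℕ.+ n} A.refl
    Deg<-⊠ {m} {n} (a ∷ P) Q d e = Deg<-⊹ {m ℕ.+ n} {scale a Q} (Deg<-mono {n} {m ℕ.+ n} {scale a Q} (ℕ.m≤n+m n m) (Deg<-scale a Q e)) (tail m d)
      where
      tail : ∀ m → Deg< (suc m) (a ∷ P) → Deg< (m ℕ.+ n) (0# ∷ (P ⊠ Q))
      tail zero    d = ≋[]⇒Deg< {n} (A.trans (∷-cong K.refl (⊠-cong {P} {[]} {Q} (mk≋ λ i → d (suc i) (s≤s z≤n)) A.refl)) 0∷[]≋[])
      tail (suc m) d = Deg<-∷ {m ℕ.+ n} 0# (Deg<-⊠ P Q (λ i le → d (suc i) (s≤s le)) e)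

  Deg<-∂ : ∀ {n} P → Deg< n P → Deg< n (∂ P)
  Deg<-∂ P d i n≤i = K.trans (coef-∂ P i) (K.trans (·-congʳ (suc i) (d (suc i) (ℕ.m≤n⇒m≤1+n n≤i))) (·-zeroʳ (suc i)))

  Deg<-• : ∀ {n} k P → Deg< n P → Deg< n (k • P)
  Deg<-• zero    P d = λ i _ → K.refl
  Deg<-• {n} (suc k) P d = Deg<-⊹ {n} {P} d (Deg<-• {n} k P d)

  Deg<-^ : ∀ {m} P → Deg< (suc m) P → ∀ n → Deg< (suc (n ℕ.* m)) (P ^ n)
  Deg<-^ P d zero    = λ { (suc i) _ → K.refl }
  Deg<-^ {m} P d (suc n) = ≡.subst (λ z → Deg< z (P ^ suc n)) (ℕ.+-suc m (n ℕ.* m)) (Deg<-⊠ P (P ^ n) d (Deg<-^ {m} P d n))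

  con : Carrier → Poly
  con a = a ∷ []

  X : Poly
  X = 0# ∷ 1# ∷ []

  lin : Carrier → Poly
  lin u = (- u) ∷ 1# ∷ []

  opaque
    unfolding _⊹_ scale neg _⊠_ _⟨_⟩

    X⊠ : ∀ P → X ⊠ P ≋ (0# ∷ P)
    X⊠ P = A.trans (0∷-⊠ (1# ∷ []) P) (∷-cong K.refl (⊠-identityˡ P))

    eval-lin : ∀ u v → lin u ⟨ v ⟩ ≈ v + - u
    eval-lin u v = K.trans (K.+-congˡ (K.trans (K.*-congˡ (K.trans (K.+-congˡ (K.zeroʳ v)) (K.+-identityʳ 1#))) (K.*-identityʳ v))) (K.+-comm (- u) v)

    eval-con : ∀ a v → con a ⟨ v ⟩ ≈ a
    eval-con a v = K.trans (K.+-congˡ (K.zeroʳ v)) (K.+-identityʳ a)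

    eval-X : ∀ v → X ⟨ v ⟩ ≈ v
    eval-X v = K.trans (K.+-identityˡ _) (K.trans (K.*-congˡ (K.trans (K.+-congˡ (K.zeroʳ v)) (K.+-identityʳ 1#))) (K.*-identityʳ v))

    -- Synthetic division by X - u: the coefficients of the quotient are the values at u of the
    -- successive tails of P.
    divide : Carrier → Poly → Poly
    divide u []      = []
    divide u (a ∷ P) = P ⟨ u ⟩ ∷ divide u P

    coef-lin⊠ : ∀ u P i → coef (lin u ⊠ P) (suc i) ≈ - u * coef P (suc i) + coef P i
    coef-lin⊠ u P i = K.trans (coef-⊹ (scale (- u) P) (0# ∷ ((1# ∷ []) ⊠ P)) (suc i))
      (K.+-cong (coef-scale (- u) P (suc i)) (coef≈ (⊠-identityˡ P) i))

    coef-lin⊠-0 : ∀ u P → coef (lin u ⊠ P) 0 ≈ - u * coef P 0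
    coef-lin⊠-0 u P = K.trans (coef-⊹ (scale (- u) P) (0# ∷ ((1# ∷ []) ⊠ P)) 0) (K.trans (K.+-identityʳ _) (coef-scale (- u) P 0))

    coef-divide : ∀ u P i → coef P i ≈ coef (lin u ⊠ divide u P ⊹ con (P ⟨ u ⟩)) i
    coef-divide u P i = K.sym (K.trans (coef-⊹ (lin u ⊠ divide u P) (con (P ⟨ u ⟩)) i) (go P i))
      where
      open import Relation.Binary.Reasoning.Setoid K.setoid
      head-step : ∀ a e → - u * e + (a + u * e) ≈ a
      head-step a e = begin
        - u * e + (a + u * e) ≈⟨ K.+-congˡ (K.+-comm a (u * e)) ⟩
        - u * e + (u * e + a) ≈⟨ K.+-assoc _ _ _ ⟨
        - u * e + u * e + a ≈⟨ K.+-congʳ (K.trans (K.sym (K.distribʳ e (- u) u)) (K.trans (K.*-congʳ (K.-‿inverseˡ u)) (K.zeroˡ e))) ⟩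
        0# + a ≈⟨ K.+-identityˡ a ⟩
        a ∎
      coef-divide₀ : ∀ P → - u * coef (divide u P) 0 + P ⟨ u ⟩ ≈ coef P 0
      coef-divide₀ []      = K.trans (K.+-identityʳ _) (K.zeroʳ _)
      coef-divide₀ (a ∷ P) = head-step a (P ⟨ u ⟩)
      coef-divideₛ : ∀ P i → - u * coef (divide u P) (suc i) + coef (divide u P) i ≈ coef P (suc i)
      coef-divideₛ []      i       = K.trans (K.+-identityʳ _) (K.zeroʳ _)
      coef-divideₛ (a ∷ P) zero    = coef-divide₀ P
      coef-divideₛ (a ∷ P) (suc i) = coef-divideₛ P i
      go : ∀ P i → coef (lin u ⊠ divide u P) i + coef (con (P ⟨ u ⟩)) i ≈ coef P i
      go P zero    = K.trans (K.+-congʳ (coef-lin⊠-0 u (divide u P))) (coef-divide₀ P)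
      go P (suc i) = K.trans (K.+-identityʳ _) (K.trans (coef-lin⊠ u (divide u P) i) (coef-divideₛ P i))

  Deg<-con : ∀ a → Deg< 1 (con a)
  Deg<-con a (suc i) _ = K.refl

  Deg<-lin : ∀ u → Deg< 2 (lin u)
  Deg<-lin u (suc (suc i)) _ = K.refl
  Deg<-lin u (suc zero) (s≤s ())

  Deg<-X : Deg< 2 X
  Deg<-X (suc (suc i)) _ = K.refl
  Deg<-X (suc zero) (s≤s ())

  Deg<-linear^ : ∀ P → Deg< 2 P → ∀ n → Deg< (suc n) (P ^ n)
  Deg<-linear^ P d n = ≡.subst (λ z → Deg< (suc z) (P ^ n)) (ℕ.*-identityʳ n) (Deg<-^ {1} P d n)

  ∂-con+X : ∀ a → ∂ (a ∷ 1# ∷ []) ≋ R.1#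
  ∂-con+X a = mk≋ λ { zero → K.trans (coef-∂ (a ∷ 1# ∷ []) 0) (K.+-identityʳ 1#)
                    ; (suc i) → K.trans (coef-∂ (a ∷ 1# ∷ []) (suc i)) (·-zeroʳ (suc (suc i))) }

  ∂-lin : ∀ u → ∂ (lin u) ≋ R.1#
  ∂-lin u = ∂-con+X (- u)

  ∂-X : ∂ X ≋ R.1#
  ∂-X = ∂-con+X 0#

  ∂-1 : ∂ R.1# ≋ []
  ∂-1 = mk≋ λ i → K.trans (coef-∂ R.1# i) (·-zeroʳ (suc i))

  ∂-[] : ∂ [] ≋ []
  ∂-[] = mk≋ λ i → K.trans (coef-∂ [] i) (·-zeroʳ (suc i))

  factor : ∀ u P → P ⟨ u ⟩ ≈ 0# → P ≋ lin u ⊠ divide u P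
  factor u P P⟨u⟩≈0 = A.trans (mk≋ (coef-divide u P))
    (A.trans (A.∙-congˡ (A.trans (∷-cong P⟨u⟩≈0 A.refl) 0∷[]≋[])) (A.identityʳ _))

  coef-length : ∀ P i → length P ℕ.≤ i → coef P i ≈ 0#
  coef-length []      i       _         = K.refl
  coef-length (a ∷ P) (suc i) (s≤s le) = coef-length P i le

  -- Since X - u is monic, coef P i is coef ((X - u) P) (i + 1) plus u times coef P (i + 1). This
  -- determines the coefficients from the top down, starting beyond the end of the list.
  Deg<-lin⁻¹ : ∀ {n} u P → Deg< (suc n) (lin u ⊠ P) → Deg< n P
  Deg<-lin⁻¹ {n} u P d i n≤i = go (length P) i (ℕ.m≤m+n (length P) i) n≤i
    where
    open import Relation.Binary.Reasoning.Setoid K.setoid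
    go : ∀ k i → length P ℕ.≤ k ℕ.+ i → n ℕ.≤ i → coef P i ≈ 0#
    go zero    i le n≤i = coef-length P i le
    go (suc k) i le n≤i = begin
      coef P i ≈⟨ K.+-identityˡ _ ⟨
      0# + coef P i ≈⟨ K.+-congʳ (K.trans (K.*-congˡ (go k (suc i) (≡.subst (length P ℕ.≤_) (≡.sym (ℕ.+-suc k i)) le) (ℕ.m≤n⇒m≤1+n n≤i))) (K.zeroʳ (- u))) ⟨
      - u * coef P (suc i) + coef P i ≈⟨ coef-lin⊠ u P i ⟨
      coef (lin u ⊠ P) (suc i) ≈⟨ d (suc i) (s≤s n≤i) ⟩
      0# ∎

  lin-cancel-0 : ∀ u P → lin u ⊠ P ≋ [] → P ≋ []
  lin-cancel-0 u P e = Deg<0⇒≋[] (Deg<-lin⁻¹ u P (≋[]⇒Deg< e))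

  lin-cancel : ∀ u P Q → lin u ⊠ P ≋ lin u ⊠ Q → P ≋ Q
  lin-cancel u P Q e = x∙y⁻¹≈ε⇒x≈y P Q (lin-cancel-0 u (P ⊹ neg Q)
    (A.trans (⊠-distribˡ (lin u) P (neg Q)) (A.trans (A.∙-congˡ (A.sym (-‿distribʳ-* (lin u) Q))) (x≈y⇒x∙y⁻¹≈ε e))))
    where
    open import Algebra.Properties.Group A.group using (x∙y⁻¹≈ε⇒x≈y; x≈y⇒x∙y⁻¹≈ε)
    open import Algebra.Properties.Ring R.ring using (-‿distribʳ-*)

-- Polynomials over a domain: divisibility and order of vanishing

record IsDomain {c ℓ} (K : CommutativeRing c ℓ) : Set (c ⊔ ℓ) where
  open CommutativeRing K
  field
    cancel : ∀ {a b} → ¬ a ≈ 0# → a * b ≈ 0# → b ≈ 0#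
    1≉0    : ¬ 1# ≈ 0#

module PolynomialDomain {c ℓ} (K : CommutativeRing c ℓ) (K-domain : IsDomain K) where

  private module K = CommutativeRing K
  open IsDomain K-domain
  open K using (Carrier; _≈_; 0#; 1#; _+_; _*_; -_)
  open Polynomial K
  open import Algebra.Properties.CommutativeMonoid.Mult K.+-commutativeMonoid using () renaming (_×_ to _·_; ×-homo-+ to ·-homo-+; ×-congʳ to ·-congʳ)
  open import Algebra.Properties.Semiring.Mult K.semiring using () renaming (×-assoc-* to ·-assoc-*)
  open import Algebra.Properties.Ring K.ring using (+-cancelˡ)
  import Algebra.Properties.Ring R.ring as RP
  import Algebra.Properties.CommutativeSemigroup R.*-commutativeSemigroup as RC
  open import Algebra.Properties.Semiring.Exp K.semiring using () renaming (_^_ to _^ᴷ_)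

  infix 4 _∣ᴾ_
  _∣ᴾ_ : Poly → Poly → Set (c ⊔ ℓ)
  P ∣ᴾ Q = ∃[ S ] Q ≋ P ⊠ S

  ∣-cong : ∀ {P Q Q′} → Q ≋ Q′ → P ∣ᴾ Q → P ∣ᴾ Q′
  ∣-cong e (S , f) = S , R.trans (R.sym e) f

  NonVanishing : Poly → Carrier → Set ℓ
  NonVanishing P v = ¬ P ⟨ v ⟩ ≈ 0#

  nonzero-* : ∀ {a b} → ¬ a ≈ 0# → ¬ b ≈ 0# → ¬ a * b ≈ 0#
  nonzero-* a≉0 b≉0 ab≈0 = b≉0 (cancel a≉0 ab≈0)

  eval-1 : ∀ v → R.1# ⟨ v ⟩ ≈ 1#
  eval-1 = eval-con 1#

  eval-^ : ∀ P n v → (P ^ n) ⟨ v ⟩ ≈ P ⟨ v ⟩ ^ᴷ n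
  eval-^ P zero    v = eval-1 v
  eval-^ P (suc n) v = K.trans (eval-⊠ P (P ^ n) v) (K.*-congˡ (eval-^ P n v))

  nonvanishing-^ : ∀ {P v} → NonVanishing P v → ∀ n → NonVanishing (P ^ n) v
  nonvanishing-^ {P} {v} nv zero    e = 1≉0 (K.trans (K.sym (eval-1 v)) e)
  nonvanishing-^ {P} {v} nv (suc n) e = nonzero-* nv (nonvanishing-^ {P} {v} nv n) (K.trans (K.sym (eval-⊠ P (P ^ n) v)) e)

  lin-root : ∀ u → lin u ⟨ u ⟩ ≈ 0#
  lin-root u = K.trans (eval-lin u u) (K.-‿inverseʳ u)

  lin-nonvanishing : ∀ {u v} → ¬ v ≈ u → NonVanishing (lin u) v
  lin-nonvanishing {u} {v} v≉u e = v≉u (x∙y⁻¹≈ε⇒x≈y v u (K.trans (K.sym (eval-lin u v)) e))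
    where open import Algebra.Properties.Group K.+-group using (x∙y⁻¹≈ε⇒x≈y)

  lin∣⇒root : ∀ {u P} → lin u ∣ᴾ P → P ⟨ u ⟩ ≈ 0#
  lin∣⇒root {u} (S , e) = K.trans (eval-cong u e) (K.trans (eval-⊠ (lin u) S u) (K.trans (K.*-congʳ (lin-root u)) (K.zeroˡ _)))

  lin^-cancel-0 : ∀ u n P → lin u ^ n ⊠ P ≋ [] → P ≋ []
  lin^-cancel-0 u zero    P e = R.trans (R.sym (R.*-identityˡ P)) e
  lin^-cancel-0 u (suc n) P e = lin^-cancel-0 u n P (lin-cancel-0 u _ (R.trans (R.sym (R.*-assoc (lin u) (lin u ^ n) P)) e))

  -- Evaluation at v shows that G has the root, because H does not vanish there. One factor X - v is
  -- then cancelled and the argument repeats; this takes the place of unique factorisation.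
  ∣-cofactor : ∀ v k {H G} → NonVanishing H v → lin v ^ k ∣ᴾ (H ⊠ G) → lin v ^ k ∣ᴾ G
  ∣-cofactor v zero    {H} {G} nv d       = G , R.sym (R.*-identityˡ G)
  ∣-cofactor v (suc k) {H} {G} nv (S , e) =
    proj₁ ih , (begin
      G ≈⟨ G≋ ⟩
      lin v ⊠ G′ ≈⟨ R.*-congˡ (proj₂ ih) ⟩
      lin v ⊠ (lin v ^ k ⊠ proj₁ ih) ≈⟨ R.*-assoc _ _ _ ⟨
      lin v ^ suc k ⊠ proj₁ ih ∎)
    where
    open import Relation.Binary.Reasoning.Setoid R.setoid
    e′ : H ⊠ G ≋ lin v ⊠ (lin v ^ k ⊠ S)
    e′ = R.trans e (R.*-assoc (lin v) (lin v ^ k) S)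
    G⟨v⟩≈0 : G ⟨ v ⟩ ≈ 0#
    G⟨v⟩≈0 = cancel nv (K.trans (K.sym (eval-⊠ H G v)) (lin∣⇒root (_ , e′)))
    G′ = divide v G
    G≋ : G ≋ lin v ⊠ G′
    G≋ = factor v G G⟨v⟩≈0
    ih = ∣-cofactor v k {H} {G′} nv (S , lin-cancel v (H ⊠ G′) (lin v ^ k ⊠ S) (begin
      lin v ⊠ (H ⊠ G′) ≈⟨ RC.x∙yz≈y∙xz (lin v) H G′ ⟩
      H ⊠ (lin v ⊠ G′) ≈⟨ R.*-congˡ G≋ ⟨
      H ⊠ G ≈⟨ e′ ⟩
      lin v ⊠ (lin v ^ k ⊠ S) ∎))

  ∏lin : ℕ → List Carrier → Poly
  ∏lin D []       = R.1#
  ∏lin D (u ∷ us) = lin u ^ D ⊠ ∏lin D us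

  ∏lin-nonvanishing : ∀ D us v → All (λ u → ¬ v ≈ u) us → NonVanishing (∏lin D us) v
  ∏lin-nonvanishing D []       v []          e = 1≉0 (K.trans (K.sym (eval-1 v)) e)
  ∏lin-nonvanishing D (u ∷ us) v (v≉u ∷ v≉us) e =
    nonzero-* (nonvanishing-^ {lin u} (lin-nonvanishing v≉u) D) (∏lin-nonvanishing D us v v≉us)
      (K.trans (K.sym (eval-⊠ (lin u ^ D) (∏lin D us) v)) e)

  ∏lin∣ : ∀ D us {P} → AllPairs (λ u v → ¬ u ≈ v) us → All (λ u → lin u ^ D ∣ᴾ P) us → ∏lin D us ∣ᴾ P
  ∏lin∣ D []       {P} _            _        = P , R.sym (R.*-identityˡ P)
  ∏lin∣ D (u ∷ us) {P} (u≉us ∷ uniq) (d ∷ ds) with ∏lin∣ D us {P} uniq ds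
  ... | S , e with ∣-cofactor u D {∏lin D us} {S} (∏lin-nonvanishing D us u u≉us) (∣-cong e d)
  ...   | S′ , e′ = S′ , (begin
    P ≈⟨ e ⟩
    ∏lin D us ⊠ S ≈⟨ R.*-congˡ e′ ⟩
    ∏lin D us ⊠ (lin u ^ D ⊠ S′) ≈⟨ RC.x∙yz≈y∙xz (∏lin D us) (lin u ^ D) S′ ⟩
    lin u ^ D ⊠ (∏lin D us ⊠ S′) ≈⟨ R.*-assoc _ _ _ ⟨
    lin u ^ D ⊠ ∏lin D us ⊠ S′ ∎)
    where open import Relation.Binary.Reasoning.Setoid R.setoid

  Deg<-lin^⁻¹ : ∀ u D {n} P → Deg< (D ℕ.+ n) (lin u ^ D ⊠ P) → Deg< n P
  Deg<-lin^⁻¹ u zero    {n} P d = Deg<-cong {n} (R.*-identityˡ P) d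
  Deg<-lin^⁻¹ u (suc D) {n} P d = Deg<-lin^⁻¹ u D P (Deg<-lin⁻¹ u (lin u ^ D ⊠ P)
    (Deg<-cong {suc D ℕ.+ n} (R.*-assoc (lin u) (lin u ^ D) P) d))

  Deg<-∏lin⁻¹ : ∀ D us P → Deg< (length us ℕ.* D) (∏lin D us ⊠ P) → Deg< 0 P
  Deg<-∏lin⁻¹ D []       P d = Deg<-cong {0} (R.*-identityˡ P) d
  Deg<-∏lin⁻¹ D (u ∷ us) P d = Deg<-∏lin⁻¹ D us P (Deg<-lin^⁻¹ u D (∏lin D us ⊠ P)
    (Deg<-cong {D ℕ.+ length us ℕ.* D} (R.*-assoc (lin u ^ D) (∏lin D us) P) d))

  -- The product of all (X - u)^D divides P and is monic; P has no room for its degree.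
  too-many-zeros : ∀ D us {P} → AllPairs (λ u v → ¬ u ≈ v) us → All (λ u → lin u ^ D ∣ᴾ P) us →
                   Deg< (length us ℕ.* D) P → P ≋ []
  too-many-zeros D us {P} uniq ds deg with ∏lin∣ D us {P} uniq ds
  ... | S , e = R.trans e (R.trans (R.*-congˡ (Deg<0⇒≋[] (Deg<-∏lin⁻¹ D us S (Deg<-cong {length us ℕ.* D} e deg)))) (R.zeroʳ _))

  root-count : ∀ {n} us {P} → AllPairs (λ u v → ¬ u ≈ v) us → All (λ u → P ⟨ u ⟩ ≈ 0#) us →
               Deg< (suc n) P → ¬ P ≋ [] → length us ℕ.≤ n
  root-count {n} us {P} uniq roots deg P≉0 = ℕ.≮⇒≥ λ n<len → P≉0 (too-many-zeros 1 us uniq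
    (All.map (λ {u} r → divide u P , R.trans (factor u P r) (R.*-congʳ (R.sym (R.*-identityʳ (lin u))))) roots)
    (Deg<-mono {suc n} {length us ℕ.* 1} {P} (ℕ.≤-trans n<len (ℕ.≤-reflexive (≡.sym (ℕ.*-identityʳ (length us))))) deg))

  -- Multiplied through by Y, the power rule avoids the exponent n - 1. It serves both X and X - u.
  euler : ∀ Y → ∂ Y ≋ R.1# → ∀ n → Y ⊠ ∂ (Y ^ n) ≋ n • Y ^ n
  euler Y ∂Y zero    = R.trans (R.*-congˡ ∂-1) (R.zeroʳ Y)
  euler Y ∂Y (suc n) = begin
    Y ⊠ ∂ (Y ⊠ Y ^ n) ≈⟨ R.*-congˡ (∂-⊠ Y (Y ^ n)) ⟩
    Y ⊠ (∂ Y ⊠ Y ^ n ⊹ Y ⊠ ∂ (Y ^ n)) ≈⟨ R.*-congˡ (R.+-cong (R.trans (R.*-congʳ ∂Y) (R.*-identityˡ _)) (euler Y ∂Y n)) ⟩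
    Y ⊠ (Y ^ n ⊹ n • Y ^ n) ≈⟨ R.distribˡ Y _ _ ⟩
    Y ⊠ Y ^ n ⊹ Y ⊠ (n • Y ^ n) ≈⟨ R.+-congˡ (•-comm-* n Y (Y ^ n)) ⟩
    suc n • (Y ⊠ Y ^ n) ∎
    where open import Relation.Binary.Reasoning.Setoid R.setoid

  cofactor-∂ : Carrier → Poly → ℕ → Poly → Poly
  cofactor-∂ u W k H = (suc k • W) ⊠ H ⊹ lin u ⊠ (W ⊠ ∂ H)

  -- The product rule: differentiation costs just one factor X - u. The multiplier W will be X (X -
  -- 1) for the auxiliary polynomial and X for sparse polynomials.
  W∂-lin^ : ∀ u W k H → W ⊠ ∂ (lin u ^ suc k ⊠ H) ≋ lin u ^ k ⊠ cofactor-∂ u W k H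
  W∂-lin^ u W k H = begin
    W ⊠ ∂ (L ⊠ L ^ k ⊠ H)
      ≈⟨ R.*-congˡ (∂-⊠ (L ⊠ L ^ k) H) ⟩
    W ⊠ (∂ (L ⊠ L ^ k) ⊠ H ⊹ L ⊠ L ^ k ⊠ ∂ H)
      ≈⟨ R.*-congˡ (R.+-cong (R.*-congʳ ∂L^) (R.trans (R.*-congʳ (R.*-comm L (L ^ k))) (R.*-assoc _ _ _))) ⟩
    W ⊠ (suc k • L ^ k ⊠ H ⊹ L ^ k ⊠ (L ⊠ ∂ H))
      ≈⟨ R.distribˡ W _ _ ⟩
    W ⊠ (suc k • L ^ k ⊠ H) ⊹ W ⊠ (L ^ k ⊠ (L ⊠ ∂ H))
      ≈⟨ R.+-cong left right ⟩
    L ^ k ⊠ (suc k • W ⊠ H) ⊹ L ^ k ⊠ (L ⊠ (W ⊠ ∂ H))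
      ≈⟨ R.distribˡ (L ^ k) _ _ ⟨
    L ^ k ⊠ cofactor-∂ u W k H ∎
    where
    open import Relation.Binary.Reasoning.Setoid R.setoid
    L = lin u
    ∂L^ : ∂ (L ⊠ L ^ k) ≋ suc k • L ^ k
    ∂L^ = begin
      ∂ (L ⊠ L ^ k) ≈⟨ ∂-⊠ L (L ^ k) ⟩
      ∂ L ⊠ L ^ k ⊹ L ⊠ ∂ (L ^ k) ≈⟨ R.+-cong (R.trans (R.*-congʳ (∂-lin u)) (R.*-identityˡ _)) (euler L (∂-lin u) k) ⟩
      suc k • L ^ k ∎
    left : W ⊠ (suc k • L ^ k ⊠ H) ≋ L ^ k ⊠ (suc k • W ⊠ H)
    left = begin
      W ⊠ (suc k • L ^ k ⊠ H) ≈⟨ R.*-assoc W _ H ⟨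
      W ⊠ (suc k • L ^ k) ⊠ H ≈⟨ R.*-congʳ (R.trans (•-comm-* (suc k) W (L ^ k)) (R.trans (•-congʳ (suc k) (R.*-comm W (L ^ k)))
              (R.sym (•-comm-* (suc k) (L ^ k) W)))) ⟩
      L ^ k ⊠ (suc k • W) ⊠ H ≈⟨ R.*-assoc (L ^ k) _ H ⟩
      L ^ k ⊠ (suc k • W ⊠ H) ∎
    right : W ⊠ (L ^ k ⊠ (L ⊠ ∂ H)) ≋ L ^ k ⊠ (L ⊠ (W ⊠ ∂ H))
    right = R.trans (RC.x∙yz≈y∙xz W (L ^ k) _) (R.*-congˡ (RC.x∙yz≈y∙xz W L (∂ H)))

  eval-• : ∀ n P v → (n • P) ⟨ v ⟩ ≈ (n · 1#) * P ⟨ v ⟩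
  eval-• zero    P v = K.trans (eval-zero [] v R.refl) (K.sym (K.zeroˡ _))
  eval-• (suc n) P v = K.trans (eval-⊹ P (n • P) v) (K.trans (K.+-cong (K.sym (K.*-identityˡ _)) (eval-• n P v))
    (K.sym (K.distribʳ (P ⟨ v ⟩) 1# (n · 1#))))

  iterate : (Poly → Poly) → ℕ → Poly → Poly
  iterate f zero    P = P
  iterate f (suc k) P = iterate f k (f P)

  module Order (m : ℕ) (char : ∀ n → 0 ℕ.< n → n ℕ.< m → ¬ n · 1# ≈ 0#) where

    module _ (W : Poly) where

      θ : Poly → Poly
      θ P = W ⊠ ∂ P

      θ-cong : ∀ {P Q} → P ≋ Q → θ P ≋ θ Q
      θ-cong e = R.*-congˡ (∂-cong e)

      iterate-θ-cong : ∀ k {P Q} → P ≋ Q → iterate θ k P ≋ iterate θ k Q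
      iterate-θ-cong zero    e = e
      iterate-θ-cong (suc k) e = iterate-θ-cong k (θ-cong e)

      module _ (u : Carrier) (W⟨u⟩≉0 : NonVanishing W u) where

        -- The value at u is k! W(u)^k H(u): each θ lowers the exponent of X - u by one and
        -- multiplies the value of the cofactor by the old exponent and W(u), both nonzero in the
        -- field as k < m.
        leading-root : ∀ k → k ℕ.< m → ∀ H → iterate θ k (lin u ^ k ⊠ H) ⟨ u ⟩ ≈ 0# → H ⟨ u ⟩ ≈ 0#
        leading-root zero    k<m H e = K.trans (eval-cong u (R.sym (R.*-identityˡ H))) e
        leading-root (suc k) k<m H e = cancel (nonzero-* (char (suc k) (s≤s z≤n) k<m) W⟨u⟩≉0) (begin
          (suc k · 1#) * W ⟨ u ⟩ * H ⟨ u ⟩ ≈⟨ K.*-congʳ (eval-• (suc k) W u) ⟨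
          (suc k • W) ⟨ u ⟩ * H ⟨ u ⟩ ≈⟨ eval-⊠ (suc k • W) H u ⟨
          ((suc k • W) ⊠ H) ⟨ u ⟩ ≈⟨ K.+-identityʳ _ ⟨
          ((suc k • W) ⊠ H) ⟨ u ⟩ + 0# ≈⟨ K.+-congˡ (lin∣⇒root (_ , R.refl)) ⟨
          ((suc k • W) ⊠ H) ⟨ u ⟩ + (lin u ⊠ (W ⊠ ∂ H)) ⟨ u ⟩ ≈⟨ eval-⊹ ((suc k • W) ⊠ H) _ u ⟨
          cofactor-∂ u W k H ⟨ u ⟩ ≈⟨ leading-root k (ℕ.<-trans (ℕ.n<1+n k) k<m) (cofactor-∂ u W k H)
              (K.trans (eval-cong u (iterate-θ-cong k (R.sym (W∂-lin^ u W k H)))) e) ⟩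
          0# ∎)
          where open import Relation.Binary.Reasoning.Setoid K.setoid

        -- Once (X - u)^D divides P, the D-th iterate tests whether the cofactor vanishes at u. W
        -- d/dX detects the order as well as d/dX does, because W(u) ≠ 0.
        vanishing-order : ∀ D → D ℕ.≤ m → ∀ P → (∀ k → k ℕ.< D → iterate θ k P ⟨ u ⟩ ≈ 0#) → lin u ^ D ∣ᴾ P
        vanishing-order zero    D≤m P e = P , R.sym (R.*-identityˡ P)
        vanishing-order (suc D) D<m P e with vanishing-order D (ℕ.<⇒≤ D<m) P (λ k k<D → e k (ℕ.m≤n⇒m≤1+n k<D))
        ... | H , P≋ = divide u H , (begin
          P ≈⟨ P≋ ⟩
          lin u ^ D ⊠ H ≈⟨ R.*-congˡ (factor u H (leading-root D D<m H
              (K.trans (eval-cong u (iterate-θ-cong D (R.sym P≋))) (e D (ℕ.n<1+n D))))) ⟩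
          lin u ^ D ⊠ (lin u ⊠ divide u H) ≈⟨ RC.x∙yz≈yx∙z (lin u ^ D) (lin u) _ ⟩
          lin u ^ suc D ⊠ divide u H ∎)
          where open import Relation.Binary.Reasoning.Setoid R.setoid

    ·-injective : ∀ {i j} → i ℕ.< j → j ℕ.< m → ∀ {a} → i · a ≈ j · a → a ≈ 0#
    ·-injective {i} {j} i<j j<m {a} e = cancel (char (j ℕ.∸ i) (ℕ.m<n⇒0<n∸m i<j) (ℕ.≤-<-trans (ℕ.m∸n≤m j i) j<m))
      (K.trans (·-assoc-* (j ℕ.∸ i) 1# a) (K.trans (·-congʳ (j ℕ.∸ i) (K.*-identityˡ a))
        (K.sym (+-cancelˡ (i · a) 0# ((j ℕ.∸ i) · a) (K.trans (K.+-identityʳ _) (K.trans e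
          (K.trans (K.reflexive (≡.cong (_· a) (≡.sym (ℕ.m+[n∸m]≡n (ℕ.<⇒≤ i<j))))) (·-homo-+ a i (j ℕ.∸ i)))))))))

    ·-injective-≢ : ∀ {i j} → i ≢ j → i ℕ.< m → j ℕ.< m → ∀ {a} → i · a ≈ j · a → a ≈ 0#
    ·-injective-≢ {i} {j} i≢j i<m j<m e with ℕ.<-cmp i j
    ... | tri< i<j _ _ = ·-injective i<j j<m e
    ... | tri≈ _ i≡j _ = contradiction i≡j i≢j
    ... | tri> _ _ j<i = ·-injective j<i i<m (K.sym e)

    opaque
      unfolding _⟨_⟩

      eval-monomial : ∀ P s v → (∀ i → i ≢ s → coef P i ≈ 0#) → P ⟨ v ⟩ ≈ coef P s * v ^ᴷ s
      eval-monomial []      s       v off = K.sym (K.zeroˡ _)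
      eval-monomial (a ∷ P) zero    v off = K.trans (K.+-congˡ (K.trans (K.*-congˡ (eval-zero P v (mk≋ λ i → off (suc i) (λ ())))) (K.zeroʳ v)))
        (K.trans (K.+-identityʳ a) (K.sym (K.*-identityʳ a)))
      eval-monomial (a ∷ P) (suc s) v off = K.trans (K.+-cong (off 0 (λ ())) (K.*-congˡ (eval-monomial P s v (λ i i≢s → off (suc i) (i≢s ∘ ℕ.suc-injective)))))
        (K.trans (K.+-identityˡ _) (x∙yz≈y∙xz v (coef P s) (v ^ᴷ s)))
        where open import Algebra.Properties.CommutativeSemigroup K.*-commutativeSemigroup using (x∙yz≈y∙xz)

    coef-X∂ : ∀ P i → coef (X ⊠ ∂ P) i ≈ i · coef P i
    coef-X∂ P zero    = coef≈ (X⊠ (∂ P)) 0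
    coef-X∂ P (suc i) = K.trans (coef≈ (X⊠ (∂ P)) (suc i)) (coef-∂ P i)

    coef-• : ∀ n P i → coef (n • P) i ≈ n · coef P i
    coef-• zero    P i = K.refl
    coef-• (suc n) P i = K.trans (coef-⊹ P (n • P) i) (K.+-congˡ (coef-• n P i))

    -- Applying X d/dX − s kills the monomial Xˢ and lowers the order of vanishing by at most one.
    sparse⇒zero : ∀ {v} → ¬ v ≈ 0# → ∀ S P → All (ℕ._< m) S → (∀ i → i ∉ˡ S → coef P i ≈ 0#) →
                  lin v ^ length S ∣ᴾ P → P ≋ []
    sparse⇒zero v≉0 []      P _ off d = mk≋ λ i → off i λ ()
    sparse⇒zero {v} v≉0 (s ∷ S) P (s<m ∷ S<m) off (H , P≋) = mk≋ coef-zero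
      where
      open import Relation.Binary.Reasoning.Setoid R.setoid
      L = lin v
      k = length S
      P′ : Poly
      P′ = X ⊠ ∂ P ⊹ neg (s • P)
      coef-P′ : ∀ i → coef P′ i ≈ i · coef P i + - (s · coef P i)
      coef-P′ i = K.trans (coef-⊹ (X ⊠ ∂ P) (neg (s • P)) i)
        (K.+-cong (coef-X∂ P i) (K.trans (coef-neg (s • P) i) (K.-‿cong (coef-• s P i))))
      off′ : ∀ i → i ∉ˡ S → coef P′ i ≈ 0#
      off′ i i∉S with i ℕ.≟ s
      ... | yes ≡.refl = K.trans (coef-P′ i) (K.-‿inverseʳ _)
      ... | no i≢s = K.trans (coef-P′ i) (K.trans (K.+-cong (·-vanish i) (K.-‿cong (·-vanish s))) (K.-‿inverseʳ 0#))
        where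
        Pᵢ≈0 : coef P i ≈ 0#
        Pᵢ≈0 = off i λ { (here e) → i≢s e ; (there i∈S) → i∉S i∈S }
        ·-vanish : ∀ n → n · coef P i ≈ 0#
        ·-vanish n = K.trans (·-congʳ n Pᵢ≈0) (·-zeroʳ n)
      divides : L ^ k ∣ᴾ P′
      divides = cofactor-∂ v X k H ⊹ neg (s • (L ⊠ H)) , (begin
        X ⊠ ∂ P ⊹ neg (s • P)
          ≈⟨ R.+-cong (R.trans (R.*-congˡ (∂-cong P≋)) (W∂-lin^ v X k H)) (R.-‿cong (•-congʳ s P≋)) ⟩
        L ^ k ⊠ cofactor-∂ v X k H ⊹ neg (s • (L ⊠ L ^ k ⊠ H))
          ≈⟨ R.+-congˡ (R.-‿cong (•-congʳ s (R.trans (R.*-congʳ (R.*-comm L (L ^ k))) (R.*-assoc _ _ _)))) ⟩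
        L ^ k ⊠ cofactor-∂ v X k H ⊹ neg (s • (L ^ k ⊠ (L ⊠ H)))
          ≈⟨ R.+-congˡ (R.trans (R.-‿cong (R.sym (•-comm-* s (L ^ k) (L ⊠ H)))) (RP.-‿distribʳ-* (L ^ k) _)) ⟩
        L ^ k ⊠ cofactor-∂ v X k H ⊹ L ^ k ⊠ neg (s • (L ⊠ H))
          ≈⟨ R.distribˡ (L ^ k) _ _ ⟨
        L ^ k ⊠ (cofactor-∂ v X k H ⊹ neg (s • (L ⊠ H))) ∎)
      P′≋0 : P′ ≋ []
      P′≋0 = sparse⇒zero v≉0 S P′ S<m off′ divides
      i·≈s· : ∀ i → i · coef P i ≈ s · coef P i
      i·≈s· i = x∙y⁻¹≈ε⇒x≈y _ _ (K.trans (K.sym (coef-P′ i)) (coef≈ P′≋0 i))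
        where open import Algebra.Properties.Group K.+-group using (x∙y⁻¹≈ε⇒x≈y)
      -- The coefficients of `P′` are i - s times those of P. Exponents below m stay distinct in the
      -- field, so the vanishing of `P′` kills all coefficients except the one at s.
      off-s : ∀ i → i ≢ s → coef P i ≈ 0#
      off-s i i≢s with DecMembership._∈?_ ℕ._≟_ i S
      ... | yes i∈S = ·-injective-≢ i≢s (All.lookup S<m i∈S) s<m (i·≈s· i)
      ... | no i∉S  = off i λ { (here e) → i≢s e ; (there i∈S) → i∉S i∈S }
      nonzero-^ : ∀ n → ¬ v ^ᴷ n ≈ 0#
      nonzero-^ zero    = 1≉0
      nonzero-^ (suc n) = nonzero-* v≉0 (nonzero-^ n)
      coef-zero : ∀ i → coef P i ≈ 0#
      coef-zero i with i ℕ.≟ s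
      ... | no i≢s = off-s i i≢s
      -- What remains is a single monomial, and one of the factors X - v of P forces it to vanish at
      -- v ≠ 0.
      ... | yes ≡.refl = cancel (nonzero-^ s) (K.trans (K.*-comm _ _) (K.trans (K.sym (eval-monomial P s v off-s))
            (lin∣⇒root (L ^ k ⊠ H , R.trans P≋ (R.*-assoc L (L ^ k) H)))))

-- Stepanov's method

funToFin-cong : ∀ {m n} {f g : Fin m → Fin n} → f ≗ g → funToFin f ≡ funToFin g
funToFin-cong {zero}  f≗g = ≡.refl
funToFin-cong {suc m} f≗g = ≡.cong₂ combine (f≗g zero) (funToFin-cong (f≗g ∘ suc))

-- Counting in place of linear algebra: q^N inputs and only q^M outputs, so two inputs collide. For
-- additive H their difference is the nonzero solution of the homogeneous system.
underdetermined : ∀ {q M N} → 1 ℕ.< q → M ℕ.< N → (H : (Fin N → Fin q) → (Fin M → Fin q)) →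
                  ∃₂ λ x y → (∃[ i ] x i ≢ y i) × H x ≗ H y
underdetermined {q} {M} {N} 1<q M<N H
  with pigeonhole (ℕ.^-monoʳ-< q 1<q M<N) (λ k → funToFin (H (finToFun k)))
... | i , j , i<j , eq = finToFun i , finToFun j , differ ,
      λ e → ≡.trans (≡.sym (finToFun-funToFin (H (finToFun i)) e))
              (≡.trans (≡.cong (λ k → finToFun {q} {M} k e) eq) (finToFun-funToFin (H (finToFun j)) e))
  where
  differ : ∃[ e ] finToFun {q} {N} i e ≢ finToFun j e
  differ with any? (λ e → ¬? (finToFun {q} {N} i e Fin.≟ finToFun j e))
  ... | yes d = d
  ... | no ¬d = contradiction (≡.trans (≡.sym (funToFin-finToFin {N} {q} i)) (≡.trans
          (funToFin-cong (λ e → decidable-stable (_ Fin.≟ _) (λ ne → ¬d (e , ne)))) (funToFin-finToFin {N} {q} j)))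
          (Fin.<⇒≢ i<j)

uncurry₃ : ∀ {a b c} {A : Set} → (Fin a → Fin b → Fin c → A) → Fin (a ℕ.* (b ℕ.* c)) → A
uncurry₃ {a} {b} {c} f e = uncurry (λ j e′ → uncurry (f j) (remQuot {b} c e′)) (remQuot {a} (b ℕ.* c) e)

uncurry₃-combine : ∀ {a b c} {A : Set} (f : Fin a → Fin b → Fin c → A) j k i →
                   uncurry₃ f (combine j (combine k i)) ≡ f j k i
uncurry₃-combine {a} {b} {c} f j k i =
  ≡.trans (≡.cong (uncurry (λ j e′ → uncurry (f j) (remQuot {b} c e′))) (remQuot-combine j (combine k i)))
          (≡.cong (uncurry (f j)) (remQuot-combine k i))

finiteField-domain : ∀ {q} (𝔽 : FiniteField q) → IsDomain (FiniteField.commutativeRing 𝔽)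
finiteField-domain 𝔽 = record { cancel = cancel ; 1≉0 = 1F≢0F }
  where
  open FiniteField 𝔽
  module F = CommutativeRing commutativeRing
  cancel : ∀ {a b} → a ≢ 0F → a ⊡ b ≡ 0F → b ≡ 0F
  cancel {a} {b} a≢0 ab≡0 with inverse a a≢0
  ... | a⁻¹ , aa⁻¹≡1 = begin
    b ≡⟨ F.*-identityˡ b ⟨
    1F ⊡ b ≡⟨ ≡.cong (_⊡ b) (≡.trans (F.*-comm a⁻¹ a) aa⁻¹≡1) ⟨
    a⁻¹ ⊡ a ⊡ b ≡⟨ F.*-assoc a⁻¹ a b ⟩
    a⁻¹ ⊡ (a ⊡ b) ≡⟨ ≡.cong (a⁻¹ ⊡_) ab≡0 ⟩
    a⁻¹ ⊡ 0F ≡⟨ F.zeroʳ a⁻¹ ⟩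
    0F ∎
    where open ≡.≡-Reasoning

module Stepanov {q : ℕ} (𝔽 : FiniteField q) where

  open FiniteField 𝔽
  private module F = CommutativeRing commutativeRing
  open Polynomial commutativeRing
  open PolynomialDomain commutativeRing (finiteField-domain 𝔽)
  open import Algebra.Properties.Semiring.Sum R.semiring using () renaming (sum to ∑ᴾ; sum-cong-≋ to ∑ᴾ-cong; ∑-distrib-+ to ∑ᴾ-⊹; *-distribˡ-sum to ⊠-∑ᴾ)
  open import Algebra.Properties.Monoid.Mult F.+-monoid using () renaming (_×_ to _·_)
  open import Algebra.Properties.Semiring.Exp F.semiring using () renaming (_^_ to _^ᶠ_)
  open import Algebra.Properties.Semiring.Exp R.semiring using (^-homo-*)
  import Algebra.Properties.CommutativeSemigroup R.*-commutativeSemigroup as RC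
  import Algebra.Properties.CommutativeSemigroup R.+-commutativeSemigroup as RA
  import Algebra.Properties.Ring R.ring as RP
  open import Relation.Binary.Reasoning.Setoid R.setoid

  horner : ∀ {n} → Poly → (Fin n → Poly) → Poly
  horner Z f = ∑ᴾ (λ b → f b ⊠ Z ^ toℕ b)

  horner-suc : ∀ {n} Z (f : Fin (suc n) → Poly) → horner Z f ≋ f zero ⊹ Z ⊠ horner Z (f ∘ suc)
  horner-suc Z f = R.+-cong (R.*-identityʳ (f zero)) (begin
    ∑ᴾ (λ b → f (suc b) ⊠ (Z ⊠ Z ^ toℕ b)) ≈⟨ ∑ᴾ-cong (λ b → RC.x∙yz≈y∙xz (f (suc b)) Z (Z ^ toℕ b)) ⟩
    ∑ᴾ (λ b → Z ⊠ (f (suc b) ⊠ Z ^ toℕ b)) ≈⟨ ⊠-∑ᴾ Z (λ b → f (suc b) ⊠ Z ^ toℕ b) ⟨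
    Z ⊠ horner Z (f ∘ suc) ∎)

  horner-cong : ∀ {n} Z {f g : Fin n → Poly} → (∀ b → f b ≋ g b) → horner Z f ≋ horner Z g
  horner-cong Z e = ∑ᴾ-cong (λ b → R.*-congʳ (e b))

  horner-⊹ : ∀ {n} Z (f g : Fin n → Poly) → horner Z f ⊹ horner Z g ≋ horner Z (λ b → f b ⊹ g b)
  horner-⊹ Z f g = R.sym (R.trans (∑ᴾ-cong (λ b → R.distribʳ (Z ^ toℕ b) (f b) (g b)))
    (∑ᴾ-⊹ (λ b → f b ⊠ Z ^ toℕ b) (λ b → g b ⊠ Z ^ toℕ b)))

  horner-⊠ : ∀ {n} Z P (f : Fin n → Poly) → P ⊠ horner Z f ≋ horner Z (λ b → P ⊠ f b)
  horner-⊠ Z P f = R.trans (⊠-∑ᴾ P (λ b → f b ⊠ Z ^ toℕ b)) (∑ᴾ-cong (λ b → R.sym (R.*-assoc P (f b) (Z ^ toℕ b))))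

  horner-eval : ∀ {n} {Z Z′} u {f g : Fin n → Poly} → Z ⟨ u ⟩ ≡ Z′ ⟨ u ⟩ → (∀ b → f b ⟨ u ⟩ ≡ g b ⟨ u ⟩) →
                horner Z f ⟨ u ⟩ ≡ horner Z′ g ⟨ u ⟩
  horner-eval {zero}  u eZ ef = ≡.refl
  horner-eval {suc n} {Z} {Z′} u {f} {g} eZ ef = step Z f
    (≡.trans (≡.cong₂ (λ a b → a ⊞ b) (ef zero) (≡.cong₂ _⊡_ eZ (horner-eval {n} {Z} {Z′} u eZ (ef ∘ suc)))) (≡.sym (step′ Z′ g)))
    where
    step′ : ∀ Z (f : Fin (suc n) → Poly) → horner Z f ⟨ u ⟩ ≡ f zero ⟨ u ⟩ ⊞ Z ⟨ u ⟩ ⊡ horner Z (f ∘ suc) ⟨ u ⟩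
    step′ Z f = ≡.trans (eval-cong u (horner-suc Z f)) (≡.trans (eval-⊹ (f zero) _ u) (≡.cong (f zero ⟨ u ⟩ ⊞_) (eval-⊠ Z (horner Z (f ∘ suc)) u)))
    step : ∀ Z (f : Fin (suc n) → Poly) {x} → f zero ⟨ u ⟩ ⊞ Z ⟨ u ⟩ ⊡ horner Z (f ∘ suc) ⟨ u ⟩ ≡ x → horner Z f ⟨ u ⟩ ≡ x
    step Z f e = ≡.trans (step′ Z f) e

  Deg<-horner : ∀ {n m} B Z d → Deg< (suc d) Z → (f : Fin n → Poly) → n ℕ.≤ B → (∀ b → Deg< m (f b)) →
                Deg< (B ℕ.* d ℕ.+ m) (horner Z f)
  Deg<-horner {n} {m} B Z d dZ f n≤B df = go f (toℕ) (λ b → ℕ.≤-trans (ℕ.<⇒≤ (toℕ<n b)) n≤B) df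
    where
    -- The exponents are generalised from `toℕ` to any function bounded by B, so that the induction
    -- survives composition with `suc`.
    go : ∀ {n} (f : Fin n → Poly) (e : Fin n → ℕ) → (∀ b → e b ℕ.≤ B) → (∀ b → Deg< m (f b)) →
         Deg< (B ℕ.* d ℕ.+ m) (∑ᴾ (λ b → f b ⊠ Z ^ e b))
    go {zero}  f e e≤B df = ≋[]⇒Deg< {B ℕ.* d ℕ.+ m} R.refl
    go {suc n} f e e≤B df = Deg<-⊹ {B ℕ.* d ℕ.+ m} {f zero ⊠ Z ^ e zero}
      (Deg<-cong {B ℕ.* d ℕ.+ m} (R.*-comm (Z ^ e zero) (f zero))
        (Deg<-mono {e zero ℕ.* d ℕ.+ m} {B ℕ.* d ℕ.+ m} {Z ^ e zero ⊠ f zero} (ℕ.+-monoˡ-≤ m (ℕ.*-monoˡ-≤ d (e≤B zero)))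
          (Deg<-⊠ (Z ^ e zero) (f zero) (Deg<-^ {d} Z dZ (e zero)) (df zero))))
      (go (f ∘ suc) (e ∘ suc) (e≤B ∘ suc) (df ∘ suc))

  X^⊠ : ∀ n P → X ^ suc n ⊠ P ≋ 0F ∷ (X ^ n ⊠ P)
  X^⊠ n P = R.trans (R.*-assoc X (X ^ n) P) (X⊠ (X ^ n ⊠ P))

  coef-X^⊠-low : ∀ n P i → i ℕ.< n → coef (X ^ n ⊠ P) i ≡ 0F
  coef-X^⊠-low (suc n) P zero    _        = coef≈ (X^⊠ n P) 0
  coef-X^⊠-low (suc n) P (suc i) (s≤s lt) = ≡.trans (coef≈ (X^⊠ n P) (suc i)) (coef-X^⊠-low n P i lt)

  coef-X^⊠-high : ∀ n P i → coef (X ^ n ⊠ P) (n ℕ.+ i) ≡ coef P i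
  coef-X^⊠-high zero    P i = coef≈ (R.*-identityˡ P) i
  coef-X^⊠-high (suc n) P i = ≡.trans (coef≈ (X^⊠ n P) (suc n ℕ.+ i)) (coef-X^⊠-high n P i)

  tabulate-⊹ : ∀ {n} (f g : Fin n → Fin q) → tabulate (λ i → f i ⊞ g i) ≋ tabulate f ⊹ tabulate g
  tabulate-⊹ f g = mk≋ λ i → ≡.trans (go f g i) (≡.sym (coef-⊹ (tabulate f) (tabulate g) i))
    where
    go : ∀ {n} (f g : Fin n → Fin q) i → coef (tabulate (λ i → f i ⊞ g i)) i ≡ coef (tabulate f) i ⊞ coef (tabulate g) i
    go {zero}  f g i       = ≡.sym (F.+-identityʳ 0F)
    go {suc n} f g zero    = ≡.refl
    go {suc n} f g (suc i) = go (f ∘ suc) (g ∘ suc) i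

  coef-tabulate : ∀ {n} (f : Fin n → Fin q) i → coef (tabulate f) (toℕ i) ≡ f i
  coef-tabulate f zero    = ≡.refl
  coef-tabulate f (suc i) = coef-tabulate (f ∘ suc) i

  Deg<-tabulate : ∀ {n} (f : Fin n → Fin q) → Deg< n (tabulate f)
  Deg<-tabulate {zero}  f i       _        = ≡.refl
  Deg<-tabulate {suc n} f (suc i) (s≤s le) = Deg<-tabulate (f ∘ suc) i le

  -- The auxiliary polynomial: nonvanishing and derivatives

  module Auxiliary (char : ∀ n → 0 ℕ.< n → n ℕ.< q → n · 1F ≢ 0F) (t : ℕ) where

    open Order q char

    Z Y : Poly
    Z = X ^ t
    Y = lin 1F ^ t

    support : ℕ → ℕ → List ℕ
    support D zero    = []
    support D (suc B) = upTo D ++ List.map (t ℕ.+_) (support D B)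

    length-support : ∀ D B → length (support D B) ≡ B ℕ.* D
    length-support D zero    = ≡.refl
    length-support D (suc B) = ≡.trans (length-++ (upTo D)) (≡.cong₂ ℕ._+_ (length-upTo D)
      (≡.trans (length-map (t ℕ.+_) (support D B)) (length-support D B)))

    support-< : ∀ D B → D ℕ.≤ t → All (ℕ._< B ℕ.* t) (support D B)
    support-< D zero    D≤t = []
    support-< D (suc B) D≤t = All.++⁺ (All.applyUpTo⁺₁ (λ i → i) D (λ i<D → ℕ.<-≤-trans i<D (ℕ.≤-trans D≤t (ℕ.m≤m+n t (B ℕ.* t)))))
      (All.map⁺ (All.map (ℕ.+-monoʳ-< t) (support-< D B D≤t)))

    horner-support : ∀ D {B} (f : Fin B → Poly) → (∀ b → Deg< D (f b)) → ∀ i → i ∉ˡ support D B → coef (horner Z f) i ≡ 0F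
    horner-support D {zero}  f df i i∉ = ≡.refl
    horner-support D {suc B} f df i i∉ = ≡.trans (coef≈ (horner-suc Z f) i) (≡.trans (coef-⊹ (f zero) (Z ⊠ horner Z (f ∘ suc)) i)
      (≡.trans (≡.cong₂ _⊞_ (df zero i (ℕ.≮⇒≥ (λ i<D → i∉ (∈-++⁺ˡ (∈-upTo⁺ i<D))))) high) (F.+-identityʳ 0F)))
      where
      high : coef (Z ⊠ horner Z (f ∘ suc)) i ≡ 0F
      high with i ℕ.<? t
      ... | yes i<t = coef-X^⊠-low t (horner Z (f ∘ suc)) i i<t
      ... | no i≮t  = ≡.trans (≡.cong (coef (Z ⊠ horner Z (f ∘ suc))) (≡.sym i≡))
              (≡.trans (coef-X^⊠-high t (horner Z (f ∘ suc)) (i ℕ.∸ t))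
                (horner-support D (f ∘ suc) (df ∘ suc) (i ℕ.∸ t) (λ ∈s → i∉ (∈-++⁺ʳ (upTo D) (≡.subst (_∈ˡ _) i≡ (∈-map⁺ (t ℕ.+_) ∈s))))))
        where
        i≡ : t ℕ.+ (i ℕ.∸ t) ≡ i
        i≡ = ℕ.m+[n∸m]≡n (ℕ.≮⇒≥ i≮t)

    -- Because D ≤ t, the blocks f_b X^(tb) occupy disjoint ranges of exponents: coefficients below
    -- t see only `f zero`, and those from t on see the rest.
    horner-Z-zero : ∀ D {B} (f : Fin B → Poly) → D ℕ.≤ t → (∀ b → Deg< D (f b)) → horner Z f ≋ [] → ∀ b → f b ≋ []
    horner-Z-zero D {suc B} f D≤t df e = λ { zero → f₀≋0 ; (suc b) → horner-Z-zero D (f ∘ suc) D≤t (df ∘ suc) h≋0 b }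
      where
      h = horner Z (f ∘ suc)
      e′ : ∀ i → coef (f zero) i ⊞ coef (Z ⊠ h) i ≡ 0F
      e′ i = ≡.trans (≡.sym (coef-⊹ (f zero) (Z ⊠ h) i)) (coef≈ (R.trans (R.sym (horner-suc Z f)) e) i)
      f₀≋0 : f zero ≋ []
      f₀≋0 = mk≋ go
        where
        go : ∀ i → coef (f zero) i ≡ 0F
        go i with i ℕ.<? t
        ... | yes i<t = ≡.trans (≡.sym (F.+-identityʳ _)) (≡.trans (≡.cong (coef (f zero) i ⊞_) (≡.sym (coef-X^⊠-low t h i i<t))) (e′ i))
        ... | no i≮t  = df zero i (ℕ.≤-trans D≤t (ℕ.≮⇒≥ i≮t))
      h≋0 : h ≋ []
      h≋0 = mk≋ λ i → ≡.trans (≡.sym (coef-X^⊠-high t h i)) (≡.trans (≡.sym (F.+-identityˡ _))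
        (≡.trans (≡.cong (_⊞ coef (Z ⊠ h) (t ℕ.+ i)) (≡.sym (coef≈ f₀≋0 (t ℕ.+ i)))) (e′ (t ℕ.+ i))))

    -- If the sum vanishes, `g zero` is a multiple of (X - 1)^t, hence of order at least |S| at 1,
    -- while it has at most |S| monomials; so it is 0. Cancelling (X - 1)^t leaves the same
    -- situation with one term fewer.
    horner-Y-zero : ∀ S {C} (g : Fin C → Poly) → length S ℕ.≤ t → All (ℕ._< q) S →
                    (∀ c i → i ∉ˡ S → coef (g c) i ≡ 0F) → horner Y g ≋ [] → ∀ c → g c ≋ []
    horner-Y-zero S {suc C} g S≤t S<q off e = λ { zero → g₀≋0 ; (suc c) → horner-Y-zero S (g ∘ suc) S≤t S<q (off ∘ suc) h≋0 c }
      where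
      h = horner Y (g ∘ suc)
      L = lin 1F
      e′ : g zero ⊹ Y ⊠ h ≋ []
      e′ = R.trans (R.sym (horner-suc Y g)) e
      g₀≋ : g zero ≋ L ^ length S ⊠ (L ^ (t ℕ.∸ length S) ⊠ neg h)
      g₀≋ = begin
        g zero ≈⟨ RP.+-inverseˡ-unique (g zero) (Y ⊠ h) e′ ⟩
        neg (Y ⊠ h) ≈⟨ RP.-‿distribʳ-* Y h ⟩
        Y ⊠ neg h ≈⟨ R.*-congʳ (R.trans (R.reflexive (≡.cong (L ^_) (≡.sym (ℕ.m+[n∸m]≡n S≤t)))) (^-homo-* L (length S) (t ℕ.∸ length S))) ⟩
        L ^ length S ⊠ L ^ (t ℕ.∸ length S) ⊠ neg h ≈⟨ R.*-assoc _ _ _ ⟩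
        L ^ length S ⊠ (L ^ (t ℕ.∸ length S) ⊠ neg h) ∎
      g₀≋0 : g zero ≋ []
      g₀≋0 = sparse⇒zero 1F≢0F S (g zero) S<q (off zero) (_ , g₀≋)
      h≋0 : h ≋ []
      h≋0 = lin^-cancel-0 1F t h (R.trans (R.sym (R.+-identityˡ _)) (R.trans (R.+-congʳ (R.sym g₀≋0)) e′))

    Family : ℕ → Set
    Family B = Fin B → Fin B → Poly

    -- The auxiliary polynomial Σ φ_{c,b} X^{tb} (X − 1)^{tc}.
    Ψ : ∀ {B} → Family B → Poly
    Ψ φ = horner Y (λ c → horner Z (φ c))

    -- B D ≤ t compares the number of monomials of each inner sum with the order of (X - 1)^t at 1;
    -- B t ≤ q keeps their exponents below the characteristic.
    Ψ-zero : ∀ D {B} (φ : Family B) → D ℕ.≤ t → B ℕ.* D ℕ.≤ t → B ℕ.* t ℕ.≤ q → (∀ c b → Deg< D (φ c b)) →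
             Ψ φ ≋ [] → ∀ c b → φ c b ≋ []
    Ψ-zero D {B} φ D≤t BD≤t Bt≤q dφ e c = horner-Z-zero D (φ c) D≤t (dφ c)
      (horner-Y-zero (support D B) (λ c → horner Z (φ c)) (≡.subst (ℕ._≤ t) (≡.sym (length-support D B)) BD≤t)
        (All.map (λ lt → ℕ.<-≤-trans lt Bt≤q) (support-< D B D≤t)) (λ c → horner-support D (φ c) (dφ c)) e c)

    -- X (X - 1) d/dX sends X^t and (X - 1)^t to polynomial multiples of themselves. Its iterates
    -- therefore keep the shape of Ψ and change only the coefficients φ, whereas d/dX would lower
    -- the exponents.
    W : Poly
    W = X ⊠ lin 1F

    D[_] : Poly → Poly
    D[_] = θ W

    D-⊹ : ∀ P Q → D[ P ⊹ Q ] ≋ D[ P ] ⊹ D[ Q ]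
    D-⊹ P Q = R.trans (R.*-congˡ (∂-⊹ P Q)) (R.distribˡ W _ _)

    D-⊠ : ∀ P Q → D[ P ⊠ Q ] ≋ D[ P ] ⊠ Q ⊹ P ⊠ D[ Q ]
    D-⊠ P Q = begin
      W ⊠ ∂ (P ⊠ Q) ≈⟨ R.*-congˡ (∂-⊠ P Q) ⟩
      W ⊠ (∂ P ⊠ Q ⊹ P ⊠ ∂ Q) ≈⟨ R.distribˡ W _ _ ⟩
      W ⊠ (∂ P ⊠ Q) ⊹ W ⊠ (P ⊠ ∂ Q) ≈⟨ R.+-cong (R.sym (R.*-assoc W (∂ P) Q)) (RC.x∙yz≈y∙xz W P (∂ Q)) ⟩
      W ⊠ ∂ P ⊠ Q ⊹ P ⊠ (W ⊠ ∂ Q) ∎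

    D-^ : ∀ {P ζ} → D[ P ] ≋ ζ ⊠ P → ∀ n → D[ P ^ n ] ≋ (n • ζ) ⊠ P ^ n
    D-^ {P} {ζ} e zero = R.trans (R.*-congˡ ∂-1) (R.trans (R.zeroʳ W) (R.sym (R.zeroˡ R.1#)))
    D-^ {P} {ζ} e (suc n) = begin
      D[ P ⊠ P ^ n ] ≈⟨ D-⊠ P (P ^ n) ⟩
      D[ P ] ⊠ P ^ n ⊹ P ⊠ D[ P ^ n ] ≈⟨ R.+-cong (R.trans (R.*-congʳ e) (R.*-assoc ζ P (P ^ n)))
              (R.trans (R.*-congˡ (D-^ e n)) (RC.x∙yz≈y∙xz P (n • ζ) (P ^ n))) ⟩
      ζ ⊠ (P ⊠ P ^ n) ⊹ n • ζ ⊠ (P ⊠ P ^ n) ≈⟨ R.distribʳ (P ⊠ P ^ n) ζ (n • ζ) ⟨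
      (suc n • ζ) ⊠ (P ⊠ P ^ n) ∎

    ζ η : Poly
    ζ = t • lin 1F
    η = t • X

    D-Z : D[ Z ] ≋ ζ ⊠ Z
    D-Z = begin
      X ⊠ lin 1F ⊠ ∂ Z ≈⟨ R.trans (R.*-congʳ (R.*-comm X (lin 1F))) (R.*-assoc _ _ _) ⟩
      lin 1F ⊠ (X ⊠ ∂ Z) ≈⟨ R.*-congˡ (euler X ∂-X t) ⟩
      lin 1F ⊠ (t • Z) ≈⟨ R.trans (•-comm-* t (lin 1F) Z) (R.sym (•-assoc-* t (lin 1F) Z)) ⟩
      ζ ⊠ Z ∎

    D-Y : D[ Y ] ≋ η ⊠ Y
    D-Y = begin
      X ⊠ lin 1F ⊠ ∂ Y ≈⟨ R.*-assoc _ _ _ ⟩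
      X ⊠ (lin 1F ⊠ ∂ Y) ≈⟨ R.*-congˡ (euler (lin 1F) (∂-lin 1F) t) ⟩
      X ⊠ (t • Y) ≈⟨ R.trans (•-comm-* t X Y) (R.sym (•-assoc-* t X Y)) ⟩
      η ⊠ Y ∎

    D-∑ : ∀ {n} (f : Fin n → Poly) → D[ ∑ᴾ f ] ≋ ∑ᴾ (λ i → D[ f i ])
    D-∑ {zero}  f = R.trans (R.*-congˡ ∂-[]) (R.zeroʳ W)
    D-∑ {suc n} f = R.trans (D-⊹ (f zero) (∑ᴾ (f ∘ suc))) (R.+-congˡ (D-∑ (f ∘ suc)))

    D-horner : ∀ {n P ξ} → D[ P ] ≋ ξ ⊠ P → (f : Fin n → Poly) →
               D[ horner P f ] ≋ horner P (λ b → D[ f b ] ⊹ (toℕ b • ξ) ⊠ f b)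
    D-horner {n} {P} {ξ} e f = R.trans (D-∑ (λ b → f b ⊠ P ^ toℕ b)) (∑ᴾ-cong (λ b → begin
      D[ f b ⊠ P ^ toℕ b ] ≈⟨ D-⊠ (f b) (P ^ toℕ b) ⟩
      D[ f b ] ⊠ P ^ toℕ b ⊹ f b ⊠ D[ P ^ toℕ b ] ≈⟨ R.+-congˡ (R.trans (R.*-congˡ (D-^ e (toℕ b))) (RC.x∙yz≈yx∙z (f b) (toℕ b • ξ) (P ^ toℕ b))) ⟩
      D[ f b ] ⊠ P ^ toℕ b ⊹ (toℕ b • ξ) ⊠ f b ⊠ P ^ toℕ b ≈⟨ R.distribʳ (P ^ toℕ b) _ _ ⟨
      (D[ f b ] ⊹ (toℕ b • ξ) ⊠ f b) ⊠ P ^ toℕ b ∎))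

    -- The action of X (X − 1) d/dX on the coefficients of Ψ.
    Λ : ∀ {B} → Family B → Family B
    Λ φ c b = D[ φ c b ] ⊹ (toℕ b • ζ) ⊠ φ c b ⊹ (toℕ c • η) ⊠ φ c b

    D-Ψ : ∀ {B} (φ : Family B) → D[ Ψ φ ] ≋ Ψ (Λ φ)
    D-Ψ φ = R.trans (D-horner D-Y (λ c → horner Z (φ c))) (horner-cong Y (λ c → begin
      D[ horner Z (φ c) ] ⊹ (toℕ c • η) ⊠ horner Z (φ c)
        ≈⟨ R.+-cong (D-horner D-Z (φ c)) (horner-⊠ Z (toℕ c • η) (φ c)) ⟩
      horner Z (λ b → D[ φ c b ] ⊹ (toℕ b • ζ) ⊠ φ c b) ⊹ horner Z (λ b → (toℕ c • η) ⊠ φ c b)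
        ≈⟨ horner-⊹ Z (λ b → D[ φ c b ] ⊹ (toℕ b • ζ) ⊠ φ c b) (λ b → (toℕ c • η) ⊠ φ c b) ⟩
      horner Z (Λ φ c) ∎))

    Λ^ : ∀ {B} → ℕ → Family B → Family B
    Λ^ zero    φ = φ
    Λ^ (suc k) φ = Λ^ k (Λ φ)

    iterate-D-Ψ : ∀ {B} k (φ : Family B) → iterate D[_] k (Ψ φ) ≋ Ψ (Λ^ k φ)
    iterate-D-Ψ zero    φ = R.refl
    iterate-D-Ψ (suc k) φ = R.trans (iterate-θ-cong W k (D-Ψ φ)) (iterate-D-Ψ k (Λ φ))

    -- W has degree 2 and the drop of degree under `∂` is not exploited, so each step costs 2. This
    -- is the origin of 3 D: fewer than D steps starting from degree below D.
    Deg<-Λ : ∀ {B n} (φ : Family B) → (∀ c b → Deg< n (φ c b)) → ∀ c b → Deg< (2 ℕ.+ n) (Λ φ c b)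
    Deg<-Λ {B} {n} φ dφ c b = Deg<-⊹ {2 ℕ.+ n} {D[ φ c b ] ⊹ (toℕ b • ζ) ⊠ φ c b}
      (Deg<-⊹ {2 ℕ.+ n} {D[ φ c b ]}
        (Deg<-⊠ {2} W (∂ (φ c b)) (Deg<-⊠ {1} X (lin 1F) Deg<-X (Deg<-lin 1F)) (Deg<-∂ (φ c b) (dφ c b)))
        (linear (toℕ b • ζ) (Deg<-• {2} (toℕ b) ζ (Deg<-• {2} t (lin 1F) (Deg<-lin 1F)))))
      (linear (toℕ c • η) (Deg<-• {2} (toℕ c) η (Deg<-• {2} t X Deg<-X)))
      where
      linear : ∀ P → Deg< 2 P → Deg< (2 ℕ.+ n) (P ⊠ φ c b)
      linear P dP = Deg<-mono {1 ℕ.+ n} {2 ℕ.+ n} {P ⊠ φ c b} (ℕ.n≤1+n (1 ℕ.+ n)) (Deg<-⊠ P (φ c b) dP (dφ c b))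

    Deg<-Λ^ : ∀ {B n} k (φ : Family B) → (∀ c b → Deg< n (φ c b)) → ∀ c b → Deg< (k ℕ.* 2 ℕ.+ n) (Λ^ k φ c b)
    Deg<-Λ^ zero    φ dφ = dφ
    Deg<-Λ^ {n = n} (suc k) φ dφ c b = ≡.subst (λ z → Deg< z (Λ^ k (Λ φ) c b)) eq (Deg<-Λ^ k (Λ φ) (Deg<-Λ φ dφ) c b)
      where
      eq : k ℕ.* 2 ℕ.+ (2 ℕ.+ n) ≡ 2 ℕ.+ k ℕ.* 2 ℕ.+ n
      eq = ≡.trans (≡.sym (ℕ.+-assoc (k ℕ.* 2) 2 n)) (≡.cong (ℕ._+ n) (ℕ.+-comm (k ℕ.* 2) 2))

    -- Ψ with both t-th powers replaced by the common value κ they take at the points of interest.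
    S : ∀ {B} → Fin q → Family B → Poly
    S κ φ = horner (con κ) (λ c → horner (con κ) (φ c))

    S-eval : ∀ {B} κ u (φ : Family B) → Z ⟨ u ⟩ ≡ κ → Y ⟨ u ⟩ ≡ κ → Ψ φ ⟨ u ⟩ ≡ S κ φ ⟨ u ⟩
    S-eval κ u φ eZ eY = horner-eval {Z = Y} {con κ} u {λ c → horner Z (φ c)} {λ c → horner (con κ) (φ c)} (≡.trans eY (≡.sym (eval-con κ u)))
      (λ c → horner-eval {Z = Z} {con κ} u {φ c} {φ c} (≡.trans eZ (≡.sym (eval-con κ u))) (λ b → ≡.refl))

    Deg<-S : ∀ {B n} κ (φ : Family B) → (∀ c b → Deg< n (φ c b)) → Deg< n (S κ φ)
    Deg<-S {B} {n} κ φ dφ = const (λ c → horner (con κ) (φ c)) (λ c → const (φ c) (dφ c))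
      where
      const : (f : Fin B → Poly) → (∀ b → Deg< n (f b)) → Deg< n (horner (con κ) f)
      const f df = ≡.subst (λ z → Deg< z (horner (con κ) f)) (≡.cong (ℕ._+ n) (ℕ.*-zeroʳ B))
        (Deg<-horner B (con κ) 0 (Deg<-con κ) f ℕ.≤-refl df)

    _≋ᶠ_⊹_ : ∀ {B} → Family B → Family B → Family B → Set
    φ ≋ᶠ ψ ⊹ χ = ∀ c b → φ c b ≋ ψ c b ⊹ χ c b

    Λ-additive : ∀ {B} {φ ψ χ : Family B} → φ ≋ᶠ ψ ⊹ χ → Λ φ ≋ᶠ Λ ψ ⊹ Λ χ
    Λ-additive {φ = φ} {ψ} {χ} e c b = begin
      D[ φ c b ] ⊹ B′ ⊠ φ c b ⊹ C′ ⊠ φ c b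
        ≈⟨ R.+-cong (R.+-cong (R.trans (θ-cong W (e c b)) (D-⊹ _ _)) (R.trans (R.*-congˡ (e c b)) (R.distribˡ B′ _ _)))
             (R.trans (R.*-congˡ (e c b)) (R.distribˡ C′ _ _)) ⟩
      (D[ ψ c b ] ⊹ D[ χ c b ]) ⊹ (B′ ⊠ ψ c b ⊹ B′ ⊠ χ c b) ⊹ (C′ ⊠ ψ c b ⊹ C′ ⊠ χ c b)
        ≈⟨ R.+-congʳ (RA.interchange _ _ _ _) ⟩
      (D[ ψ c b ] ⊹ B′ ⊠ ψ c b) ⊹ (D[ χ c b ] ⊹ B′ ⊠ χ c b) ⊹ (C′ ⊠ ψ c b ⊹ C′ ⊠ χ c b)
        ≈⟨ RA.interchange _ _ _ _ ⟩
      Λ ψ c b ⊹ Λ χ c b ∎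
      where
      B′ = toℕ b • ζ
      C′ = toℕ c • η

    Λ^-additive : ∀ {B} k {φ ψ χ : Family B} → φ ≋ᶠ ψ ⊹ χ → Λ^ k φ ≋ᶠ Λ^ k ψ ⊹ Λ^ k χ
    Λ^-additive zero    e = e
    Λ^-additive (suc k) e = Λ^-additive k (Λ-additive e)

    S-additive : ∀ {B} κ {φ ψ χ : Family B} → φ ≋ᶠ ψ ⊹ χ → S κ φ ≋ S κ ψ ⊹ S κ χ
    S-additive κ {φ} {ψ} {χ} e = R.trans
      (horner-cong (con κ) (λ c → R.trans (horner-cong (con κ) (e c)) (R.sym (horner-⊹ (con κ) (ψ c) (χ c)))))
      (R.sym (horner-⊹ (con κ) (λ c → horner (con κ) (ψ c)) (λ c → horner (con κ) (χ c))))

    -- The linear system and the count of zeros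

    module _ (D B : ℕ) (κs : List (Fin q)) where

      n : ℕ
      n = length κs

      family : (Fin (B ℕ.* (B ℕ.* D)) → Fin q) → Family B
      family x c b = tabulate (λ i → x (combine c (combine b i)))

      -- At every u over κ the k-th derivative of Ψ takes the value of one polynomial `S` of degree
      -- below 3 D. Making `S` vanish identically costs 3 D equations for each κ and k, however many
      -- points u lie over κ: this is where the method gains.
      condition : (Fin (B ℕ.* (B ℕ.* D)) → Fin q) → Fin n → Fin D → Fin (3 ℕ.* D) → Fin q
      condition x j k i = coef (S (List.lookup κs j) (Λ^ (toℕ k) (family x))) (toℕ i)

      conditions : (Fin (B ℕ.* (B ℕ.* D)) → Fin q) → Fin (n ℕ.* (D ℕ.* (3 ℕ.* D))) → Fin q
      conditions x = uncurry₃ {n} {D} (condition x)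

      stepanov-solution : 1 ℕ.< q → n ℕ.* (D ℕ.* (3 ℕ.* D)) ℕ.< B ℕ.* (B ℕ.* D) →
        ∃[ φ ] ((∀ c b → Deg< D (φ c b)) × (¬ (∀ c b → φ c b ≋ [])) ×
                (∀ κ → κ ∈ˡ κs → ∀ k → k ℕ.< D → S κ (Λ^ {B} k φ) ≋ []))
      stepanov-solution 1<q M<N with underdetermined 1<q M<N conditions
      ... | x , y , (e , xₑ≢yₑ) , same = family z , (λ c b → Deg<-tabulate (λ i → z (combine c (combine b i)))) , nonzero , solves
        where
        z : Fin (B ℕ.* (B ℕ.* D)) → Fin q
        z e = x e ⊞ ⊟ y e
        y+z : ∀ e → x e ≡ y e ⊞ z e
        y+z e = ≡.sym (≡.trans (F.+-comm (y e) (z e)) (≡.trans (F.+-assoc (x e) _ _)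
          (≡.trans (≡.cong (x e ⊞_) (F.-‿inverseˡ (y e))) (F.+-identityʳ (x e)))))
        nonzero : ¬ (∀ c b → family z c b ≋ [])
        nonzero all-zero with Fin.combine-surjective {B} {B ℕ.* D} e
        ... | c , e′ , ≡.refl with Fin.combine-surjective {B} {D} e′
        ...   | b , i , ≡.refl = xₑ≢yₑ (≡.trans (y+z e) (≡.trans (≡.cong (y e ⊞_)
                (≡.trans (≡.sym (coef-tabulate (λ i → z (combine c (combine b i))) i)) (coef≈ (all-zero c b) (toℕ i)))) (F.+-identityʳ (y e))))
        split : family x ≋ᶠ family y ⊹ family z
        split c b = R.trans (mk≋ λ i → ≡.cong (λ l → coef l i) (tabulate-cong (λ i → y+z (combine c (combine b i)))))
          (tabulate-⊹ (λ i → y (combine c (combine b i))) (λ i → z (combine c (combine b i))))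
        solves : ∀ κ → κ ∈ˡ κs → ∀ k → k ℕ.< D → S κ (Λ^ k (family z)) ≋ []
        solves κ κ∈κs k k<D = mk≋ go
          where
          Sx = S κ (Λ^ k (family x))
          Sy = S κ (Λ^ k (family y))
          Sz = S κ (Λ^ k (family z))
          x≡y : ∀ i → i ℕ.< 3 ℕ.* D → coef Sx i ≡ coef Sy i
          x≡y i i<3D = ≡.trans (≡.sym (at x)) (≡.trans (≡.sym (uncurry₃-combine (condition x) j k′ i′))
            (≡.trans (same (combine j (combine k′ i′))) (≡.trans (uncurry₃-combine (condition y) j k′ i′) (at y))))
            where
            j = Any.index κ∈κs
            k′ = fromℕ< k<D
            i′ = fromℕ< i<3D
            at : ∀ x → condition x j k′ i′ ≡ coef (S κ (Λ^ k (family x))) i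
            at x rewrite ≡.sym (lookup-index κ∈κs) | toℕ-fromℕ< k<D | toℕ-fromℕ< i<3D = ≡.refl
          go : ∀ i → coef Sz i ≡ 0F
          -- Below 3 D the coefficient vanishes because x and y satisfy the same conditions and `S`
          -- is additive; from 3 D on it vanishes by degree.
          go i with i ℕ.<? 3 ℕ.* D
          ... | yes i<3D = FP.+-identityʳ-unique (coef Sy i) (coef Sz i) (≡.trans (≡.sym (≡.trans
                  (coef≈ (S-additive κ (Λ^-additive k split)) i) (coef-⊹ Sy Sz i))) (x≡y i i<3D))
            where import Algebra.Properties.Ring F.ring as FP
          ... | no i≮3D = Deg<-S κ (Λ^ k (family z)) (Deg<-Λ^ k (family z) (λ c b → Deg<-tabulate (λ i → z (combine c (combine b i))))) i
                  (ℕ.≤-trans bound (ℕ.≮⇒≥ i≮3D))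
            where
            bound : k ℕ.* 2 ℕ.+ D ℕ.≤ 3 ℕ.* D
            bound = ℕ.≤-trans (ℕ.+-monoˡ-≤ D (ℕ.≤-trans (ℕ.*-monoˡ-≤ 2 (ℕ.<⇒≤ k<D)) (ℕ.≤-reflexive (ℕ.*-comm D 2)))) (ℕ.≤-reflexive (ℕ.+-comm (2 ℕ.* D) D))

      stepanov : 1 ℕ.< q → 0 ℕ.< t → n ℕ.* (D ℕ.* (3 ℕ.* D)) ℕ.< B ℕ.* (B ℕ.* D) → D ℕ.≤ t → B ℕ.* D ℕ.≤ t → B ℕ.* t ℕ.≤ q → D ℕ.≤ q →
        All (_≢ 0F) κs → ∀ us → AllPairs _≢_ us →
        All (λ u → u ^ᶠ t ∈ˡ κs × (u ⊞ ⊟ 1F) ^ᶠ t ≡ u ^ᶠ t) us →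
        length us ℕ.* D ℕ.≤ B ℕ.* t ℕ.+ (B ℕ.* t ℕ.+ D)
      stepanov 1<q 0<t M<N D≤t BD≤t Bt≤q D≤q κs≢0 us uniq on-κs = ℕ.≮⇒≥ λ lt → contradict (ℕ.<⇒≤ lt)
        where
        solution = stepanov-solution 1<q M<N
        φ = proj₁ solution
        dφ = proj₁ (proj₂ solution)
        power-root : ∀ {v} → v ^ᶠ t ≢ 0F → v ≢ 0F
        power-root {v} ne ≡.refl = ne (zero^ t 0<t)
          where
          zero^ : ∀ t → 0 ℕ.< t → 0F ^ᶠ t ≡ 0F
          zero^ (suc t) _ = F.zeroˡ _
        Deg<-Ψ : Deg< (B ℕ.* t ℕ.+ (B ℕ.* t ℕ.+ D)) (Ψ φ)
        Deg<-Ψ = Deg<-horner B Y t (Deg<-linear^ (lin 1F) (Deg<-lin 1F) t) _ ℕ.≤-refl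
          (λ c → Deg<-horner B Z t (Deg<-linear^ X Deg<-X t) (φ c) ℕ.≤-refl (dφ c))
        high-order : ∀ {u} → u ^ᶠ t ∈ˡ κs × (u ⊞ ⊟ 1F) ^ᶠ t ≡ u ^ᶠ t → lin u ^ D ∣ᴾ Ψ φ
        high-order {u} (∈κs , eq) = vanishing-order W u W⟨u⟩≢0 D D≤q (Ψ φ) (λ k k<D →
          ≡.trans (eval-cong u (iterate-D-Ψ k φ)) (≡.trans (S-eval (u ^ᶠ t) u (Λ^ k φ) Z⟨u⟩ Y⟨u⟩)
            (eval-zero _ u (proj₂ (proj₂ (proj₂ solution)) (u ^ᶠ t) ∈κs k k<D))))
          where
          Z⟨u⟩ : Z ⟨ u ⟩ ≡ u ^ᶠ t
          Z⟨u⟩ = ≡.trans (eval-^ X t u) (≡.cong (_^ᶠ t) (eval-X u))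
          Y⟨u⟩ : Y ⟨ u ⟩ ≡ u ^ᶠ t
          Y⟨u⟩ = ≡.trans (eval-^ (lin 1F) t u) (≡.trans (≡.cong (_^ᶠ t) (eval-lin 1F u)) eq)
          κ≢0 : u ^ᶠ t ≢ 0F
          κ≢0 = All.lookup κs≢0 ∈κs
          -- Both u and u - 1 are nonzero since their t-th powers equal κ ≠ 0.
          W⟨u⟩≢0 : W ⟨ u ⟩ ≢ 0F
          W⟨u⟩≢0 e = nonzero-* (power-root κ≢0) (power-root (λ e′ → κ≢0 (≡.trans (≡.sym eq) e′)))
            (≡.trans (≡.sym (≡.trans (eval-⊠ X (lin 1F) u) (≡.cong₂ _⊡_ (eval-X u) (eval-lin 1F u)))) e)
        contradict : ¬ (B ℕ.* t ℕ.+ (B ℕ.* t ℕ.+ D) ℕ.≤ length us ℕ.* D)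
        contradict le = proj₁ (proj₂ (proj₂ solution)) (Ψ-zero D φ D≤t BD≤t Bt≤q dφ
          (too-many-zeros D us uniq (All.map high-order on-κs) (Deg<-mono {P = Ψ φ} le Deg<-Ψ)))

-- Arithmetic of the parameters and exponents

module Arithmetic where

  open import Data.Nat
  open import Data.Nat.Properties
  open import Data.Nat.DivMod using (_/_; _%_; m/n*n≤m; m≡m%n+[m/n]*n; m%n<n; m≥n⇒m/n>0)
  open import Data.Nat.Tactic.RingSolver using (solve-∀)
  open ≤-Reasoning

  square-mono : ∀ {a b} → a ≤ b → a * a ≤ b * b
  square-mono le = *-mono-≤ le le

  cube-mono : ∀ {a b} → a ≤ b → a * a * a ≤ b * b * b
  cube-mono le = *-mono-≤ (square-mono le) le

  square-cancel : ∀ {a b} → a * a ≤ b * b → a ≤ b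
  square-cancel {a} {b} le = ≮⇒≥ λ b<a → <⇒≱ (*-mono-< b<a b<a) le

  cube-cancel : ∀ {a b} → a * a * a ≤ b * b * b → a ≤ b
  cube-cancel {a} {b} le = ≮⇒≥ λ b<a → <⇒≱ (*-mono-< (*-mono-< b<a b<a) b<a) le

  largest : ∀ {P : ℕ → Set} → (∀ d → Dec (P d)) → ∀ k d → P d → ¬ P (k + d) → ∃[ e ] (d ≤ e × P e × ¬ P (suc e))
  largest P? zero    d Pd ¬Pd = contradiction Pd ¬Pd
  largest {P} P? (suc k) d Pd ¬P with P? (suc d)
  ... | no ¬Ps = d , ≤-refl , Pd , ¬Ps
  ... | yes Ps with largest P? k (suc d) Ps (subst (λ z → ¬ P z) (sym (+-suc k d)) ¬P)
  ...   | e , le , Pe , ¬Pse = e , ≤-trans (n≤1+n d) le , Pe , ¬Pse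

  -- For the largest D with a D³ ≤ m one has m < a (D + 1)³, and D + 1 ≤ 2 D accounts for the 8.
  cubeRoot : ∀ a m → .{{NonZero a}} → a ≤ m → ∃[ D ] (1 ≤ D × a * (D * D * D) ≤ m × m ≤ 8 * a * (D * D * D))
  cubeRoot a m a≤m with largest (λ d → a * (d * d * d) ≤? m) m 1 (subst (_≤ m) (sym (*-identityʳ a)) a≤m) too-big
    where
    too-big : ¬ (a * ((m + 1) * (m + 1) * (m + 1)) ≤ m)
    too-big le = <-irrefl refl (begin-strict
      m <⟨ ≤-reflexive (+-comm 1 m) ⟩
      m + 1 ≤⟨ m≤m*n (m + 1) (m + 1) {{>-nonZero (≤-trans (s≤s z≤n) (m≤n+m 1 m))}} ⟩
      (m + 1) * (m + 1) ≤⟨ m≤m*n ((m + 1) * (m + 1)) (m + 1) {{>-nonZero (≤-trans (s≤s z≤n) (m≤n+m 1 m))}} ⟩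
      (m + 1) * (m + 1) * (m + 1) ≤⟨ m≤n*m _ a ⟩
      a * ((m + 1) * (m + 1) * (m + 1)) ≤⟨ le ⟩
      m ∎)
  ... | D , 1≤D , le , ¬le = D , 1≤D , le , (begin
    m ≤⟨ <⇒≤ (≰⇒> ¬le) ⟩
    a * (suc D * suc D * suc D) ≤⟨ *-monoʳ-≤ a (cube-mono {suc D} {2 * D} (+-mono-≤ 1≤D (≤-reflexive (sym (+-identityʳ D))))) ⟩
    a * ((2 * D) * (2 * D) * (2 * D)) ≡⟨ expand a D ⟩
    8 * a * (D * D * D) ∎)
    where
    expand : ∀ a D → a * ((2 * D) * (2 * D) * (2 * D)) ≡ 8 * a * (D * D * D)
    expand = solve-∀

  squareRoot : ∀ t → 1 ≤ t → ∃[ σ ] (1 ≤ σ × t ≤ σ * σ × σ * σ ≤ 4 * t)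
  squareRoot (suc zero)    _ = 1 , s≤s z≤n , s≤s z≤n , s≤s z≤n
  squareRoot (suc (suc t)) _ with squareRoot (suc t) (s≤s z≤n)
  ... | σ , 1≤σ , lo , hi with suc (suc t) ≤? σ * σ
  ...   | yes le = σ , 1≤σ , le , ≤-trans hi (*-monoʳ-≤ 4 (n≤1+n (suc t)))
  ...   | no ¬le = suc σ , s≤s z≤n , ≤-trans (s≤s lo) (*-mono-< (n<1+n σ) (n<1+n σ)) , (begin
    suc σ * suc σ ≤⟨ square-mono {suc σ} {2 * σ} (+-mono-≤ 1≤σ (≤-reflexive (sym (+-identityʳ σ)))) ⟩
    (2 * σ) * (2 * σ) ≡⟨ expand σ ⟩
    4 * (σ * σ) ≤⟨ *-monoʳ-≤ 4 (<⇒≤ (≰⇒> ¬le)) ⟩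
    4 * suc (suc t) ∎)
    where
    expand : ∀ σ → (2 * σ) * (2 * σ) ≡ 4 * (σ * σ)
    expand = solve-∀

  -- D is the order of vanishing and B the number of powers of X^t and of (X - 1)^t. `room` says
  -- that unknowns outnumber equations; the last field bounds D from below, which makes the count of
  -- zeros effective.
  record Parameters (n t q : ℕ) : Set where
    field
      D B     : ℕ
      1≤D     : 1 ≤ D
      1≤B     : 1 ≤ B
      D≤t     : D ≤ t
      BD≤t    : B * D ≤ t
      Bt≤q    : B * t ≤ q
      room    : n * (D * (3 * D)) < B * (B * D)
      t²≤96nD³ : t * t ≤ 96 * n * (D * D * D)

  parameters : ∀ n τ t q → 1 ≤ n → 12 * n ≤ t * t → n * τ ≤ t → t ≤ τ * τ → 21 * (t * t * t) ≤ q * q → Parameters n t q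
  parameters n τ t q 1≤n 12n≤t² nτ≤t t≤τ² 21t³≤q² = record
    { D = D ; B = B ; 1≤D = 1≤D ; 1≤B = 1≤B ; D≤t = D≤t ; BD≤t = m/n*n≤m t D ; Bt≤q = Bt≤q ; room = room
    ; t²≤96nD³ = t²≤ }
    where
    instance
      n≢0 : NonZero n
      n≢0 = >-nonZero 1≤n
      12n≢0 : NonZero (12 * n)
      12n≢0 = m*n≢0 12 n
    -- 12 is 3 · 4: the 3 comes from the 3 D equations per κ and derivative, the 4 from squaring t <
    -- 2 B D.
    root = cubeRoot (12 * n) (t * t) 12n≤t²
    D = proj₁ root
    1≤D = proj₁ (proj₂ root)
    12nD³≤t² = proj₁ (proj₂ (proj₂ root))
    instance
      D≢0 : NonZero D
      D≢0 = >-nonZero 1≤D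
    B = t / D
    t²≤ : t * t ≤ 96 * n * (D * D * D)
    t²≤ = ≤-trans (proj₂ (proj₂ (proj₂ root))) (≤-reflexive (eq n D))
      where
      eq : ∀ n D → 8 * (12 * n) * (D * D * D) ≡ 96 * n * (D * D * D)
      eq = solve-∀
    D≤t : D ≤ t
    D≤t = square-cancel (begin
      D * D ≤⟨ m≤m*n (D * D) D ⟩
      D * D * D ≤⟨ m≤n*m (D * D * D) (12 * n) ⟩
      12 * n * (D * D * D) ≤⟨ 12nD³≤t² ⟩
      t * t ∎)
    1≤B : 1 ≤ B
    1≤B = m≥n⇒m/n>0 D≤t
    t<2BD : t < 2 * (B * D)
    t<2BD = begin-strict
      t ≡⟨ m≡m%n+[m/n]*n t D ⟩
      t % D + B * D <⟨ +-monoˡ-< (B * D) (m%n<n t D) ⟩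
      D + B * D ≤⟨ +-monoˡ-≤ (B * D) (m≤n*m D B {{>-nonZero 1≤B}}) ⟩
      B * D + B * D ≡⟨ cong (_+_ (B * D)) (+-identityʳ (B * D)) ⟨
      2 * (B * D) ∎
    room : n * (D * (3 * D)) < B * (B * D)
    room = *-cancelˡ-< (4 * D) _ _ (begin-strict
      4 * D * (n * (D * (3 * D))) ≡⟨ eq₁ D n ⟩
      12 * n * (D * D * D) ≤⟨ 12nD³≤t² ⟩
      t * t <⟨ *-mono-< t<2BD t<2BD ⟩
      2 * (B * D) * (2 * (B * D)) ≡⟨ eq₂ B D ⟩
      4 * D * (B * (B * D)) ∎)
      where
      eq₁ : ∀ D n → 4 * D * (n * (D * (3 * D))) ≡ 12 * n * (D * D * D)
      eq₁ = solve-∀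
      eq₂ : ∀ B D → 2 * (B * D) * (2 * (B * D)) ≡ 4 * D * (B * (B * D))
      eq₂ = solve-∀
    instance
      t≢0 : NonZero t
      t≢0 = >-nonZero (≤-trans 1≤D D≤t)
      t²≢0 : NonZero (t * t)
      t²≢0 = m*n≢0 t t
    P = B * t
    PD≤t² : P * D ≤ t * t
    PD≤t² = begin
      B * t * D ≡⟨ eq B t D ⟩
      B * D * t ≤⟨ *-monoˡ-≤ t (m/n*n≤m t D) ⟩
      t * t ∎
      where
      eq : ∀ B t D → B * t * D ≡ B * D * t
      eq = solve-∀
    -- B t ≤ t² / D combined with D³ ≥ t² / (96 n).
    P³≤ : P * P * P ≤ 96 * n * (t * t * (t * t))
    P³≤ = *-cancelˡ-≤ (t * t) (begin
      t * t * (P * P * P) ≤⟨ *-monoˡ-≤ (P * P * P) t²≤ ⟩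
      96 * n * (D * D * D) * (P * P * P) ≡⟨ eq₁ n D P ⟩
      96 * n * (P * D * (P * D) * (P * D)) ≤⟨ *-monoʳ-≤ (96 * n) (cube-mono PD≤t²) ⟩
      96 * n * (t * t * (t * t) * (t * t)) ≡⟨ eq₂ n (t * t) ⟩
      t * t * (96 * n * (t * t * (t * t))) ∎)
      where
      eq₁ : ∀ n D P → 96 * n * (D * D * D) * (P * P * P) ≡ 96 * n * (P * D * (P * D) * (P * D))
      eq₁ = solve-∀
      eq₂ : ∀ n s → 96 * n * (s * s * s) ≡ s * (96 * n * (s * s))
      eq₂ = solve-∀
    n²≤t : n * n ≤ t
    n²≤t = *-cancelʳ-≤ (n * n) t t (begin
      n * n * t ≤⟨ *-monoʳ-≤ (n * n) t≤τ² ⟩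
      n * n * (τ * τ) ≡⟨ eq n τ ⟩
      n * τ * (n * τ) ≤⟨ square-mono nτ≤t ⟩
      t * t ∎)
      where
      eq : ∀ n τ → n * n * (τ * τ) ≡ n * τ * (n * τ)
      eq = solve-∀
    -- Squaring the bound for (B t)³ brings in n² ≤ t, so (B t)⁶ ≤ 96² t⁹. The constant 21 is chosen
    -- because 21³ = 9261 exceeds 96² = 9216.
    Bt≤q : B * t ≤ q
    Bt≤q = cube-cancel (square-cancel (begin
      P * P * P * (P * P * P) ≤⟨ square-mono P³≤ ⟩
      96 * n * (t * t * (t * t)) * (96 * n * (t * t * (t * t))) ≡⟨ eq₁ n t ⟩
      9216 * (n * n) * (t * t * (t * t) * (t * t * (t * t))) ≤⟨ *-monoˡ-≤ _ (*-mono-≤ {9216} {9261} (m≤m+n 9216 45) n²≤t) ⟩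
      9261 * t * (t * t * (t * t) * (t * t * (t * t))) ≡⟨ eq₂ t ⟩
      21 * (t * t * t) * (21 * (t * t * t)) * (21 * (t * t * t)) ≤⟨ cube-mono 21t³≤q² ⟩
      q * q * (q * q) * (q * q) ≡⟨ eq₃ q ⟩
      q * q * q * (q * q * q) ∎))
      where
      eq₁ : ∀ n t → 96 * n * (t * t * (t * t)) * (96 * n * (t * t * (t * t))) ≡ 9216 * (n * n) * (t * t * (t * t) * (t * t * (t * t)))
      eq₁ = solve-∀
      eq₂ : ∀ t → 9261 * t * (t * t * (t * t) * (t * t * (t * t))) ≡ 21 * (t * t * t) * (21 * (t * t * t)) * (21 * (t * t * t))
      eq₂ = solve-∀
      eq₃ : ∀ q → q * q * (q * q) * (q * q) ≡ q * q * q * (q * q * q)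
      eq₃ = solve-∀

  -- 248832 = 96² · 3³, from t² ≤ 96 n D³ and n τ D² ≤ 3 t²; opaque so that multiples of it do not unfold.
  opaque
    K : ℕ
    K = 248832

    K≡ : 248832 ≡ K
    K≡ = refl

  12≤K : 12 ≤ K
  12≤K = subst (12 ≤_) K≡ (m≤m+n 12 248820)

  -- L D ≤ 3 B t and B D ≤ t give n τ D² ≤ 3 t². Cubing this and eliminating D⁶ by the square of t²
  -- ≤ 96 n D³ leaves the bound.
  parameters-bound : ∀ {n t q} (par : Parameters n t q) → let open Parameters par in
                     ∀ τ L → n * τ ≤ L → L * D ≤ B * t + (B * t + D) → n * (τ * τ * τ) ≤ K * (t * t)
  parameters-bound {n} {t} par τ L nτ≤L LD≤ = *-cancelˡ-≤ (t * t * (t * t)) (begin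
      t * t * (t * t) * (n * (τ * τ * τ))
        ≤⟨ *-monoˡ-≤ (n * (τ * τ * τ)) (square-mono t²≤96nD³) ⟩
      96 * n * (D * D * D) * (96 * n * (D * D * D)) * (n * (τ * τ * τ))
        ≡⟨ eq₁ n τ D ⟩
      9216 * (n * τ * (D * D) * (n * τ * (D * D)) * (n * τ * (D * D)))
        ≤⟨ *-monoʳ-≤ 9216 (cube-mono nτD²≤) ⟩
      9216 * (3 * (t * t) * (3 * (t * t)) * (3 * (t * t)))
        ≡⟨ eq₂ (t * t) ⟩
      t * t * (t * t) * (248832 * (t * t))
        ≡⟨ cong (λ k → t * t * (t * t) * (k * (t * t))) K≡ ⟩
      t * t * (t * t) * (K * (t * t)) ∎)
    where
    open Parameters par
    instance
      t≢0 : NonZero t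
      t≢0 = >-nonZero (≤-trans 1≤D D≤t)
      t⁴≢0 : NonZero (t * t * (t * t))
      t⁴≢0 = m*n≢0 (t * t) (t * t) {{m*n≢0 t t}} {{m*n≢0 t t}}
    eq₁ : ∀ n τ D → 96 * n * (D * D * D) * (96 * n * (D * D * D)) * (n * (τ * τ * τ)) ≡
                    9216 * (n * τ * (D * D) * (n * τ * (D * D)) * (n * τ * (D * D)))
    eq₁ = solve-∀
    eq₂ : ∀ s → 9216 * (3 * s * (3 * s) * (3 * s)) ≡ s * s * (248832 * s)
    eq₂ = solve-∀
    nτD²≤ : n * τ * (D * D) ≤ 3 * (t * t)
    nτD²≤ = begin
      n * τ * (D * D) ≤⟨ *-monoˡ-≤ (D * D) nτ≤L ⟩
      L * (D * D) ≡⟨ *-assoc L D D ⟨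
      L * D * D ≤⟨ *-monoˡ-≤ D LD≤ ⟩
      (B * t + (B * t + D)) * D ≤⟨ *-monoˡ-≤ D (+-monoʳ-≤ (B * t) (+-monoʳ-≤ (B * t) (≤-trans D≤t (m≤n*m t B {{>-nonZero 1≤B}})))) ⟩
      (B * t + (B * t + B * t)) * D ≡⟨ eq B t D ⟩
      3 * (B * D * t) ≤⟨ *-monoʳ-≤ 3 (*-monoˡ-≤ t BD≤t) ⟩
      3 * (t * t) ∎
      where
      eq : ∀ B t D → (B * t + (B * t + B * t)) * D ≡ 3 * (B * D * t)
      eq = solve-∀

  *-^ : ∀ a b n → (a * b) ^ n ≡ a ^ n * b ^ n
  *-^ a b zero    = refl
  *-^ a b (suc n) = trans (cong (a * b *_) (*-^ a b n)) (interchange a b (a ^ n) (b ^ n))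
    where
    interchange : ∀ a b c d → a * b * (c * d) ≡ a * c * (b * d)
    interchange = solve-∀

  ^-cancelˡ-≤ : ∀ n .{{_ : NonZero n}} {a b} → a ^ n ≤ b ^ n → a ≤ b
  ^-cancelˡ-≤ n le = ≮⇒≥ λ b<a → <⇒≱ (^-monoˡ-< n b<a) le

  geometric : ∀ (v : ℕ → ℕ) a b → (∀ k → a * v (suc k) ≤ b * v k) → ∀ j → a ^ j * v j ≤ b ^ j * v 0
  geometric v a b step zero    = ≤-refl
  geometric v a b step (suc j) = begin
    a * a ^ j * v (suc j) ≡⟨ eq₁ a (a ^ j) (v (suc j)) ⟩
    a ^ j * (a * v (suc j)) ≤⟨ *-monoʳ-≤ (a ^ j) (step j) ⟩
    a ^ j * (b * v j) ≡⟨ eq₂ (a ^ j) b (v j) ⟩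
    b * (a ^ j * v j) ≤⟨ *-monoʳ-≤ b (geometric v a b step j) ⟩
    b * (b ^ j * v 0) ≡⟨ *-assoc b (b ^ j) (v 0) ⟨
    b * b ^ j * v 0 ∎
    where
    eq₁ : ∀ a b c → a * b * c ≡ b * (a * c)
    eq₁ = solve-∀
    eq₂ : ∀ a b c → a * (b * c) ≡ b * (a * c)
    eq₂ = solve-∀

  geometric-1 : ∀ (v : ℕ → ℕ) b → (∀ k → v (suc k) ≤ b * v k) → ∀ j → v j ≤ b ^ j * v 0
  geometric-1 v b step j = subst (_≤ b ^ j * v 0) (trans (cong (_* v j) (^-zeroˡ j)) (*-identityˡ (v j)))
    (geometric v 1 b (λ k → subst (_≤ b * v k) (sym (*-identityˡ (v (suc k)))) (step k)) j)

  t^-split : ∀ t j → t ^ (4 + j) ≡ t * t * (t * t) * t ^ j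
  t^-split t j = eq t (t ^ j)
    where
    eq : ∀ t T → t * (t * (t * (t * T))) ≡ t * t * (t * t) * T
    eq = solve-∀

  -- Here j = l - 3. With U = t^(l+1) the bounds combine to t^j U⁴ ≤ (q E)^(l+1). Squaring makes E²
  -- appear, which A t⁵ replaces; the surplus (t⁵)^(l+1) is multiplied in beforehand and cancelled.
  exponents₁ : ∀ t q E A v₁ v j → .{{_ : NonZero t}} → E * E ≤ A * (t * t * (t * t) * t) →
    v₁ ≤ q * q * E → t ^ j * (v * v) ≤ (q * E) ^ j * (v₁ * v₁) →
    t ^ (4 + j) * t ^ (4 + j) ≤ v * E → t ^ (5 * j + 12) ≤ A ^ (4 + j) * q ^ (2 * j + 8)
  exponents₁ t q E A v₁ v j E²≤ v₁≤ vj≤ missing = *-cancelʳ-≤ _ _ (t⁵ ^ m) {{m^n≢0 t⁵ m {{t⁵≢0}}}} (begin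
      t ^ (5 * j + 12) * t⁵ ^ m ≡⟨ cong₂ _*_ t^≡ t⁵^m≡ ⟩
      T * T * T * T * T * (t⁴ * t⁴ * t⁴) * (T * T * T * T * T * (t⁴ * t⁴ * t⁴ * t⁴ * t⁴))
              ≡⟨ eq₄ T t⁴ ⟩
      S * S ≤⟨ square-mono S≤ ⟩
      (q * E) ^ m * (q * E) ^ m ≡⟨ trans (sym (*-^ (q * E) (q * E) m)) (cong (_^ m) (eq₅ q E)) ⟩
      (E * E * (q * q)) ^ m ≤⟨ ^-monoˡ-≤ m (*-monoˡ-≤ (q * q) E²≤) ⟩
      (A * t⁵ * (q * q)) ^ m ≡⟨ trans (*-^ (A * t⁵) (q * q) m) (cong₂ _*_ (*-^ A t⁵ m) (*-^ q q m)) ⟩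
      A ^ m * t⁵ ^ m * (q ^ m * q ^ m) ≡⟨ eq₆ (A ^ m) (t⁵ ^ m) (q ^ m) ⟩
      A ^ m * (q ^ m * q ^ m) * t⁵ ^ m ≡⟨ cong (λ z → A ^ m * z * t⁵ ^ m) (trans (sym (^-distribˡ-+-* q m m)) (cong (q ^_) (eq₇ j))) ⟩
      A ^ m * q ^ (2 * j + 8) * t⁵ ^ m ∎)
    where
    m = 4 + j
    T = t ^ j
    t⁴ = t * t * (t * t)
    t⁵ = t⁴ * t
    t⁴≢0 : NonZero t⁴
    t⁴≢0 = m*n≢0 (t * t) (t * t) {{m*n≢0 t t}} {{m*n≢0 t t}}
    t⁵≢0 : NonZero t⁵
    t⁵≢0 = m*n≢0 t⁴ t {{t⁴≢0}}
    S = T * (t⁴ * T * (t⁴ * T) * (t⁴ * T * (t⁴ * T)))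
    t^≡ : t ^ (5 * j + 12) ≡ T * T * T * T * T * (t⁴ * t⁴ * t⁴)
    t^≡ = trans (^-distribˡ-+-* t (5 * j) 12) (cong₂ _*_ (trans (cong (t ^_) (*-comm 5 j)) (trans (sym (^-*-assoc t j 5)) (eq (t ^ j)))) (eq′ t))
      where
      eq : ∀ a → a * (a * (a * (a * (a * 1)))) ≡ a * a * a * a * a
      eq = solve-∀
      eq′ : ∀ t → t * (t * (t * (t * (t * (t * (t * (t * (t * (t * (t * (t * 1))))))))))) ≡ t * t * (t * t) * (t * t * (t * t)) * (t * t * (t * t))
      eq′ = solve-∀
    t⁵^m≡ : t⁵ ^ m ≡ T * T * T * T * T * (t⁴ * t⁴ * t⁴ * t⁴ * t⁴)
    t⁵^m≡ = trans (trans (cong (_^ m) (t^5 t)) (trans (^-*-assoc t 5 m) (trans (cong (t ^_) (*-comm 5 m)) (sym (^-*-assoc t m 5)))))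
      (trans (cong (_^ 5) (t^-split t j)) (eq t⁴ T))
      where
      t^5 : ∀ t → t * t * (t * t) * t ≡ t * (t * (t * (t * (t * 1))))
      t^5 = solve-∀
      eq : ∀ s T → (s * T) * ((s * T) * ((s * T) * ((s * T) * ((s * T) * 1)))) ≡ T * T * T * T * T * (s * s * s * s * s)
      eq = solve-∀
    eq₄ : ∀ T s → T * T * T * T * T * (s * s * s) * (T * T * T * T * T * (s * s * s * s * s)) ≡
                  T * (s * T * (s * T) * (s * T * (s * T))) * (T * (s * T * (s * T) * (s * T * (s * T))))
    eq₄ = solve-∀
    eq₅ : ∀ q E → q * E * (q * E) ≡ E * E * (q * q)
    eq₅ = solve-∀
    eq₆ : ∀ a b c → a * b * (c * c) ≡ a * (c * c) * b
    eq₆ = solve-∀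
    eq₇ : ∀ j → 4 + j + (4 + j) ≡ 2 * j + 8
    eq₇ = solve-∀
    missing′ : t⁴ * T * (t⁴ * T) ≤ v * E
    missing′ = subst (_≤ v * E) (cong (λ z → z * z) (t^-split t j)) missing
    S≤ : S ≤ (q * E) ^ m
    S≤ = begin
      T * (t⁴ * T * (t⁴ * T) * (t⁴ * T * (t⁴ * T))) ≤⟨ *-monoʳ-≤ T (square-mono missing′) ⟩
      T * (v * E * (v * E)) ≡⟨ eq₁ T v E ⟩
      T * (v * v) * (E * E) ≤⟨ *-monoˡ-≤ (E * E) vj≤ ⟩
      (q * E) ^ j * (v₁ * v₁) * (E * E) ≤⟨ *-monoˡ-≤ (E * E) (*-monoʳ-≤ ((q * E) ^ j) (square-mono v₁≤)) ⟩
      (q * E) ^ j * (q * q * E * (q * q * E)) * (E * E) ≡⟨ eq₂ ((q * E) ^ j) q E ⟩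
      q * E * (q * E) * (q * E * (q * E)) * (q * E) ^ j ≡⟨ t^-split (q * E) j ⟨
      (q * E) ^ m ∎
      where
      eq₁ : ∀ T v E → T * (v * E * (v * E)) ≡ T * (v * v) * (E * E)
      eq₁ = solve-∀
      eq₂ : ∀ P q E → P * (q * q * E * (q * q * E)) * (E * E) ≡ q * E * (q * E) * (q * E * (q * E)) * P
      eq₂ = solve-∀

  -- The fourth power of the last hypothesis gives U⁸ ≤ (q E²)^(l+1) q⁴ with U = t^(l+1) and j = l -
  -- 3; q⁴ is what v₁⁴ ≤ q⁸ E⁴ leaves over.
  exponents₂ : ∀ t q E A v₁ v j → .{{_ : NonZero t}} → E * E ≤ A * (t * t * (t * t) * t) →
    v₁ ≤ q * q * E → v * v * (v * v) ≤ (q * (E * E)) ^ j * (v₁ * v₁ * (v₁ * v₁)) →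
    t ^ (4 + j) * t ^ (4 + j) ≤ v * E → t ^ (3 * j + 12) ≤ A ^ (4 + j) * q ^ (j + 8)
  exponents₂ t q E A v₁ v j E²≤ v₁≤ vj≤ missing = *-cancelʳ-≤ _ _ (t⁵ ^ m) {{m^n≢0 t⁵ m {{t⁵≢0}}}} (begin
      t ^ (3 * j + 12) * t⁵ ^ m ≡⟨ t^≡ ⟩
      U * U * (U * U) * (U * U * (U * U)) ≤⟨ square-mono (square-mono missing) ⟩
      v * E * (v * E) * (v * E * (v * E)) ≡⟨ eq₁ v E ⟩
      v * v * (v * v) * (E * E * (E * E)) ≤⟨ *-monoˡ-≤ (E * E * (E * E)) vj≤ ⟩
      (q * (E * E)) ^ j * (v₁ * v₁ * (v₁ * v₁)) * (E * E * (E * E))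
              ≤⟨ *-monoˡ-≤ (E * E * (E * E)) (*-monoʳ-≤ ((q * (E * E)) ^ j) (square-mono (square-mono v₁≤))) ⟩
      (q * (E * E)) ^ j * (q * q * E * (q * q * E) * (q * q * E * (q * q * E))) * (E * E * (E * E))
              ≡⟨ eq₂ ((q * (E * E)) ^ j) q E ⟩
      q * (E * E) * (q * (E * E)) * (q * (E * E) * (q * (E * E))) * (q * (E * E)) ^ j * (q * q * (q * q))
              ≡⟨ cong (_* (q * q * (q * q))) (t^-split (q * (E * E)) j) ⟨
      (q * (E * E)) ^ m * (q * q * (q * q)) ≤⟨ *-monoˡ-≤ (q * q * (q * q)) (^-monoˡ-≤ m (*-monoʳ-≤ q E²≤)) ⟩
      (q * (A * t⁵)) ^ m * (q * q * (q * q)) ≡⟨ cong (_* (q * q * (q * q))) (trans (*-^ q (A * t⁵) m) (cong (q ^ m *_) (*-^ A t⁵ m))) ⟩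
      q ^ m * (A ^ m * t⁵ ^ m) * (q * q * (q * q)) ≡⟨ eq₃ (q ^ m) (A ^ m) (t⁵ ^ m) q ⟩
      A ^ m * (q ^ m * q ^ 4) * t⁵ ^ m ≡⟨ cong (λ z → A ^ m * z * t⁵ ^ m) (trans (sym (^-distribˡ-+-* q m 4)) (cong (q ^_) (eq₄ j))) ⟩
      A ^ m * q ^ (j + 8) * t⁵ ^ m ∎)
    where
    m = 4 + j
    U = t ^ m
    t⁴ = t * t * (t * t)
    t⁵ = t⁴ * t
    t⁵≢0 : NonZero t⁵
    t⁵≢0 = m*n≢0 t⁴ t {{m*n≢0 (t * t) (t * t) {{m*n≢0 t t}} {{m*n≢0 t t}}}}
    t^≡ : t ^ (3 * j + 12) * t⁵ ^ m ≡ U * U * (U * U) * (U * U * (U * U))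
    t^≡ = trans (cong₂ _*_
        (trans (cong (t ^_) (e₁ j)) (sym (^-*-assoc t m 3)))
        (trans (cong (_^ m) (t^5 t)) (trans (^-*-assoc t 5 m) (trans (cong (t ^_) (*-comm 5 m)) (sym (^-*-assoc t m 5))))))
      (e₂ U)
      where
      e₁ : ∀ j → 3 * j + 12 ≡ (4 + j) * 3
      e₁ = solve-∀
      t^5 : ∀ t → t * t * (t * t) * t ≡ t * (t * (t * (t * (t * 1))))
      t^5 = solve-∀
      e₂ : ∀ U → (U * (U * (U * 1))) * (U * (U * (U * (U * (U * 1))))) ≡ U * U * (U * U) * (U * U * (U * U))
      e₂ = solve-∀
    eq₁ : ∀ v E → v * E * (v * E) * (v * E * (v * E)) ≡ v * v * (v * v) * (E * E * (E * E))
    eq₁ = solve-∀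
    eq₂ : ∀ P q E → P * (q * q * E * (q * q * E) * (q * q * E * (q * q * E))) * (E * E * (E * E)) ≡
                    q * (E * E) * (q * (E * E)) * (q * (E * E) * (q * (E * E))) * P * (q * q * (q * q))
    eq₂ = solve-∀
    eq₃ : ∀ a b c q → a * (b * c) * (q * q * (q * q)) ≡ b * (a * (q * (q * (q * (q * 1))))) * c
    eq₃ = solve-∀
    eq₄ : ∀ j → 4 + j + 4 ≡ j + 8
    eq₄ = solve-∀

  constant-too-small : ∀ A → 1 < A → ∀ {a b} N → .{{NonZero N}} → a < b → ¬ (A ^ b * N ≤ A ^ a * N)
  constant-too-small A 1<A {a} {b} N a<b le = <⇒≱ (^-monoʳ-< A 1<A a<b) (*-cancelʳ-≤ (A ^ b) (A ^ a) N le)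

  base≤ : ∀ c N t b .{{_ : NonZero b}} .{{_ : NonZero N}} → c ^ b * N ≤ t ^ b → c ≤ t
  base≤ c N t b le = ^-cancelˡ-≤ b (≤-trans (m≤m*n (c ^ b) N) le)

  -- Beyond t = p^{2/3} the second part of the theorem applies.
  large-subgroup : ∀ t q i → 4084101 ≤ t → q * q < 21 * (t * t * t) → q ^ (5 + i) < t ^ (2 * (4 + i))
  large-subgroup t q i 21⁵≤t q²<21t³ = ≰⇒> λ le → <⇒≱ (begin-strict
      q ^ m * q ^ m ≡⟨ *-^ q q m ⟨
      (q * q) ^ m <⟨ ^-monoˡ-< m q²<21t³ ⟩
      (21 * (t * t * t)) ^ m ≡⟨ *-^ 21 (t * t * t) m ⟩
      21 ^ m * (t * t * t) ^ m ≤⟨ *-monoˡ-≤ ((t * t * t) ^ m) 21^m≤ ⟩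
      t ^ (1 + i) * (t * t * t) ^ m ≡⟨ cong (t ^ (1 + i) *_) (trans (cong (_^ m) (cube t)) (^-*-assoc t 3 m)) ⟩
      t ^ (1 + i) * t ^ (3 * m) ≡⟨ ^-distribˡ-+-* t (1 + i) (3 * m) ⟨
      t ^ (1 + i + 3 * m) ≡⟨ cong (t ^_) (e i) ⟩
      t ^ (2 * (4 + i) + 2 * (4 + i)) ≡⟨ ^-distribˡ-+-* t (2 * (4 + i)) (2 * (4 + i)) ⟩
      t ^ (2 * (4 + i)) * t ^ (2 * (4 + i)) ∎) (square-mono le)
    where
    m = 5 + i
    cube : ∀ t → t * t * t ≡ t * (t * (t * 1))
    cube = solve-∀
    e : ∀ i → 1 + i + 3 * (5 + i) ≡ 2 * (4 + i) + 2 * (4 + i)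
    e = solve-∀
    -- The power of t left to absorb 21^(5+i) is t^(1+i), and 5 + i ≤ 5 (1 + i); hence the threshold
    -- 21⁵ = 4084101.
    21^m≤ : 21 ^ m ≤ t ^ (1 + i)
    21^m≤ = begin
      21 ^ m ≤⟨ ^-monoʳ-≤ 21 (+-monoʳ-≤ 5 (m≤n*m i 5)) ⟩
      21 ^ (5 + 5 * i) ≡⟨ cong (21 ^_) (e′ i) ⟩
      21 ^ (5 * (1 + i)) ≡⟨ ^-*-assoc 21 5 (1 + i) ⟨
      (21 ^ 5) ^ (1 + i) ≤⟨ ^-monoˡ-≤ (1 + i) 21⁵≤t ⟩
      t ^ (1 + i) ∎
      where
      e′ : ∀ i → 5 + 5 * i ≡ 5 * (1 + i)
      e′ = solve-∀

-- The additive energy of a subgroup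

module Sumsℕ where

  open import Data.Nat public using (_≤_; _<_; _+_; _*_; _≤?_)
  open import Data.Nat.Tactic.RingSolver public using (solve-∀)
  open import Algebra.Properties.Semiring.Sum ℤ.+-*-semiring public using () renaming (sum to ∑ᶻ; sum-cong-≗ to ∑ᶻ-cong)
  open import Algebra.Properties.Semiring.Sum ℕ.+-*-semiring public using (*-distribˡ-sum; *-distribʳ-sum; ∑-distrib-+; ∑-comm; sum-cong-≗; sum-replicate-zero) renaming (sum to ∑)

  pos-∑ : ∀ {n} (f : Fin n → ℕ) → + ∑ f ≡ ∑ᶻ (λ x → + f x)
  pos-∑ {zero}  f = refl
  pos-∑ {suc n} f = trans (ℤ.pos-+ (f zero) _) (cong (ℤ._+_ (+ f zero)) (pos-∑ (f ∘ suc)))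

  ∑-mono-≤ : ∀ {n} {f g : Fin n → ℕ} → (∀ i → f i ≤ g i) → ∑ f ≤ ∑ g
  ∑-mono-≤ {zero}  f≤g = z≤n
  ∑-mono-≤ {suc n} f≤g = ℕ.+-mono-≤ (f≤g zero) (∑-mono-≤ (f≤g ∘ suc))

  ∑-zero : ∀ {n} {f : Fin n → ℕ} → (∀ i → f i ≡ 0) → ∑ f ≡ 0
  ∑-zero {n} f≡0 = trans (sum-cong-≗ f≡0) (sum-replicate-zero n)

  ∑-single : ∀ {n} {f : Fin n → ℕ} i → (∀ j → j ≢ i → f j ≡ 0) → ∑ f ≡ f i
  ∑-single {suc n} {f} zero    f≡0 = trans (cong (_+_ (f zero)) (∑-zero (λ j → f≡0 (suc j) λ ()))) (ℕ.+-identityʳ _)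
  ∑-single {suc n} {f} (suc i) f≡0 = cong₂ _+_ (f≡0 zero λ ()) (∑-single i (λ j j≢i → f≡0 (suc j) (j≢i ∘ suc-injective)))

  term≤∑ : ∀ {n} (f : Fin n → ℕ) i → f i ≤ ∑ f
  term≤∑ f zero    = ℕ.m≤m+n _ _
  term≤∑ f (suc i) = ℕ.≤-trans (term≤∑ (f ∘ suc) i) (ℕ.m≤n+m _ _)

  ⟦_⟧ : ∀ {P : Set} → Dec P → ℕ
  ⟦ d ⟧ = ind (does d)

  ⟦⟧-true : ∀ {P : Set} (d : Dec P) → P → ⟦ d ⟧ ≡ 1
  ⟦⟧-true d x = cong ind (dec-true d x)

  ⟦⟧-false : ∀ {P : Set} (d : Dec P) → ¬ P → ⟦ d ⟧ ≡ 0
  ⟦⟧-false d x = cong ind (dec-false d x)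

  ⟦⟧-× : ∀ {P Q : Set} (d : Dec P) (e : Dec Q) → ⟦ d ×-dec e ⟧ ≡ ⟦ d ⟧ * ⟦ e ⟧
  ⟦⟧-× (yes _) e = sym (ℕ.*-identityˡ ⟦ e ⟧)
  ⟦⟧-× (no _)  e = refl

  ⟦⟧≤1 : ∀ {P : Set} (d : Dec P) → ⟦ d ⟧ ≤ 1
  ⟦⟧≤1 (yes _) = s≤s z≤n
  ⟦⟧≤1 (no _)  = z≤n

  ⟦⟧*-mono-≤ : ∀ {P : Set} (d : Dec P) {a b} → (P → a ≤ b) → ⟦ d ⟧ * a ≤ ⟦ d ⟧ * b
  ⟦⟧*-mono-≤ (yes x) a≤b = ℕ.*-monoʳ-≤ 1 (a≤b x)
  ⟦⟧*-mono-≤ (no _)  a≤b = z≤n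

  ∑-⟦⟧ : ∀ {n} {A : Set} {P : A → Set} (P? : Decidable P) (f : Fin n → A) →
          ∑ (λ i → ⟦ P? (f i) ⟧) ≡ length (filter P? (tabulate f))
  ∑-⟦⟧ {zero}  P? f = refl
  ∑-⟦⟧ {suc n} P? f with does (P? (f zero))
  ... | true  = cong suc (∑-⟦⟧ P? (f ∘ suc))
  ... | false = ∑-⟦⟧ P? (f ∘ suc)

module Energy {q : ℕ} (𝔽 : FiniteField q)
  (R : Subset q) (R-subgroup : IsSubgroup 𝔽 R) where

  open Sumsℕ
  open Sumsℤ using (‖_‖²) renaming (∑-mono-≤ to ∑ᶻ-mono-≤)
  open Arithmetic
  open FiniteField 𝔽
  open IsSubgroup R-subgroup
  open Subgroup 𝔽 R R-subgroup
  open Convolution 𝔽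
  private module F = CommutativeRing commutativeRing
  open Polynomial commutativeRing
  open PolynomialDomain commutativeRing (finiteField-domain 𝔽)
  open IsDomain (finiteField-domain 𝔽) using (cancel)
  open import Algebra.Properties.CommutativeMonoid.Sum F.*-commutativeMonoid using () renaming (sum to ∏; sum-permute to ∏-permute; ∑-distrib-+ to ∏-distrib-⊡; sum-cong-≗ to ∏-cong)
  open import Algebra.Properties.Monoid.Mult F.+-monoid using () renaming (_×_ to _·_)
  open import Algebra.Properties.CommutativeSemiring.Exp F.commutativeSemiring using () renaming (_^_ to _^ᶠ_; ^-distrib-* to ^ᶠ-distrib-⊡)
  open import Algebra.Properties.Ring F.ring using (-‿distribʳ-*)

  1<q : 1 < q
  1<q = go q 1F 0F 1F≢0F
    where
    go : ∀ q (x y : Fin q) → x ≢ y → 1 < q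
    go (suc zero)    zero zero x≢y = contradiction refl x≢y
    go (suc (suc q)) _    _    _   = s≤s (s≤s z≤n)

  one^ : ∀ n → 1F ^ᶠ n ≡ 1F
  one^ zero    = refl
  one^ (suc n) = trans (F.*-identityˡ _) (one^ n)

  zero^t : 0F ^ᶠ t ≡ 0F
  zero^t = go t 0<t
    where
    go : ∀ n → 0 < n → 0F ^ᶠ n ≡ 0F
    go (suc n) _ = F.zeroˡ _

  choose : Fin q → Bool → Fin q
  choose x true  = x
  choose x false = 1F

  ∏-choose : ∀ {n} r (S : Subset n) → ∏ (λ x → choose r (lookup S x)) ≡ r ^ᶠ ∣ S ∣
  ∏-choose r []          = refl
  ∏-choose r (true ∷ S)  = cong (r ⊡_) (∏-choose r S)
  ∏-choose r (false ∷ S) = trans (F.*-identityˡ _) (∏-choose r S)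

  ind-injective : ∀ a b → + ind a ≡ + ind b → a ≡ b
  ind-injective true  true  _ = refl
  ind-injective false false _ = refl

  -- Dilation by r permutes R and so preserves the product of its elements, but also multiplies it
  -- by r^t; the product is nonzero. It is taken over the whole field with factors 1 outside R, so
  -- that a permutation of the field can be used.
  lagrange : ∀ {r} → r ∈ R → r ^ᶠ t ≡ 1F
  lagrange {r} r∈R = begin
    r ^ᶠ t ≡⟨ cancelʳ′ (r ^ᶠ t) 1F ⟨
    r ^ᶠ t ⊞ ⊟ 1F ⊞ 1F ≡⟨ cong (_⊞ 1F) (cancel (∏≢0 g g≢0) (begin
      Π ⊡ (r ^ᶠ t ⊞ ⊟ 1F) ≡⟨ F.distribˡ Π _ _ ⟩
      Π ⊡ r ^ᶠ t ⊞ Π ⊡ ⊟ 1F ≡⟨ cong₂ _⊞_ (trans (F.*-comm Π _) (sym Π≡)) (trans (sym (-‿distribʳ-* Π 1F)) (cong ⊟_ (F.*-identityʳ Π))) ⟩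
      Π ⊞ ⊟ Π ≡⟨ F.-‿inverseʳ Π ⟩
      0F ∎)) ⟩
    0F ⊞ 1F ≡⟨ F.+-identityˡ 1F ⟩
    1F ∎
    where
    open ≡-Reasoning
    g : Fin q → Fin q
    g x = choose x (lookup R x)
    Π = ∏ g
    g≢0 : ∀ x → g x ≢ 0F
    g≢0 x with lookup R x in eq
    ... | true  = R∌0 (lookup⇒[]= x R eq)
    ... | false = 1F≢0F
    ∏≢0 : ∀ {n} (f : Fin n → Fin q) → (∀ x → f x ≢ 0F) → ∏ f ≢ 0F
    ∏≢0 {zero}  f f≢0 = 1F≢0F
    ∏≢0 {suc n} f f≢0 = nonzero-* (f≢0 zero) (∏≢0 (f ∘ suc) (f≢0 ∘ suc))
    g-dilate : ∀ x → g (r ⊡ x) ≡ choose r (lookup R x) ⊡ g x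
    g-dilate x rewrite ind-injective (lookup R (r ⊡ x)) (lookup R x) (χ-invariant r∈R x) with lookup R x
    ... | true  = refl
    ... | false = sym (F.*-identityˡ 1F)
    Π≡ : Π ≡ r ^ᶠ t ⊡ Π
    Π≡ with inv-closed r∈R
    ... | r⁻¹ , _ , rr⁻¹≡1 = begin
      ∏ g ≡⟨ ∏-permute g (permutation (r ⊡_) (r⁻¹ ⊡_)
              (⊡-cancel (trans (F.*-comm r⁻¹ r) rr⁻¹≡1)) (⊡-cancel rr⁻¹≡1)) ⟩
      ∏ (λ x → g (r ⊡ x)) ≡⟨ ∏-cong g-dilate ⟩
      ∏ (λ x → choose r (lookup R x) ⊡ g x) ≡⟨ ∏-distrib-⊡ (λ x → choose r (lookup R x)) g ⟩
      ∏ (λ x → choose r (lookup R x)) ⊡ ∏ g ≡⟨ cong (_⊡ ∏ g) (∏-choose r R) ⟩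
      r ^ᶠ t ⊡ ∏ g ∎

  -- The second condition excludes the zeros of X (X - 1), at which `W` vanishes and the order
  -- criterion fails.
  Good : Fin q → Set
  Good u = (u ⊞ ⊟ 1F) ^ᶠ t ≡ u ^ᶠ t × u ^ᶠ t ≢ 0F

  good? : ∀ u → Dec (Good u)
  good? u = ((u ⊞ ⊟ 1F) ^ᶠ t ≟ u ^ᶠ t) ×-dec ¬? (u ^ᶠ t ≟ 0F)

  -- M κ = #{u : uᵗ = (u − 1)ᵗ = κ} for κ ≠ 0, and M 0 = 0.
  M : Fin q → ℕ
  M κ = ∑ (λ u → ⟦ good? u ⟧ * ⟦ u ^ᶠ t ≟ κ ⟧)

  -- Each good u lies in just one fibre of u ↦ u^t, so a weight in κ may be evaluated at u^t.
  ∑-fibres : ∀ (w : Fin q → ℕ) → ∑ (λ κ → w κ * M κ) ≡ ∑ (λ u → ⟦ good? u ⟧ * w (u ^ᶠ t))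
  ∑-fibres w = begin
    ∑ (λ κ → w κ * M κ)
      ≡⟨ sum-cong-≗ (λ κ → *-distribˡ-sum (w κ) (λ u → ⟦ good? u ⟧ * ⟦ u ^ᶠ t ≟ κ ⟧)) ⟩
    ∑ (λ κ → ∑ (λ u → w κ * (⟦ good? u ⟧ * ⟦ u ^ᶠ t ≟ κ ⟧)))
      ≡⟨ ∑-comm (λ κ u → w κ * (⟦ good? u ⟧ * ⟦ u ^ᶠ t ≟ κ ⟧)) ⟩
    ∑ (λ u → ∑ (λ κ → w κ * (⟦ good? u ⟧ * ⟦ u ^ᶠ t ≟ κ ⟧)))
      ≡⟨ sum-cong-≗ (λ u → trans (∑-single (u ^ᶠ t) (λ κ κ≢ → trans
           (cong (λ z → w κ * (⟦ good? u ⟧ * z)) (⟦⟧-false (u ^ᶠ t ≟ κ) (κ≢ ∘ sym))) (zeros (w κ) ⟦ good? u ⟧)))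
           (trans (cong (λ z → w (u ^ᶠ t) * (⟦ good? u ⟧ * z)) (⟦⟧-true (u ^ᶠ t ≟ u ^ᶠ t) refl)) (ones (w (u ^ᶠ t)) ⟦ good? u ⟧))) ⟩
    ∑ (λ u → ⟦ good? u ⟧ * w (u ^ᶠ t)) ∎
    where
    open ≡-Reasoning
    zeros : ∀ a b → a * (b * 0) ≡ 0
    zeros = solve-∀
    ones : ∀ a b → a * (b * 1) ≡ b * a
    ones = solve-∀

  count-roots : ∀ {P : Fin q → Set} (P? : Decidable P) F n → Deg< (suc n) F → ¬ F ≋ [] → (∀ u → P u → F ⟨ u ⟩ ≡ 0F) →
                ∑ (λ u → ⟦ P? u ⟧) ≤ n
  count-roots P? F n deg F≉0 root = subst (_≤ n) (sym (∑-⟦⟧ P? id))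
    (root-count (filter P? (allFin q)) {F} (Unique.filter⁺ P? (Unique.allFin⁺ q))
      (All.map (λ {u} → root u) (All.all-filter P? (allFin q))) deg F≉0)

  eval-X^ : ∀ u → (X ^ t) ⟨ u ⟩ ≡ u ^ᶠ t
  eval-X^ u = trans (eval-^ X t u) (cong (_^ᶠ t) (eval-X u))

  eval-lin^ : ∀ u → (lin 1F ^ t) ⟨ u ⟩ ≡ (u ⊞ ⊟ 1F) ^ᶠ t
  eval-lin^ u = trans (eval-^ (lin 1F) t u) (cong (_^ᶠ t) (eval-lin 1F u))

  -- Good points are roots of X^t - (X - 1)^t, which is nonzero because it takes the value 1 at 1.
  ∑good≤t : ∑ (λ u → ⟦ good? u ⟧) ≤ t
  ∑good≤t = count-roots good? poly t
    (Deg<-⊹ {suc t} {X ^ t} (Deg<-linear^ X Deg<-X t) (Deg<-⊠ {0} {suc t} (con (⊟ 1F)) (lin 1F ^ t) (Deg<-con (⊟ 1F)) (Deg<-linear^ (lin 1F) (Deg<-lin 1F) t)))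
    poly≉0 (λ u good → trans (eval-poly u) (trans (cong (λ z → u ^ᶠ t ⊞ ⊟ 1F ⊡ z) (proj₁ good)) (annihilate (u ^ᶠ t))))
    where
    poly : Poly
    poly = X ^ t ⊹ con (⊟ 1F) ⊠ lin 1F ^ t
    annihilate : ∀ x → x ⊞ ⊟ 1F ⊡ x ≡ 0F
    annihilate x = trans (cong (_⊞ ⊟ 1F ⊡ x) (sym (F.*-identityˡ x))) (trans (sym (F.distribʳ x 1F (⊟ 1F)))
      (trans (cong (_⊡ x) (F.-‿inverseʳ 1F)) (F.zeroˡ x)))
    eval-poly : ∀ u → poly ⟨ u ⟩ ≡ u ^ᶠ t ⊞ ⊟ 1F ⊡ (u ⊞ ⊟ 1F) ^ᶠ t
    eval-poly u = trans (eval-⊹ (X ^ t) _ u) (cong₂ _⊞_ (eval-X^ u)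
      (trans (eval-⊠ (con (⊟ 1F)) (lin 1F ^ t) u) (cong₂ _⊡_ (eval-con (⊟ 1F) u) (eval-lin^ u))))
    poly≉0 : ¬ poly ≋ []
    poly≉0 e = 1F≢0F (begin
      1F ≡⟨ F.+-identityʳ 1F ⟨
      1F ⊞ 0F ≡⟨ cong₂ _⊞_ (one^ t) (trans (cong (⊟ 1F ⊡_) (trans (cong (_^ᶠ t) (F.-‿inverseʳ 1F)) zero^t)) (F.zeroʳ _)) ⟨
      1F ^ᶠ t ⊞ ⊟ 1F ⊡ (1F ⊞ ⊟ 1F) ^ᶠ t ≡⟨ eval-poly 1F ⟨
      poly ⟨ 1F ⟩ ≡⟨ eval-zero poly 1F e ⟩
      0F ∎)
      where open ≡-Reasoning

  ∑M≤t : ∑ M ≤ t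
  ∑M≤t = subst (_≤ t) (sym (trans (sum-cong-≗ (λ κ → sym (ℕ.*-identityˡ (M κ)))) (trans (∑-fibres (λ _ → 1))
    (sum-cong-≗ (λ u → ℕ.*-identityʳ ⟦ good? u ⟧))))) ∑good≤t

  -- The polynomial κ X^t - 1 has value -1 at 0, so it is nonzero. The bound says how many a can
  -- share one κ.
  ∑fibre≤t : ∀ κ → ∑ (λ a → ⟦ κ ⊡ a ^ᶠ t ≟ 1F ⟧) ≤ t
  ∑fibre≤t κ = count-roots (λ a → κ ⊡ a ^ᶠ t ≟ 1F) poly t
    (Deg<-⊹ {suc t} {con κ ⊠ X ^ t} (Deg<-⊠ {0} {suc t} (con κ) (X ^ t) (Deg<-con κ) (Deg<-linear^ X Deg<-X t)) (Deg<-mono {1} {suc t} {con (⊟ 1F)} (s≤s z≤n) (Deg<-con (⊟ 1F))))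
    poly≉0 (λ a eq → trans (eval-poly a) (trans (cong (_⊞ ⊟ 1F) eq) (F.-‿inverseʳ 1F)))
    where
    poly : Poly
    poly = con κ ⊠ X ^ t ⊹ con (⊟ 1F)
    eval-poly : ∀ a → poly ⟨ a ⟩ ≡ κ ⊡ a ^ᶠ t ⊞ ⊟ 1F
    eval-poly a = trans (eval-⊹ (con κ ⊠ X ^ t) _ a) (cong₂ _⊞_
      (trans (eval-⊠ (con κ) (X ^ t) a) (cong₂ _⊡_ (eval-con κ a) (eval-X^ a))) (eval-con (⊟ 1F) a))
    poly≉0 : ¬ poly ≋ []
    poly≉0 e = 1F≢0F (begin
      1F ≡⟨ F.+-identityʳ 1F ⟨
      1F ⊞ 0F ≡⟨ cong (1F ⊞_) (eval-zero poly 0F e) ⟨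
      1F ⊞ poly ⟨ 0F ⟩ ≡⟨ cong (1F ⊞_) (eval-poly 0F) ⟩
      1F ⊞ (κ ⊡ 0F ^ᶠ t ⊞ ⊟ 1F) ≡⟨ cong (λ z → 1F ⊞ (z ⊞ ⊟ 1F)) (trans (cong (κ ⊡_) zero^t) (F.zeroʳ κ)) ⟩
      1F ⊞ (0F ⊞ ⊟ 1F) ≡⟨ cong (1F ⊞_) (F.+-identityˡ _) ⟩
      1F ⊞ ⊟ 1F ≡⟨ F.-‿inverseʳ 1F ⟩
      0F ∎)
      where open ≡-Reasoning

  -- N a counts the y with y and y - a in R. With y = a u, both a u and a (u - 1) have t-th power 1,
  -- so u^t and (u - 1)^t both equal a^(-t) = κ.
  N≤M : ∀ a → a ≢ 0F → ∀ κ → κ ⊡ a ^ᶠ t ≡ 1F → N a ℤ.≤ + M κ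
  N≤M a a≢0 κ κaᵗ≡1 = begin
    ∑ᶻ (λ x → χ x ℤ.* χ (x ⊞ a))
      ≡⟨ ∑-shift (⊟ a) (λ x → χ x ℤ.* χ (x ⊞ a)) ⟩
    ∑ᶻ (λ y → χ (y ⊞ ⊟ a) ℤ.* χ (y ⊞ ⊟ a ⊞ a))
      ≡⟨ ∑ᶻ-cong (λ y → cong (λ z → χ (y ⊞ ⊟ a) ℤ.* χ z) (cancelʳ′ y a)) ⟩
    ∑ᶻ (λ y → χ (y ⊞ ⊟ a) ℤ.* χ y)
      ≡⟨ ∑-dilate a a≢0 (λ y → χ (y ⊞ ⊟ a) ℤ.* χ y) ⟩
    ∑ᶻ (λ u → χ (a ⊡ u ⊞ ⊟ a) ℤ.* χ (a ⊡ u))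
      ≤⟨ ∑ᶻ-mono-≤ pointwise ⟩
    ∑ᶻ (λ u → + (⟦ good? u ⟧ * ⟦ u ^ᶠ t ≟ κ ⟧))
      ≡⟨ pos-∑ (λ u → ⟦ good? u ⟧ * ⟦ u ^ᶠ t ≟ κ ⟧) ⟨
    + M κ ∎
    where
    open ℤ.≤-Reasoning
    κ≢0 : κ ≢ 0F
    κ≢0 refl = 1F≢0F (trans (sym κaᵗ≡1) (F.zeroˡ _))
    power : ∀ v → a ⊡ v ∈ R → v ^ᶠ t ≡ κ
    power v av∈R = trans (sym (F.*-identityˡ _)) (trans (cong (_⊡ v ^ᶠ t) (sym κaᵗ≡1)) (trans (F.*-assoc κ _ _)
      (trans (cong (κ ⊡_) (trans (sym (^ᶠ-distrib-⊡ a v t)) (lagrange av∈R))) (F.*-identityʳ κ))))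
    shifted : ∀ u → a ⊡ u ⊞ ⊟ a ≡ a ⊡ (u ⊞ ⊟ 1F)
    shifted u = sym (trans (F.distribˡ a u (⊟ 1F)) (cong (a ⊡ u ⊞_) (trans (sym (-‿distribʳ-* a 1F)) (cong ⊟_ (F.*-identityʳ a)))))
    vanish : ∀ {x} {m : ℕ} → x ≡ 0ℤ → x ℤ.≤ + m
    vanish refl = ℤ.+≤+ z≤n
    pointwise : ∀ u → χ (a ⊡ u ⊞ ⊟ a) ℤ.* χ (a ⊡ u) ℤ.≤ + (⟦ good? u ⟧ * ⟦ u ^ᶠ t ≟ κ ⟧)
    pointwise u with χ-cases (a ⊡ u ⊞ ⊟ a) | χ-cases (a ⊡ u)
    ... | inj₂ χ≡0 | _        = vanish (trans (cong (ℤ._* χ (a ⊡ u)) χ≡0) (ℤ.*-zeroˡ (χ (a ⊡ u))))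
    ... | inj₁ _   | inj₂ χ≡0 = vanish (trans (cong (χ (a ⊡ u ⊞ ⊟ a) ℤ.*_) χ≡0) (ℤ.*-zeroʳ (χ (a ⊡ u ⊞ ⊟ a))))
    ... | inj₁ ∈₁  | inj₁ ∈₂ = ℤ.≤-reflexive (trans (cong₂ ℤ._*_ (∈⇒χ≡1 ∈₁) (∈⇒χ≡1 ∈₂)) (sym (cong +_ (cong₂ _*_
            (⟦⟧-true (good? u) (trans (power _ (subst (_∈ R) (shifted u) ∈₁)) (sym (power u ∈₂)) , λ e → κ≢0 (trans (sym (power u ∈₂)) e)))
            (⟦⟧-true (u ^ᶠ t ≟ κ) (power u ∈₂))))))

  ∑M² : ℕ
  ∑M² = ∑ (λ κ → M κ * M κ)

  -- The term a = 0 contributes t². For a ≠ 0 the value κ = a^(-t) is shared by at most t elements,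
  -- so summing over κ instead of a costs a factor t.
  E≤ : E ≤ t * t + t * ∑M²
  E≤ = ℕ.≤-trans (ℤ.drop‿+≤+ (begin
    + E ≡⟨ +E ⟩
    ∑ᶻ (λ a → N a ℤ.* N a) ≤⟨ ∑ᶻ-mono-≤ pointwise ⟩
    ∑ᶻ (λ a → + b a) ≡⟨ pos-∑ b ⟨
    + ∑ b ∎)) ∑b≤
    where
    open ℤ.≤-Reasoning
    c : Fin q → Fin q → ℕ
    c a κ = ⟦ κ ⊡ a ^ᶠ t ≟ 1F ⟧ * (M κ * M κ)
    b : Fin q → ℕ
    b a = ⟦ a ≟ 0F ⟧ * (t * t) + ∑ (c a)
    square : ∀ {x} {m : ℕ} → 0ℤ ℤ.≤ x → x ℤ.≤ + m → x ℤ.* x ℤ.≤ + (m * m)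
    square {+ n} {m} _ (ℤ.+≤+ n≤m) = subst (ℤ._≤ + (m * m)) (ℤ.pos-* n n) (ℤ.+≤+ (ℕ.*-mono-≤ n≤m n≤m))
    pointwise : ∀ a → N a ℤ.* N a ℤ.≤ + b a
    pointwise a with a ≟ 0F
    ... | yes refl = ℤ.≤-trans (square (0≤N 0F) (ℤ.≤-reflexive (trans (correlation-0 χ) ‖χ‖²)))
                       (ℤ.+≤+ (ℕ.≤-trans (ℕ.≤-reflexive (sym (ℕ.*-identityˡ (t * t)))) (ℕ.m≤m+n _ (∑ (c 0F)))))
    ... | no a≢0 = ℤ.≤-trans (square (0≤N a) (N≤M a a≢0 κ κaᵗ≡1)) (ℤ.+≤+ (ℕ.≤-trans
                       (ℕ.≤-reflexive (sym (trans (cong (_* (M κ * M κ)) (⟦⟧-true (κ ⊡ a ^ᶠ t ≟ 1F) κaᵗ≡1)) (ℕ.*-identityˡ _))))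
                       (term≤∑ (c a) κ)))
      where
      κ = proj₁ (inverse a a≢0) ^ᶠ t
      κaᵗ≡1 : κ ⊡ a ^ᶠ t ≡ 1F
      κaᵗ≡1 = trans (sym (^ᶠ-distrib-⊡ _ a t)) (trans (cong (_^ᶠ t) (trans (F.*-comm _ a) (proj₂ (inverse a a≢0)))) (one^ t))
    ∑b≤ : ∑ b ≤ t * t + t * ∑M²
    ∑b≤ = L.begin
      ∑ b L.≡⟨ ∑-distrib-+ (λ a → ⟦ a ≟ 0F ⟧ * (t * t)) (λ a → ∑ (c a)) ⟩
      ∑ (λ a → ⟦ a ≟ 0F ⟧ * (t * t)) + ∑ (λ a → ∑ (c a)) L.≡⟨ cong₂ _+_ (trans (∑-single 0F (λ a a≢0 → cong (_* (t * t)) (⟦⟧-false (a ≟ 0F) a≢0)))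
              (trans (cong (_* (t * t)) (⟦⟧-true (0F ≟ 0F) refl)) (ℕ.*-identityˡ (t * t))))
              (trans (∑-comm c) (sum-cong-≗ (λ κ → sym (*-distribʳ-sum (M κ * M κ) (λ a → ⟦ κ ⊡ a ^ᶠ t ≟ 1F ⟧))))) ⟩
      t * t + ∑ (λ κ → ∑ (λ a → ⟦ κ ⊡ a ^ᶠ t ≟ 1F ⟧) * (M κ * M κ)) L.≤⟨ ℕ.+-monoʳ-≤ (t * t) (∑-mono-≤ (λ κ → ℕ.*-monoˡ-≤ (M κ * M κ) (∑fibre≤t κ))) ⟩
      t * t + ∑ (λ κ → t * (M κ * M κ)) L.≡⟨ cong (_+_ (t * t)) (sym (*-distribˡ-sum t (λ κ → M κ * M κ))) ⟩
      t * t + t * ∑M² L.∎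
      where module L = ℕ.≤-Reasoning

  level : ℕ → ℕ
  level τ = ∑ (λ κ → ⟦ τ ≤? M κ ⟧)

  -- Markov's inequality. The right side counts the good points over the level set, which are the
  -- zeros available to Stepanov's method.
  level*τ≤ : ∀ τ → level τ * τ ≤ ∑ (λ u → ⟦ good? u ⟧ * ⟦ τ ≤? M (u ^ᶠ t) ⟧)
  level*τ≤ τ = begin
    level τ * τ ≡⟨ *-distribʳ-sum τ (λ κ → ⟦ τ ≤? M κ ⟧) ⟩
    ∑ (λ κ → ⟦ τ ≤? M κ ⟧ * τ) ≤⟨ ∑-mono-≤ (λ κ → ⟦⟧*-mono-≤ (τ ≤? M κ) id) ⟩
    ∑ (λ κ → ⟦ τ ≤? M κ ⟧ * M κ) ≡⟨ ∑-fibres (λ κ → ⟦ τ ≤? M κ ⟧) ⟩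
    ∑ (λ u → ⟦ good? u ⟧ * ⟦ τ ≤? M (u ^ᶠ t) ⟧) ∎
    where
    open ℕ.≤-Reasoning

  level*τ≤t : ∀ τ → level τ * τ ≤ t
  level*τ≤t τ = ℕ.≤-trans (level*τ≤ τ) (ℕ.≤-trans (∑-mono-≤ (λ u →
    ℕ.≤-trans (ℕ.*-monoʳ-≤ ⟦ good? u ⟧ (⟦⟧≤1 (τ ≤? M (u ^ᶠ t)))) (ℕ.≤-reflexive (ℕ.*-identityʳ _)))) ∑good≤t)

  M-0 : M 0F ≡ 0
  M-0 = ∑-zero (λ u → exclusive (good? u) (u ^ᶠ t ≟ 0F) (λ good e → proj₂ good e))
    where
    exclusive : ∀ {P Q : Set} (d : Dec P) (e : Dec Q) → (P → ¬ Q) → ⟦ d ⟧ * ⟦ e ⟧ ≡ 0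
    exclusive (yes x) (yes y) ¬both = contradiction y (¬both x)
    exclusive (yes x) (no _)  _     = refl
    exclusive (no _)  _       _     = refl

  -- Level sets, dyadic summation and the energy bound

  module _ (char : ∀ n → 0 < n → n < q → n · 1F ≢ 0F) (21t³≤q² : 21 * (t * t * t) ≤ q * q) where

    open Stepanov 𝔽 using (module Auxiliary)
    open Auxiliary char t using (stepanov)

    level-bound : ∀ τ → 1 ≤ τ → t ≤ τ * τ → level τ * (τ * τ * τ) ≤ K * (t * t)
    level-bound τ 1≤τ t≤τ² with 1 ≤? level τ | 12 ≤? t
    ... | no ¬1≤n | _ rewrite ℕ.n<1⇒n≡0 (ℕ.≰⇒> ¬1≤n) = z≤n
    -- For t < 12 the estimate n τ³ ≤ t³ is enough. For t ≥ 12 one has 12 n ≤ t², so that the order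
    -- D can be chosen positive.
    ... | yes 1≤n | no t≱12 = begin
      level τ * (τ * τ * τ) ≡⟨ eq (level τ) τ ⟩
      level τ * τ * (τ * τ) ≤⟨ ℕ.*-mono-≤ (level*τ≤t τ) (square-mono τ≤t) ⟩
      t * (t * t) ≤⟨ ℕ.*-monoˡ-≤ (t * t) (ℕ.≤-trans (ℕ.<⇒≤ (ℕ.≰⇒> t≱12)) 12≤K) ⟩
      K * (t * t) ∎
      where
      open ℕ.≤-Reasoning
      eq : ∀ n τ → n * (τ * τ * τ) ≡ n * τ * (τ * τ)
      eq = solve-∀
      τ≤t : τ ≤ t
      τ≤t = ℕ.≤-trans (ℕ.m≤n*m τ (level τ) {{ℕ.>-nonZero 1≤n}}) (level*τ≤t τ)
    ... | yes 1≤n | yes 12≤t = parameters-bound par τ L nτ≤L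
            (stepanov D B κs 1<q 0<t (subst (λ z → z * (D * (3 * D)) < B * (B * D)) n≡ room) D≤t BD≤t Bt≤q
              (ℕ.≤-trans D≤t (ℕ.≤-trans (ℕ.m≤n*m t B {{ℕ.>-nonZero 1≤B}}) Bt≤q)) κs≢0 us
              (Unique.filter⁺ us? (Unique.allFin⁺ q)) (All.map on-κs (All.all-filter us? (allFin q))))
      where
      12n≤t² : 12 * level τ ≤ t * t
      12n≤t² = ℕ.*-mono-≤ 12≤t (ℕ.≤-trans (ℕ.m≤m*n (level τ) τ {{ℕ.>-nonZero 1≤τ}}) (level*τ≤t τ))
      par = parameters (level τ) τ t q 1≤n 12n≤t² (level*τ≤t τ) t≤τ² 21t³≤q²
      open Parameters par
      κs? : Decidable (λ κ → τ ≤ M κ)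
      κs? κ = τ ≤? M κ
      κs = filter κs? (allFin q)
      n≡ : level τ ≡ length κs
      n≡ = ∑-⟦⟧ κs? id
      us? : Decidable (λ u → Good u × τ ≤ M (u ^ᶠ t))
      us? u = good? u ×-dec (τ ≤? M (u ^ᶠ t))
      us = filter us? (allFin q)
      L = length us
      nτ≤L : level τ * τ ≤ L
      nτ≤L = ℕ.≤-trans (level*τ≤ τ) (ℕ.≤-reflexive (trans (sum-cong-≗ (λ u → sym (⟦⟧-× (good? u) (τ ≤? M (u ^ᶠ t))))) (∑-⟦⟧ us? id)))
      κs≢0 : All (_≢ 0F) κs
      κs≢0 = All.map (λ { τ≤M refl → ℕ.<⇒≱ 1≤τ (ℕ.≤-trans τ≤M (ℕ.≤-reflexive M-0)) }) (All.all-filter κs? (allFin q))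
      on-κs : ∀ {u} → Good u × τ ≤ M (u ^ᶠ t) → u ^ᶠ t ∈ˡ κs × (u ⊞ ⊟ 1F) ^ᶠ t ≡ u ^ᶠ t
      on-κs {u} (good , τ≤M) = ∈-filter⁺ κs? (∈-allFin (u ^ᶠ t)) τ≤M , proj₁ good

    upper : ℕ → ℕ
    upper σ = ∑ (λ κ → ⟦ σ ≤? M κ ⟧ * (M κ * M κ))

    -- Values of M between σ and 2σ contribute at most 4 σ² each; larger ones are left to the next
    -- dyadic range.
    upper-halve : ∀ σ → upper σ ≤ level σ * (4 * (σ * σ)) + upper (2 * σ)
    upper-halve σ = begin
      upper σ ≤⟨ ∑-mono-≤ (λ κ → split (M κ) (σ ≤? M κ) (2 * σ ≤? M κ)) ⟩
      ∑ (λ κ → ⟦ σ ≤? M κ ⟧ * (4 * (σ * σ)) + ⟦ 2 * σ ≤? M κ ⟧ * (M κ * M κ))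
        ≡⟨ ∑-distrib-+ (λ κ → ⟦ σ ≤? M κ ⟧ * (4 * (σ * σ))) (λ κ → ⟦ 2 * σ ≤? M κ ⟧ * (M κ * M κ)) ⟩
      ∑ (λ κ → ⟦ σ ≤? M κ ⟧ * (4 * (σ * σ))) + upper (2 * σ)
        ≡⟨ cong (_+ upper (2 * σ)) (sym (*-distribʳ-sum (4 * (σ * σ)) (λ κ → ⟦ σ ≤? M κ ⟧))) ⟩
      level σ * (4 * (σ * σ)) + upper (2 * σ) ∎
      where
      open ℕ.≤-Reasoning
      expand : ∀ σ → (2 * σ) * (2 * σ) ≡ 4 * (σ * σ)
      expand = solve-∀
      split : ∀ m (d : Dec (σ ≤ m)) (e : Dec (2 * σ ≤ m)) → ⟦ d ⟧ * (m * m) ≤ ⟦ d ⟧ * (4 * (σ * σ)) + ⟦ e ⟧ * (m * m)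
      split m (no _)  _       = z≤n
      split m (yes _) (yes _) = ℕ.m≤n+m (1 * (m * m)) (1 * (4 * (σ * σ)))
      split m (yes _) (no lt) = ℕ.≤-trans (ℕ.*-monoʳ-≤ 1 (ℕ.≤-trans (square-mono (ℕ.<⇒≤ (ℕ.≰⇒> lt))) (ℕ.≤-reflexive (expand σ)))) (ℕ.m≤m+n _ 0)

    -- Since `level σ` is at most K t² / σ³, the dyadic blocks decay like 1/σ. The constant 8 is the
    -- fixed point of the recursion, half coming from the block and half from the tail. k is fuel:
    -- doubling raises σ by at least 1 until it exceeds t, and no M κ is larger than t.
    upper-bound : ∀ k σ → t < k + σ → 1 ≤ σ → t ≤ σ * σ → σ * upper σ ≤ 8 * (K * (t * t))
    upper-bound zero σ t<σ 1≤σ t≤σ² = ℕ.≤-trans (ℕ.≤-reflexive (trans (cong (σ *_) (∑-zero vanish)) (ℕ.*-zeroʳ σ))) z≤n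
      where
      vanish : ∀ κ → ⟦ σ ≤? M κ ⟧ * (M κ * M κ) ≡ 0
      vanish κ = cong (_* (M κ * M κ)) (⟦⟧-false (σ ≤? M κ) (λ σ≤M → ℕ.<⇒≱ t<σ (ℕ.≤-trans σ≤M (ℕ.≤-trans (term≤∑ M κ) ∑M≤t))))
    upper-bound (suc k) σ t<σ 1≤σ t≤σ² = ℕ.*-cancelˡ-≤ 2 (begin
      2 * (σ * upper σ) ≤⟨ ℕ.*-monoʳ-≤ 2 (ℕ.*-monoʳ-≤ σ (upper-halve σ)) ⟩
      2 * (σ * (level σ * (4 * (σ * σ)) + upper (2 * σ))) ≡⟨ expand σ (level σ) (upper (2 * σ)) ⟩
      8 * (level σ * (σ * σ * σ)) + 2 * σ * upper (2 * σ) ≤⟨ ℕ.+-mono-≤ (ℕ.*-monoʳ-≤ 8 (level-bound σ 1≤σ t≤σ²)) ih ⟩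
      8 * (K * (t * t)) + 8 * (K * (t * t)) ≡⟨ cong (_+_ (8 * (K * (t * t)))) (ℕ.+-identityʳ _) ⟨
      2 * (8 * (K * (t * t))) ∎)
      where
      open ℕ.≤-Reasoning
      expand : ∀ σ n s → 2 * (σ * (n * (4 * (σ * σ)) + s)) ≡ 8 * (n * (σ * σ * σ)) + 2 * σ * s
      expand = solve-∀
      σ≤2σ : σ ≤ 2 * σ
      σ≤2σ = ℕ.m≤m+n σ (σ + 0)
      ih = upper-bound k (2 * σ) (ℕ.≤-trans t<σ (ℕ.≤-trans (ℕ.≤-reflexive (sym (ℕ.+-suc k σ)))
             (ℕ.+-monoʳ-≤ k (ℕ.+-mono-≤ 1≤σ (ℕ.≤-reflexive (sym (ℕ.+-identityʳ σ))))))) (ℕ.≤-trans 1≤σ σ≤2σ) (ℕ.≤-trans t≤σ² (square-mono σ≤2σ))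

    -- The sum of M² is cut at σ of size √t: below, M² ≤ σ M and the M sum to at most t; above, the
    -- dyadic bound applies. Both parts have order t^(3/2). Multiplying by σ and squaring avoids the
    -- root, and 10 K absorbs 8 + 8 K.
    energy-bound : E * E ≤ 10 * K * (10 * K) * (t * t * (t * t) * t)
    energy-bound = ℕ.*-cancelˡ-≤ t (begin
      t * (E * E) ≤⟨ ℕ.*-monoˡ-≤ (E * E) t≤σ² ⟩
      σ * σ * (E * E) ≡⟨ eq₁ σ E ⟩
      σ * E * (σ * E) ≤⟨ square-mono σE≤ ⟩
      10 * K * (t * t * t) * (10 * K * (t * t * t)) ≡⟨ eq₂ (10 * K) t ⟩
      t * (10 * K * (10 * K) * (t * t * (t * t) * t)) ∎)
      where
      open ℕ.≤-Reasoning
      root = squareRoot t 0<t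
      σ = proj₁ root
      1≤σ = proj₁ (proj₂ root)
      t≤σ² = proj₁ (proj₂ (proj₂ root))
      σ²≤4t = proj₂ (proj₂ (proj₂ root))
      eq₁ : ∀ σ e → σ * σ * (e * e) ≡ σ * e * (σ * e)
      eq₁ = solve-∀
      eq₂ : ∀ k t → k * (t * t * t) * (k * (t * t * t)) ≡ t * (k * k * (t * t * (t * t) * t))
      eq₂ = solve-∀
      ∑M²≤ : ∑M² ≤ σ * t + upper σ
      ∑M²≤ = begin
        ∑M² ≤⟨ ∑-mono-≤ (λ κ → split (M κ) (σ ≤? M κ)) ⟩
        ∑ (λ κ → σ * M κ + ⟦ σ ≤? M κ ⟧ * (M κ * M κ)) ≡⟨ ∑-distrib-+ (λ κ → σ * M κ) (λ κ → ⟦ σ ≤? M κ ⟧ * (M κ * M κ)) ⟩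
        ∑ (λ κ → σ * M κ) + upper σ ≡⟨ cong (_+ upper σ) (sym (*-distribˡ-sum σ M)) ⟩
        σ * ∑ M + upper σ ≤⟨ ℕ.+-monoˡ-≤ (upper σ) (ℕ.*-monoʳ-≤ σ ∑M≤t) ⟩
        σ * t + upper σ ∎
        where
        split : ∀ m (d : Dec (σ ≤ m)) → m * m ≤ σ * m + ⟦ d ⟧ * (m * m)
        split m (yes _) = ℕ.≤-trans (ℕ.≤-reflexive (sym (ℕ.*-identityˡ (m * m)))) (ℕ.m≤n+m _ (σ * m))
        split m (no lt) = ℕ.≤-trans (ℕ.*-monoˡ-≤ m (ℕ.<⇒≤ (ℕ.≰⇒> lt))) (ℕ.m≤m+n _ 0)
      σ∑M²≤ : σ * ∑M² ≤ 4 * (t * t) + 8 * (K * (t * t))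
      σ∑M²≤ = begin
        σ * ∑M² ≤⟨ ℕ.*-monoʳ-≤ σ ∑M²≤ ⟩
        σ * (σ * t + upper σ) ≡⟨ eq σ t (upper σ) ⟩
        σ * σ * t + σ * upper σ ≤⟨ ℕ.+-mono-≤ (ℕ.*-monoˡ-≤ t σ²≤4t) (upper-bound (suc t) σ (ℕ.m≤m+n (suc t) σ) 1≤σ t≤σ²) ⟩
        4 * t * t + 8 * (K * (t * t)) ≡⟨ cong (_+ 8 * (K * (t * t))) (ℕ.*-assoc 4 t t) ⟩
        4 * (t * t) + 8 * (K * (t * t)) ∎
        where
        eq : ∀ σ t s → σ * (σ * t + s) ≡ σ * σ * t + σ * s
        eq = solve-∀
      σE≤ : σ * E ≤ 10 * K * (t * t * t)
      σE≤ = begin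
        σ * E ≤⟨ ℕ.*-monoʳ-≤ σ E≤ ⟩
        σ * (t * t + t * ∑M²) ≡⟨ eq₃ σ t ∑M² ⟩
        σ * (t * t) + t * (σ * ∑M²) ≤⟨ ℕ.+-mono-≤ (ℕ.*-monoˡ-≤ (t * t) (ℕ.≤-trans (ℕ.m≤m*n σ σ {{ℕ.>-nonZero 1≤σ}}) σ²≤4t)) (ℕ.*-monoʳ-≤ t σ∑M²≤) ⟩
        4 * t * (t * t) + t * (4 * (t * t) + 8 * (K * (t * t))) ≡⟨ eq₄ K t ⟩
        (8 + 8 * K) * (t * t * t) ≤⟨ ℕ.*-monoˡ-≤ (t * t * t) 8+8K≤10K ⟩
        10 * K * (t * t * t) ∎
        where
        eq₃ : ∀ σ t s → σ * (t * t + t * s) ≡ σ * (t * t) + t * (σ * s)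
        eq₃ = solve-∀
        8+8K≤10K : 8 + 8 * K ≤ 10 * K
        8+8K≤10K = ℕ.≤-trans (ℕ.+-monoˡ-≤ (8 * K) (ℕ.≤-trans (ℕ.≤-trans (ℕ.m≤m+n 8 4) 12≤K) (ℕ.m≤m+n K (K + 0))))
          (ℕ.≤-reflexive (sym (ℕ.*-distribʳ-+ K 2 8)))
        eq₄ : ∀ k t → 4 * t * (t * t) + t * (4 * (t * t) + 8 * (k * (t * t))) ≡ (8 + 8 * k) * (t * t * t)
        eq₄ = solve-∀

-- From the estimates to the theorem

open Arithmetic using (K; K≡; 12≤K; exponents₁; exponents₂; geometric; geometric-1; base≤; large-subgroup; constant-too-small)
open import Data.Nat using (_+_; _*_; _∸_; _≤_; _<_; _≤?_)
open import Data.Nat.Tactic.RingSolver using (solve-∀)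

-- Unnormalised rationals multiply without reducing fractions, so with denominator 1 only numerators
-- have to be compared.
fromℕ-power : ∀ c b x → ℚ.toℚᵘ ((fromℕ c ^ℚ b) ℚ.* fromℕ x) ℚᵘ.≃ mkℚᵘ (+ (c ℕ.^ b * x)) 0
fromℕ-power c b x = ℚᵘ.≃-trans (ℚ.toℚᵘ-homo-* (fromℕ c ^ℚ b) (fromℕ x))
  (ℚᵘ.≃-trans (ℚᵘ.*-cong (power b) (ℚ.toℚᵘ-fromℚᵘ (mkℚᵘ (+ x) 0))) (*-pos (c ℕ.^ b) x))
  where
  *-pos : ∀ m n → mkℚᵘ (+ m) 0 ℚᵘ.* mkℚᵘ (+ n) 0 ℚᵘ.≃ mkℚᵘ (+ (m * n)) 0
  *-pos m n = *≡* (cong (ℤ._* + 1) (sym (ℤ.pos-* m n)))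
  power : ∀ b → ℚ.toℚᵘ (fromℕ c ^ℚ b) ℚᵘ.≃ mkℚᵘ (+ (c ℕ.^ b)) 0
  power zero    = ℚᵘ.≃-refl
  power (suc b) = ℚᵘ.≃-trans (ℚ.toℚᵘ-homo-* (fromℕ c) (fromℕ c ^ℚ b))
    (ℚᵘ.≃-trans (ℚᵘ.*-cong (ℚ.toℚᵘ-fromℚᵘ (mkℚᵘ (+ c) 0)) (power b)) (*-pos c (c ℕ.^ b)))

power-≤ : ∀ c n a b m → fromℕ c · n ^[ a / b ]≤ m → c ℕ.^ b * n ℕ.^ a ≤ m ℕ.^ b
power-≤ c n a b m le = ℤ.drop‿+≤+ (subst₂ ℤ._≤_ (ℤ.*-identityʳ _) (ℤ.*-identityʳ _) (ℚᵘ.drop-*≤*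
  (ℚᵘ.≤-respˡ-≃ (fromℕ-power c b (n ℕ.^ a)) (ℚᵘ.≤-respʳ-≃ (ℚ.toℚᵘ-fromℚᵘ (mkℚᵘ (+ (m ℕ.^ b)) 0)) (ℚ.toℚᵘ-mono-≤ le)))))

-- The constant of E² ≤ C₀ t⁵. The same number serves as C: it is raised to the power 5l - 3 or 3l +
-- 3 in the hypothesis, but only to l + 1 in the bound for a missing element.
C₀ : ℕ
C₀ = 10 * K * (10 * K)

module Main (p : ℕ) .{{_ : NonZero p}} (p-prime : Prime p) (R : Subset p) (R-subgroup : IsMultiplicativeSubgroup R) where

  open PrimeField p p-prime
  open IsMultiplicativeSubgroup R-subgroup using (R⊆𝔽*; 𝟙∈R; ⊗-closed; ⁻¹-closed)
  private module F = CommutativeRing 𝔽ₚ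

  𝔽ₚ-finiteField : FiniteField p
  𝔽ₚ-finiteField = record
    { _⊞_ = _⊕_ ; _⊡_ = _⊗_ ; ⊟_ = ⊖_ ; 0F = 𝟘 ; 1F = 𝟙
    ; isCommutativeRing = ⊕-⊗-isCommutativeRing ; inverse = ⊗-inverse ; 1F≢0F = 𝟙≢𝟘 }

  isSubgroup : IsSubgroup 𝔽ₚ-finiteField R
  isSubgroup = record { R∌0 = R⊆𝔽* ; 1∈R = 𝟙∈R ; ⊡-closed = ⊗-closed ; inv-closed = ⁻¹-closed }

  open Subgroup 𝔽ₚ-finiteField R isSubgroup
  open Convolution 𝔽ₚ-finiteField using (cancelʳ′)
  open Sumsℤ using (∑; ∑-zero)

  nonzero-term : ∀ {n} (f : Fin n → ℤ) → ∑ f ≢ 0ℤ → ∃[ i ] f i ≢ 0ℤ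
  nonzero-term f ∑≢0 with any? (λ i → ¬? (f i ℤ.≟ 0ℤ))
  ... | yes found = found
  ... | no ¬found = contradiction (∑-zero (λ i → decidable-stable (f i ℤ.≟ 0ℤ) (λ ne → ¬found (i , ne)))) ∑≢0

  -- A finite search finds a nonzero term of the count; its factor χ y puts the first summand y into
  -- R, and its other factor yields the remaining summands by induction.
  rep≢0⇒∈sumset : ∀ k x → rep k x ≢ 0ℤ → (suc k -fold-sumset R) x
  rep≢0⇒∈sumset zero x χ≢0 with χ-cases x
  ... | inj₁ x∈R = (λ _ → x) , (λ _ → x∈R) , F.+-identityʳ x
  ... | inj₂ χ≡0 = contradiction χ≡0 χ≢0
  rep≢0⇒∈sumset (suc k) x rep≢0 with nonzero-term _ rep≢0
  ... | y , term≢0 with χ-cases y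
  ...   | inj₂ χ≡0 = contradiction (trans (cong (ℤ._* rep k (x ⊕ (⊖ (𝟙 ⊗ y)))) χ≡0) (ℤ.*-zeroˡ (rep k (x ⊕ (⊖ (𝟙 ⊗ y)))))) term≢0
  ...   | inj₁ y∈R with rep≢0⇒∈sumset k (x ⊕ (⊖ (𝟙 ⊗ y))) (λ rep≡0 → term≢0 (trans (cong (χ y ℤ.*_) rep≡0) (ℤ.*-zeroʳ (χ y))))
  ...     | r , r∈R , Σr≡ = (λ { zero → y ; (suc i) → r i }) , (λ { zero → y∈R ; (suc i) → r∈R i }) , (begin
    y ⊕ Σ𝔽 r ≡⟨ cong (y ⊕_) Σr≡ ⟩
    y ⊕ (x ⊕ (⊖ (𝟙 ⊗ y))) ≡⟨ cong (λ z → y ⊕ (x ⊕ (⊖ z))) (F.*-identityˡ y) ⟩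
    y ⊕ (x ⊕ (⊖ y)) ≡⟨ F.+-comm y _ ⟩
    x ⊕ (⊖ y) ⊕ y ≡⟨ cancelʳ′ x y ⟩
    x ∎)
    where open ≡-Reasoning

  -- With l = k + 1, a missing x gives t^(2l+2) ≤ v t, while k uses of the basic operator bound give
  -- v ≤ p^(l+1) t; then t² cancels.
  rep≢0₂ : ∀ k → p ℕ.^ (2 + k) < t ℕ.^ (2 * suc k) → ∀ {x} → x ≢ 𝟘 → rep k x ≢ 0ℤ
  rep≢0₂ k large {x} x≢0 rep≡0 = ℕ.<⇒≱ large (ℕ.*-cancelʳ-≤ _ _ (t * t) {{ℕ.m*n≢0 t t}} (begin
    t ℕ.^ (2 * suc k) * (t * t)
      ≡⟨ cong (λ z → t ℕ.^ z * (t * t)) (cong (_+_ (suc k)) (ℕ.+-identityʳ (suc k))) ⟩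
    t ℕ.^ (suc k + suc k) * (t * t)
      ≡⟨ cong (ℕ._* (t * t)) (ℕ.^-distribˡ-+-* t (suc k) (suc k)) ⟩
    t ℕ.^ suc k * t ℕ.^ suc k * (t * t)
      ≡⟨ eq₁ t (t ℕ.^ suc k) ⟩
    t ℕ.^ suc (suc k) * t ℕ.^ suc (suc k)
      ≤⟨ Missing.missing≤t x x≢0 k rep≡0 ⟩
    v k * t
      ≤⟨ ℕ.*-monoˡ-≤ t (geometric-1 v p v-suc≤q k) ⟩
    p ℕ.^ k * v 0 * t
      ≤⟨ ℕ.*-monoˡ-≤ t (ℕ.*-monoʳ-≤ (p ℕ.^ k) v₀≤) ⟩
    p ℕ.^ k * (p * p * t) * t
      ≡⟨ eq₂ (p ℕ.^ k) p t ⟩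
    p ℕ.^ (2 + k) * (t * t) ∎))
    where
    open ℕ.≤-Reasoning
    eq₁ : ∀ t T → T * T * (t * t) ≡ t * T * (t * T)
    eq₁ = solve-∀
    eq₂ : ∀ P p t → P * (p * p * t) * t ≡ p * (p * P) * (t * t)
    eq₂ = solve-∀

  module _ (i : ℕ) {x : Fin p} (x≢0 : x ≢ 𝟘) (rep≡0 : rep (3 + i) x ≡ 0ℤ) (21t³≤p² : 21 * (t * t * t) ≤ p * p) where

    private
      -- With l = 4 + i, j = l - 3 operator bounds lead from the two-fold count in `v 1` to the (l -
      -- 1)-fold count in `v (suc j)`; the last summand is absorbed by the adjoint.
      j = suc i
      E²≤ = Energy.energy-bound 𝔽ₚ-finiteField R isSubgroup ·𝟙≢𝟘 21t³≤p²
      missing = Missing.missing≤E x x≢0 (suc j) rep≡0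

    missing₁ : t ℕ.^ (5 * j + 12) ≤ C₀ ℕ.^ (4 + j) * p ℕ.^ (2 * j + 8)
    missing₁ = exponents₁ t p E C₀ (v 1) (v (suc j)) j E²≤ v₁≤
      (geometric (λ k → v (suc k) * v (suc k)) t (p * E) (λ k → v-suc²≤ (suc k)) j) missing

    missing₂ : t ℕ.^ (3 * j + 12) ≤ C₀ ℕ.^ (4 + j) * p ℕ.^ (j + 8)
    missing₂ = exponents₂ t p E C₀ (v 1) (v (suc j)) j E²≤ v₁≤
      (geometric-1 (λ k → v (suc k) * v (suc k) * (v (suc k) * v (suc k))) (p * (E * E)) (λ k → v-suc⁴≤ (suc k)) j) missing

  21⁵≤C₀ : 4084101 ≤ C₀
  21⁵≤C₀ = subst (λ k → 4084101 ≤ 10 * k * (10 * k)) K≡ (ℕ.≤ᵇ⇒≤ 4084101 (10 * 248832 * (10 * 248832)) _)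

  1<C₀ : 1 < C₀
  1<C₀ = ℕ.≤-trans (ℕ.≤ᵇ⇒≤ 2 4084101 _) 21⁵≤C₀

  Large : ℕ → Set
  Large j = C₀ ℕ.^ (5 * j + 12) * p ℕ.^ (2 * j + 8) ≤ t ℕ.^ (5 * j + 12) ⊎
            C₀ ℕ.^ (3 * j + 12) * p ℕ.^ (j + 8) ≤ t ℕ.^ (3 * j + 12)

  Large⇒C₀≤t : ∀ i → Large (suc i) → C₀ ≤ t
  Large⇒C₀≤t i (inj₁ le) = base≤ C₀ (p ℕ.^ (2 * suc i + 8)) t (5 * suc i + 12) {{_}} {{ℕ.m^n≢0 p (2 * suc i + 8)}} le
  Large⇒C₀≤t i (inj₂ le) = base≤ C₀ (p ℕ.^ (suc i + 8)) t (3 * suc i + 12) {{_}} {{ℕ.m^n≢0 p (suc i + 8)}} le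

  exponent-< : ∀ c j → 4 + j < suc c * j + 12
  exponent-< c j = ℕ.≤-trans (ℕ.≤-reflexive (ℕ.+-comm 5 j)) (ℕ.+-mono-≤ (ℕ.m≤m+n j (c * j)) (ℕ.m≤m+n 5 7))

  rep≢0₁ : ∀ i → Large (suc i) → ∀ {x} → x ≢ 𝟘 → rep (3 + i) x ≢ 0ℤ
  rep≢0₁ i large {x} x≢0 rep≡0 with 21 * (t * t * t) ≤? p * p | large
  ... | no p²<21t³ | _ =
    rep≢0₂ (3 + i) (large-subgroup t p i (ℕ.≤-trans 21⁵≤C₀ (Large⇒C₀≤t i large)) (ℕ.≰⇒> p²<21t³)) x≢0 rep≡0
  ... | yes 21t³≤p² | inj₁ le = constant-too-small C₀ 1<C₀ (p ℕ.^ (2 * suc i + 8)) {{ℕ.m^n≢0 p (2 * suc i + 8)}}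
    (exponent-< 4 (suc i)) (ℕ.≤-trans le (missing₁ i x≢0 rep≡0 21t³≤p²))
  ... | yes 21t³≤p² | inj₂ le = constant-too-small C₀ 1<C₀ (p ℕ.^ (suc i + 8)) {{ℕ.m^n≢0 p (suc i + 8)}}
    (exponent-< 2 (suc i)) (ℕ.≤-trans le (missing₂ i x≢0 rep≡0 21t³≤p²))

theorem2p6 : (∃[ C ] (Positive C ×
    (∀ (p : ℕ) .{{_ : NonZero p}} → Prime p →
    ∀ (R : Subset p) → IsMultiplicativeSubgroup R →
    ∀ (l : ℕ) → 4 ≤ l →
    C ·min[ p ^ (2 * l + 2) / (5 * l ∸ 3) , p ^ (l + 5) / (3 * l + 3) ]≤ ∣ R ∣ →
    𝔽* ⊆ (l -fold-sumset R))))
    ×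
    (∀ (p : ℕ) .{{_ : NonZero p}} → Prime p →
    ∀ (R : Subset p) → IsMultiplicativeSubgroup R →
    ∀ (l : ℕ) → 2 ≤ l →
    p ^[ (l + 1) / (2 * l) ]< ∣ R ∣ →
    𝔽* ⊆ (l -fold-sumset R))
theorem2p6 = (fromℕ C₀ , ℚ.normalize-pos C₀ 1 {{_}} {{C₀≢0}} , part₁) , part₂
  where
  C₀≢0 : NonZero C₀
  C₀≢0 = ℕ.m*n≢0 (10 * K) (10 * K) {{10K≢0}} {{10K≢0}}
    where
    10K≢0 : NonZero (10 * K)
    10K≢0 = ℕ.m*n≢0 10 K {{_}} {{ℕ.>-nonZero (ℕ.≤-trans (s≤s z≤n) 12≤K)}}

  part₁ : ∀ (p : ℕ) .{{_ : NonZero p}} → Prime p → ∀ (R : Subset p) → IsMultiplicativeSubgroup R →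
    ∀ (l : ℕ) → 4 ≤ l → fromℕ C₀ ·min[ p ^ (2 * l + 2) / (5 * l ∸ 3) , p ^ (l + 5) / (3 * l + 3) ]≤ ∣ R ∣ →
    𝔽* ⊆ (l -fold-sumset R)
  part₁ p p-prime R R-subgroup (suc (suc (suc (suc i)))) (s≤s (s≤s (s≤s (s≤s z≤n)))) large {x} x≢0 =
    rep≢0⇒∈sumset (3 + i) x (rep≢0₁ i (bound large) x≢0)
    where
    open Main p p-prime R R-subgroup
    -- In terms of j = l - 3 = suc i the two fractions become (2 j + 8) / (5 j + 12) and (j + 8) /
    -- (3 j + 12).
    e₁ : ∀ i → 5 * (4 + i) ≡ 5 * suc i + 12 + 3
    e₁ = solve-∀
    e₂ : ∀ i → 2 * (4 + i) + 2 ≡ 2 * suc i + 8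
    e₂ = solve-∀
    e₃ : ∀ i → 3 * (4 + i) + 3 ≡ 3 * suc i + 12
    e₃ = solve-∀
    e₄ : ∀ i → 4 + i + 5 ≡ suc i + 8
    e₄ = solve-∀
    bound : fromℕ C₀ ·min[ p ^ (2 * (4 + i) + 2) / (5 * (4 + i) ∸ 3) , p ^ (4 + i + 5) / (3 * (4 + i) + 3) ]≤ ∣ R ∣ →
            C₀ ℕ.^ (5 * suc i + 12) * p ℕ.^ (2 * suc i + 8) ≤ ∣ R ∣ ℕ.^ (5 * suc i + 12) ⊎
            C₀ ℕ.^ (3 * suc i + 12) * p ℕ.^ (suc i + 8) ≤ ∣ R ∣ ℕ.^ (3 * suc i + 12)
    bound (inj₁ le) = inj₁ (subst₂ (λ a b → C₀ ℕ.^ b * p ℕ.^ a ≤ ∣ R ∣ ℕ.^ b) (e₂ i)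
      (trans (cong (_∸ 3) (e₁ i)) (ℕ.m+n∸n≡m (5 * suc i + 12) 3)) (power-≤ C₀ p (2 * (4 + i) + 2) (5 * (4 + i) ∸ 3) ∣ R ∣ le))
    bound (inj₂ le) = inj₂ (subst₂ (λ a b → C₀ ℕ.^ b * p ℕ.^ a ≤ ∣ R ∣ ℕ.^ b) (e₄ i) (e₃ i)
      (power-≤ C₀ p (4 + i + 5) (3 * (4 + i) + 3) ∣ R ∣ le))

  part₂ : ∀ (p : ℕ) .{{_ : NonZero p}} → Prime p → ∀ (R : Subset p) → IsMultiplicativeSubgroup R →
    ∀ (l : ℕ) → 2 ≤ l → p ^[ (l + 1) / (2 * l) ]< ∣ R ∣ → 𝔽* ⊆ (l -fold-sumset R)
  part₂ p p-prime R R-subgroup (suc k) 2≤l large {x} x≢0 =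
    rep≢0⇒∈sumset k x (rep≢0₂ k (subst (λ a → p ℕ.^ a < ∣ R ∣ ℕ.^ (2 * suc k)) (ℕ.+-comm (suc k) 1) large) x≢0)
    where open Main p p-prime R R-subgroup
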